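{- For every $n\geq 1$, the set theory $\mathsf{ReS}_0+\mathsf{Sep}(\Sigma_n)$ interprets the arithmetical theory $I\Sigma_n$.
   Context: Interpretability: for first-order theories $S,T$, "$T$ interprets $S$" means that a fixed finite family of parameter-free formulas in the language of $T$ defines, in every model of $T$, a nonempty quotient structure satisfying $S$; the formulas specify the domain, an equivalence relation on that domain (serving as equality), and the interpretations of the relations and functions of $S$. Arithmetic: $I\Sigma_n$ is $\mathsf{PA}^{ - }$ (nonnegative parts of discretely ordered rings) plus induction for arithmetical $\Sigma_n$ formulas (with parameters). Set theories are in the first-order language $\{\in\}$. $\Delta_0$ formulas contain only quantifiers $\forall x\in a$, $\exists x\in a$; $\Sigma_n$ and $\Pi_n$ formulas (Lévy hierarchy) are obtained from $\Delta_0$ formulas by strict alternation of unbounded quantifier blocks in prenex form. $\mathsf{ReS}_0$ consists of Extensionality, Empty Set, Pairing, Set Difference ($x\setminus y$ exists), Union, and Separation for $\Delta_0$ formulas. $\mathsf{Sep}(\Gamma)$ is the Separation scheme: for every $\varphi\in\Gamma$, every set $a$ and parameters $\bar p$, the set $\{x\in a:\varphi(x,\bar p)\}$ exists. (No Foundation is assumed.) -}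

module Defs where

open import Data.Empty.Polymorphic using (⊥)
open import Data.Fin using (Fin; zero; suc; #_; _↑ʳ_)
open import Data.Nat using (ℕ; zero; suc; _≤?_)
open import Data.Product using (Σ-syntax; ∃-syntax; _×_; proj₁)
open import Data.Sum using (_⊎_)
open import Data.Vec using (Vec; []; _∷_; lookup; map)
open import Data.Vec.Functional using (Vector) renaming (_∷_ to _▹_)
open import Data.Vec.Relation.Binary.Pointwise.Inductive using (Pointwise)
open import Function using (_∘_)
open import Level using (Level; 0ℓ; Setω) renaming (suc to lsuc)
open import Relation.Binary using (Rel; IsEquivalence)
open import Relation.Nullary using (¬_; Stable)
open import Relation.Nullary.Decidable using (True)
open import Relation.Unary using (Pred; _∪_)

record Language : Set₁ where
  field
    Func : ℕ → Set
    Reln : ℕ → Set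

open Language

-- Terms and formulas whose free variables are the de Bruijn indices below k.

data Term (L : Language) (k : ℕ) : Set where
  var : Fin k → Term L k
  app : ∀ {m} → Func L m → Vec (Term L k) m → Term L k

infix  8 _≐_
infixr 7 _∧′_
infixr 6 _∨′_
infixr 5 _⇒_

data Formula (L : Language) : ℕ → Set where
  _≐_            : ∀ {k} → Term L k → Term L k → Formula L k
  rel            : ∀ {k m} → Reln L m → Vec (Term L k) m → Formula L k
  ⊥′             : ∀ {k} → Formula L k
  _∧′_ _∨′_ _⇒_  : ∀ {k} → Formula L k → Formula L k → Formula L k
  ∀′ ∃′          : ∀ {k} → Formula L (suc k) → Formula L k

module _ {L : Language} where
  infix 5 _⇔_
  infix 9 ¬′_

  ¬′_ : ∀ {k} → Formula L k → Formula L k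
  ¬′ φ = φ ⇒ ⊥′

  _⇔_ : ∀ {k} → Formula L k → Formula L k → Formula L k
  φ ⇔ ψ = (φ ⇒ ψ) ∧′ (ψ ⇒ φ)

  v : ∀ m {k} {m<k : True (suc m ≤? k)} → Term L k
  v m {m<k = m<k} = var (#_ m {m<n = m<k})

  mutual
    substᵗ : ∀ {m n} → Vector (Term L n) m → Term L m → Term L n
    substᵗ σ (var i)    = σ i
    substᵗ σ (app f ts) = app f (substᵗˢ σ ts)

    substᵗˢ : ∀ {m n l} → Vector (Term L n) m → Vec (Term L m) l → Vec (Term L n) l
    substᵗˢ σ []       = []
    substᵗˢ σ (t ∷ ts) = substᵗ σ t ∷ substᵗˢ σ ts

  weaken : ∀ {k} → Term L k → Term L (suc k)
  weaken = substᵗ (var ∘ suc)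

  lift : ∀ {m n} → Vector (Term L n) m → Vector (Term L (suc n)) (suc m)
  lift σ = var zero ▹ (weaken ∘ σ)

  infix 10 _[_]

  _[_] : ∀ {m n} → Formula L m → Vector (Term L n) m → Formula L n
  (t ≐ u)    [ σ ] = substᵗ σ t ≐ substᵗ σ u
  rel R ts   [ σ ] = rel R (substᵗˢ σ ts)
  ⊥′         [ σ ] = ⊥′
  (φ ∧′ ψ)   [ σ ] = φ [ σ ] ∧′ ψ [ σ ]
  (φ ∨′ ψ)   [ σ ] = φ [ σ ] ∨′ ψ [ σ ]
  (φ ⇒ ψ)    [ σ ] = φ [ σ ] ⇒ ψ [ σ ]
  (∀′ φ)     [ σ ] = ∀′ (φ [ lift σ ])
  (∃′ φ)     [ σ ] = ∃′ (φ [ lift σ ])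

  close : ∀ {k} → Formula L k → Formula L 0
  close {zero}  φ = φ
  close {suc k} φ = close (∀′ φ)

Theory : Language → Set₁
Theory L = Pred (Formula L 0) 0ℓ

FormulaClass : Language → Set₁
FormulaClass L = ∀ {k} → Pred (Formula L k) 0ℓ

-- Quantifier hierarchy over formulas whose quantifiers are bounded by a
-- binary relation symbol R: membership gives the Lévy hierarchy, the order
-- of arithmetic gives the arithmetical one.

module _ {L : Language} (R : Reln L 2) where

  -- The bound is weakened, so the bound variable does not occur in it.

  data Δ₀ : FormulaClass L where
    eq    : ∀ {k} (t u : Term L k) → Δ₀ (t ≐ u)
    atom  : ∀ {k m} (S : Reln L m) (ts : Vec (Term L k) m) → Δ₀ (rel S ts)
    false : ∀ {k} → Δ₀ {k} ⊥′
    and   : ∀ {k} {φ ψ : Formula L k} → Δ₀ φ → Δ₀ ψ → Δ₀ (φ ∧′ ψ)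
    or    : ∀ {k} {φ ψ : Formula L k} → Δ₀ φ → Δ₀ ψ → Δ₀ (φ ∨′ ψ)
    imp   : ∀ {k} {φ ψ : Formula L k} → Δ₀ φ → Δ₀ ψ → Δ₀ (φ ⇒ ψ)
    ball  : ∀ {k} (t : Term L k) {φ : Formula L (suc k)} → Δ₀ φ →
            Δ₀ (∀′ (rel R (var zero ∷ weaken t ∷ []) ⇒ φ))
    bex   : ∀ {k} (t : Term L k) {φ : Formula L (suc k)} → Δ₀ φ →
            Δ₀ (∃′ (rel R (var zero ∷ weaken t ∷ []) ∧′ φ))

  -- A quantifier block may be empty, so that Σₙ₊₁ contains Σₙ and Πₙ.  Up to
  -- dummy quantifiers these are the formulas with exactly n nonempty blocks.

  mutual
    data Σₙ : ℕ → FormulaClass L where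
      Δ₀⇒Σ : ∀ {k} {φ : Formula L k} → Δ₀ φ → Σₙ 0 φ
      Π⇒Σ  : ∀ {n k} {φ : Formula L k} → Πₙ n φ → Σₙ (suc n) φ
      ex   : ∀ {n k} {φ : Formula L (suc k)} → Σₙ (suc n) φ → Σₙ (suc n) (∃′ φ)

    data Πₙ : ℕ → FormulaClass L where
      Δ₀⇒Π : ∀ {k} {φ : Formula L k} → Δ₀ φ → Πₙ 0 φ
      Σ⇒Π  : ∀ {n k} {φ : Formula L k} → Σₙ n φ → Πₙ (suc n) φ
      all  : ∀ {n k} {φ : Formula L (suc k)} → Πₙ (suc n) φ → Πₙ (suc n) (∀′ φ)

-- Classical truth values are ¬¬-stable types: relations are required to be
-- stable, and classical disjunction and existence are the double negations of
-- _⊎_ and ∃.  As there are no quotient types, equality is a congruence _≈_;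
-- as there is no unique choice for classical existence, an m-ary function is
-- given by its graph, total and single-valued up to _≈_.

record RawStructure (L : Language) (ℓ : Level) : Set (lsuc ℓ) where
  infix 4 _≈_
  field
    Carrier : Set ℓ
    _≈_     : Rel Carrier ℓ
    graph   : ∀ {m} → Func L m → Vec Carrier m → Carrier → Set ℓ
    holds   : ∀ {m} → Reln L m → Vec Carrier m → Set ℓ

record IsStructure {L : Language} {ℓ : Level} (M : RawStructure L ℓ) : Set ℓ where
  open RawStructure M
  field
    nonempty      : ¬ ¬ Carrier
    isEquivalence : IsEquivalence _≈_
    ≈-stable      : ∀ {a b} → Stable (a ≈ b)
    graph-stable  : ∀ {m} (f : Func L m) {xs a} → Stable (graph f xs a)
    graph-cong    : ∀ {m} (f : Func L m) {xs ys a b} →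
                    Pointwise _≈_ xs ys → a ≈ b → graph f xs a → graph f ys b
    graph-total   : ∀ {m} (f : Func L m) xs → ¬ ¬ (∃[ a ] graph f xs a)
    graph-unique  : ∀ {m} (f : Func L m) {xs a b} →
                    graph f xs a → graph f xs b → a ≈ b
    holds-stable  : ∀ {m} (R : Reln L m) {xs} → Stable (holds R xs)
    holds-cong    : ∀ {m} (R : Reln L m) {xs ys} →
                    Pointwise _≈_ xs ys → holds R xs → holds R ys

module _ {L : Language} {ℓ : Level} (M : RawStructure L ℓ) where
  open RawStructure M

  -- Value ρ t a: the term t takes the value a under the assignment ρ.

  data Value {k} (ρ : Vec Carrier k) : Term L k → Carrier → Set ℓ where
    val-var : ∀ {i a} → lookup ρ i ≈ a → Value ρ (var i) a
    val-app : ∀ {m} {f : Func L m} {ts as a} →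
              Pointwise (Value ρ) ts as → graph f as a → Value ρ (app f ts) a

  -- Values of terms exist classically and are unique up to _≈_, so in the
  -- atomic clauses "for all values" amounts to "for the value".

  Sat : ∀ {k} → Formula L k → Vec Carrier k → Set ℓ
  Sat (t ≐ u)    ρ = ∀ a b → Value ρ t a → Value ρ u b → a ≈ b
  Sat (rel R ts) ρ = ∀ as → Pointwise (Value ρ) ts as → holds R as
  Sat ⊥′         ρ = ⊥
  Sat (φ ∧′ ψ)   ρ = Sat φ ρ × Sat ψ ρ
  Sat (φ ∨′ ψ)   ρ = ¬ ¬ (Sat φ ρ ⊎ Sat ψ ρ)
  Sat (φ ⇒ ψ)    ρ = Sat φ ρ → Sat ψ ρ
  Sat (∀′ φ)     ρ = ∀ a → Sat φ (a ∷ ρ)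
  Sat (∃′ φ)     ρ = ¬ ¬ (∃[ a ] Sat φ (a ∷ ρ))

infix 4 _⊨_

_⊨_ : ∀ {L ℓ} → RawStructure L ℓ → Theory L → Set ℓ
M ⊨ T = ∀ φ → T φ → Sat M φ []

-- Formulas of L′ without parameters.  In the formula for the graph of a
-- function, variable 0 is the value and the others are the arguments.

record Interpretation (L L′ : Language) : Set where
  field
    domain   : Formula L′ 1
    equality : Formula L′ 2
    function : ∀ {m} → Func L m → Formula L′ (suc m)
    relation : ∀ {m} → Reln L m → Formula L′ m

defined : ∀ {L L′ ℓ} → Interpretation L L′ → RawStructure L′ ℓ → RawStructure L ℓ
defined I M = record
  { Carrier = Σ[ a ∈ Carrier ] Sat M domain (a ∷ [])
  ; _≈_     = λ a b → Sat M equality (proj₁ a ∷ proj₁ b ∷ [])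
  ; graph   = λ f as b → Sat M (function f) (proj₁ b ∷ map proj₁ as)
  ; holds   = λ R as → Sat M (relation R) (map proj₁ as)
  }
  where
  open RawStructure M using (Carrier)
  open Interpretation I

-- The interpretation is fixed before the model, whose universe is arbitrary.

record _Interprets_ {L L′ : Language} (T : Theory L′) (S : Theory L) : Setω where
  field
    interpretation : Interpretation L L′
    isStructure    : ∀ {ℓ} (M : RawStructure L′ ℓ) → IsStructure M → M ⊨ T →
                     IsStructure (defined interpretation M)
    isModel        : ∀ {ℓ} (M : RawStructure L′ ℓ) → IsStructure M → M ⊨ T →
                     defined interpretation M ⊨ S

data NoSymbol : ℕ → Set where

data SetReln : ℕ → Set where
  mem : SetReln 2

ℒ∈ : Language
ℒ∈ = record { Func = NoSymbol ; Reln = SetReln }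

infix 8 _∈′_

_∈′_ : ∀ {k} → Term ℒ∈ k → Term ℒ∈ k → Formula ℒ∈ k
t ∈′ u = rel mem (t ∷ u ∷ [])

-- In φ, variable 0 is the element and the others are the parameters; the
-- substitution makes room for a and b: ∀ p̄ ∀ a ∃ b ∀ x (x ∈ b ⇔ x ∈ a ∧ φ(x,p̄)).

separation : ∀ {k} → Formula ℒ∈ (suc k) → Formula ℒ∈ 0
separation φ = close (∀′ (∃′ (∀′
  (v 0 ∈′ v 1 ⇔ v 0 ∈′ v 2 ∧′ φ [ var zero ▹ (λ i → var (3 ↑ʳ i)) ]))))

data Sep (Γ : FormulaClass ℒ∈) : Theory ℒ∈ where
  sep : ∀ {k} {φ : Formula ℒ∈ (suc k)} → Γ φ → Sep Γ (separation φ)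

data ReS₀-Basic : Theory ℒ∈ where
  extensionality : ReS₀-Basic (∀′ (∀′ (∀′ (v 0 ∈′ v 2 ⇔ v 0 ∈′ v 1) ⇒ v 1 ≐ v 0)))
  emptySet       : ReS₀-Basic (∃′ (∀′ (¬′ (v 0 ∈′ v 1))))
  pairing        : ReS₀-Basic (∀′ (∀′ (∃′ (∀′
                     (v 0 ∈′ v 1 ⇔ v 0 ≐ v 3 ∨′ v 0 ≐ v 2)))))
  difference     : ReS₀-Basic (∀′ (∀′ (∃′ (∀′
                     (v 0 ∈′ v 1 ⇔ v 0 ∈′ v 3 ∧′ ¬′ (v 0 ∈′ v 2))))))
  union          : ReS₀-Basic (∀′ (∃′ (∀′
                     (v 0 ∈′ v 1 ⇔ ∃′ (v 0 ∈′ v 3 ∧′ v 1 ∈′ v 0)))))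

ReS₀ : Theory ℒ∈
ReS₀ = ReS₀-Basic ∪ Sep (Δ₀ mem)

data ArithFunc : ℕ → Set where
  zeroᶠ oneᶠ   : ArithFunc 0
  plusᶠ timesᶠ : ArithFunc 2

data ArithReln : ℕ → Set where
  less : ArithReln 2

ℒA : Language
ℒA = record { Func = ArithFunc ; Reln = ArithReln }

module _ {k : ℕ} where
  infixl 11 _·′_
  infixl 10 _+′_
  infix  8 _<′_ _≤′_

  0′ 1′ : Term ℒA k
  0′ = app zeroᶠ []
  1′ = app oneᶠ []

  _+′_ _·′_ : Term ℒA k → Term ℒA k → Term ℒA k
  t +′ u = app plusᶠ (t ∷ u ∷ [])
  t ·′ u = app timesᶠ (t ∷ u ∷ [])

  _<′_ _≤′_ : Term ℒA k → Term ℒA k → Formula ℒA k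
  t <′ u = rel less (t ∷ u ∷ [])
  t ≤′ u = t <′ u ∨′ t ≐ u

data PA⁻ : Theory ℒA where
  +-assoc    : PA⁻ (close {k = 3} ((v 0 +′ v 1) +′ v 2 ≐ v 0 +′ (v 1 +′ v 2)))
  +-comm     : PA⁻ (close {k = 2} (v 0 +′ v 1 ≐ v 1 +′ v 0))
  ·-assoc    : PA⁻ (close {k = 3} ((v 0 ·′ v 1) ·′ v 2 ≐ v 0 ·′ (v 1 ·′ v 2)))
  ·-comm     : PA⁻ (close {k = 2} (v 0 ·′ v 1 ≐ v 1 ·′ v 0))
  ·-distrib  : PA⁻ (close {k = 3} (v 0 ·′ (v 1 +′ v 2) ≐ v 0 ·′ v 1 +′ v 0 ·′ v 2))
  +-identity : PA⁻ (close {k = 1} (v 0 +′ 0′ ≐ v 0))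
  ·-zero     : PA⁻ (close {k = 1} (v 0 ·′ 0′ ≐ 0′))
  ·-identity : PA⁻ (close {k = 1} (v 0 ·′ 1′ ≐ v 0))
  <-trans    : PA⁻ (close {k = 3} (v 0 <′ v 1 ∧′ v 1 <′ v 2 ⇒ v 0 <′ v 2))
  <-irrefl   : PA⁻ (close {k = 1} (¬′ (v 0 <′ v 0)))
  <-total    : PA⁻ (close {k = 2} (v 0 <′ v 1 ∨′ v 0 ≐ v 1 ∨′ v 1 <′ v 0))
  +-mono     : PA⁻ (close {k = 3} (v 0 <′ v 1 ⇒ v 0 +′ v 2 <′ v 1 +′ v 2))
  ·-mono     : PA⁻ (close {k = 3} (0′ <′ v 2 ∧′ v 0 <′ v 1 ⇒ v 0 ·′ v 2 <′ v 1 ·′ v 2))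
  subtract   : PA⁻ (close {k = 2} (v 0 <′ v 1 ⇒ ∃′ (v 1 +′ v 0 ≐ v 2)))
  0<1        : PA⁻ (0′ <′ 1′)
  discrete   : PA⁻ (close {k = 1} (0′ <′ v 0 ⇒ 1′ ≤′ v 0))
  nonneg     : PA⁻ (close {k = 1} (0′ ≤′ v 0))

-- In φ, variable 0 is the induction variable and the others are the parameters.

induction : ∀ {k} → Formula ℒA (suc k) → Formula ℒA 0
induction φ = close
  (φ [ 0′ ▹ var ] ∧′ ∀′ (φ ⇒ φ [ (v 0 +′ 1′) ▹ (λ i → var (suc i)) ]) ⇒ ∀′ φ)

data Ind (Γ : FormulaClass ℒA) : Theory ℒA where
  ind : ∀ {k} {φ : Formula ℒA (suc k)} → Γ φ → Ind Γ (induction φ)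

IΣ : ℕ → Theory ℒA
IΣ n = PA⁻ ∪ Ind (Σₙ less n)

{-# OPTIONS --safe #-}

-- A number is a transitive set x, each member of x ∪ {x} being empty or a successor,
-- that no set shows to be ill-founded; the order is ∈.  This is Π₁, which would ruin
-- the complexity of relativised quantifiers.  But if some x has all Δ₀ properties of
-- numbers without being one, then it contains all numbers, and Σ₁-Separation turns
-- them into a set.  In either case numberhood is Δ₀ in a parameter.  Sums and products
-- are read off sets of pairs that record the recursion; these exist by induction and
-- determine the values, so the operations are Δ₁.  By Σ₁-collection below a number,
-- Δ₀ formulas of arithmetic become Δ₁, hence Σₙ formulas become Σₙ, and separation
-- with well-foundedness yields induction.  PA⁻ follows by induction on atomic formulas.
module Submission where

-- The interpreting formulas are fixed before the model and have no parameters, whereas the Δ₀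
-- definition `δ` of numberhood and its parameter `p` depend on the model and exist only
-- classically. So the domain stays Π₁, while `δ` and `p` enter the verification alone, always
-- inside the proof of a stable statement. There is no axiom of Infinity, power set or replacement:
-- neither a set of all numbers nor a product of two sets is at hand to bound a recursion in
-- advance. Each existence proof therefore enlarges given sets by finitely many elements at a time;
-- hence the sets W that hold all the data of a computation, and the merging of several witnesses
-- into one set. Without Foundation, even x ∉ x and the transitivity of the members of a number have
-- to come out of the induction clause. The bound n ≥ 1 matters twice. Recursion rests on
-- Σ₁-Separation, and the Δ₁ form of an arithmetical matrix brings one unbounded quantifier, which
-- needs a block to merge into: an existential one for the Σ₁ form, a universal one for the Π₁ form.
-- For this reason relations are treated together with their complements.

open import Defs
open import Data.Empty using (⊥-elim)
open import Data.Empty.Polymorphic using (⊥)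
open import Data.Fin using (Fin; zero; suc; #_; _↑ˡ_; _↑ʳ_)
open import Data.List using (List; []; _∷_)
open import Data.List.Relation.Unary.All as All using (All; []; _∷_)
open import Data.Nat using (ℕ; zero; suc; _+_; _≤_; s≤s)
open import Data.Product using (Σ; Σ-syntax; ∃-syntax; _×_; _,_; proj₁; proj₂)
open import Data.Sum using (_⊎_; inj₁; inj₂; [_,_])
open import Data.Vec using (Vec; []; _∷_; lookup; map; _++_; head; tail; take; drop; allFin)
open import Data.Vec.Functional using (Vector) renaming (_∷_ to _▹_)
open import Data.Vec.Properties using (lookup-map; map-∘; map-++; map-cong; map-lookup-allFin; take++drop≡id; lookup-++ˡ; lookup-++ʳ)
open import Data.Vec.Relation.Binary.Pointwise.Inductive as Pointwise using (Pointwise; []; _∷_)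
open import Data.Unit using (⊤)
open import Function using (_∘_; id)
open import Level using (Lift) renaming (suc to lsuc; _⊔_ to _⊔ˡ_)
open import Relation.Binary using (IsEquivalence; Setoid)
open import Relation.Binary.PropositionalEquality using (_≡_; refl; sym; trans; cong; cong₂; subst)
open import Relation.Nullary using (¬_; Stable; yes; no)
open import Relation.Nullary.Decidable using (¬¬-excluded-middle)
open import Relation.Nullary.Negation using (contradiction; ¬¬-map; negated-stable)
import Relation.Binary.Reasoning.Setoid as SetoidReasoning
open import Relation.Unary using (_∪_)

-- Classical reasoning

infixl 0 _>>=_

-- Bind of the double-negation monad. A `do` block extracts classical witnesses, and a `where`
-- alternative inside it settles the other case of a classical disjunction.
_>>=_ : ∀ {a b} {A : Set a} {B : Set b} → ¬ ¬ A → (A → ¬ ¬ B) → ¬ ¬ B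
m >>= f = negated-stable (¬¬-map f m)

return : ∀ {a} {A : Set a} → A → ¬ ¬ A
return = contradiction

infix 0 _⟺_

_⟺_ : ∀ {a b} → Set a → Set b → Set (a ⊔ˡ b)
A ⟺ B = (A → B) × (B → A)

⟺-refl : ∀ {a} {A : Set a} → A ⟺ A
⟺-refl = id , id

⟺-sym : ∀ {a b} {A : Set a} {B : Set b} → A ⟺ B → B ⟺ A
⟺-sym (f , g) = g , f

⟺-trans : ∀ {a b c} {A : Set a} {B : Set b} {C : Set c} → A ⟺ B → B ⟺ C → A ⟺ C
⟺-trans (f , g) (h , k) = h ∘ f , g ∘ k

¬¬-⟺ : ∀ {a b} {A : Set a} {B : Set b} → A ⟺ B → ¬ ¬ A ⟺ ¬ ¬ B
¬¬-⟺ (f , g) = ¬¬-map f , ¬¬-map g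

module _ {a b c d} {A : Set a} {B : Set b} {C : Set c} {D : Set d} (p : A ⟺ B) (q : C ⟺ D) where

  ×-⟺ : A × C ⟺ B × D
  ×-⟺ = (λ (x , y) → proj₁ p x , proj₁ q y) , (λ (x , y) → proj₂ p x , proj₂ q y)

  ⊎-⟺ : A ⊎ C ⟺ B ⊎ D
  ⊎-⟺ = [ inj₁ ∘ proj₁ p , inj₂ ∘ proj₁ q ] , [ inj₁ ∘ proj₂ p , inj₂ ∘ proj₂ q ]

  →-⟺ : (A → C) ⟺ (B → D)
  →-⟺ = (λ f → proj₁ q ∘ f ∘ proj₂ p) , (λ f → proj₂ q ∘ f ∘ proj₁ p)

module _ {a b c} {A : Set a} {B : A → Set b} {C : A → Set c} (p : ∀ x → B x ⟺ C x) where

  Π-⟺ : (∀ x → B x) ⟺ (∀ x → C x)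
  Π-⟺ = (λ f x → proj₁ (p x) (f x)) , (λ f x → proj₂ (p x) (f x))

  ∃-⟺ : Σ A B ⟺ Σ A C
  ∃-⟺ = (λ (x , y) → x , proj₁ (p x) y) , (λ (x , y) → x , proj₂ (p x) y)

⊥-stable : ∀ {ℓ} → Stable (⊥ {ℓ})
⊥-stable ¬¬⊥ = ⊥-elim (¬¬⊥ λ ())

-- Satisfaction in an arbitrary structure

module Satisfaction {L : Language} {ℓ} (M : RawStructure L ℓ) (isS : IsStructure M) where
  open RawStructure M
  open IsStructure isS
  open IsEquivalence isEquivalence renaming (refl to ≈-refl; sym to ≈-sym; trans to ≈-trans) using ()

  -- Disjunction and existence are double negations already, and the other clauses inherit stability
  -- from the atoms. This allows a goal of satisfaction to be proved in a `do` block.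
  Sat-stable : ∀ {k} (φ : Formula L k) {ρ} → Stable (Sat M φ ρ)
  Sat-stable (t ≐ u)    s a b p q = ≈-stable (¬¬-map (λ f → f a b p q) s)
  Sat-stable (rel R ts) s as p = holds-stable R (¬¬-map (λ f → f as p) s)
  Sat-stable ⊥′         s = ⊥-stable s
  Sat-stable (φ ∧′ ψ)   s = Sat-stable φ (¬¬-map proj₁ s) , Sat-stable ψ (¬¬-map proj₂ s)
  Sat-stable (φ ∨′ ψ)   s = negated-stable s
  Sat-stable (φ ⇒ ψ)    s p = Sat-stable ψ (¬¬-map (λ f → f p) s)
  Sat-stable (∀′ φ)     s a = Sat-stable φ (¬¬-map (λ f → f a) s)
  Sat-stable (∃′ φ)     s = negated-stable s

  mutual
    Value-resp : ∀ {k} {ρ : Vec Carrier k} {t a b} → a ≈ b → Value M ρ t a → Value M ρ t b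
    Value-resp a≈b (val-var p)             = val-var (≈-trans p a≈b)
    Value-resp a≈b (val-app {f = f} ps g) = val-app ps (graph-cong f (Pointwise.refl ≈-refl) a≈b g)

    Value-cong : ∀ {k} {ρ ρ′ : Vec Carrier k} {t a} → Pointwise _≈_ ρ ρ′ → Value M ρ t a → Value M ρ′ t a
    Value-cong e (val-var {i = i} p) = val-var (≈-trans (≈-sym (Pointwise.lookup e i)) p)
    Value-cong e (val-app ps g)      = val-app (Values-cong e ps) g

    Values-cong : ∀ {k m} {ρ ρ′ : Vec Carrier k} {ts : Vec (Term L k) m} {as : Vec Carrier m} →
                  Pointwise _≈_ ρ ρ′ → Pointwise (Value M ρ) ts as → Pointwise (Value M ρ′) ts as
    Values-cong e []       = []
    Values-cong e (p ∷ ps) = Value-cong e p ∷ Values-cong e ps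

  mutual
    Value-unique : ∀ {k} {ρ : Vec Carrier k} {t a b} → Value M ρ t a → Value M ρ t b → a ≈ b
    Value-unique (val-var p) (val-var q) = ≈-trans (≈-sym p) q
    Value-unique (val-app {f = f} ps g) (val-app qs h) =
      graph-unique f (graph-cong f (Values-unique ps qs) ≈-refl g) h

    Values-unique : ∀ {k m} {ρ : Vec Carrier k} {ts : Vec (Term L k) m} {as bs : Vec Carrier m} →
                    Pointwise (Value M ρ) ts as → Pointwise (Value M ρ) ts bs → Pointwise _≈_ as bs
    Values-unique []       []       = []
    Values-unique (p ∷ ps) (q ∷ qs) = Value-unique p q ∷ Values-unique ps qs

  mutual
    Value-total : ∀ {k} (ρ : Vec Carrier k) t → ¬ ¬ (∃[ a ] Value M ρ t a)
    Value-total ρ (var i)    = return (lookup ρ i , val-var ≈-refl)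
    Value-total ρ (app f ts) = do
      as , ps ← Values-total ρ ts
      a , g   ← graph-total f as
      return (a , val-app ps g)

    Values-total : ∀ {k m} (ρ : Vec Carrier k) (ts : Vec (Term L k) m) →
                   ¬ ¬ (∃[ as ] Pointwise (Value M ρ) ts as)
    Values-total ρ []       = return ([] , [])
    Values-total ρ (t ∷ ts) = do
      a , p   ← Value-total ρ t
      as , ps ← Values-total ρ ts
      return (a ∷ as , p ∷ ps)

  Sat-cong : ∀ {k} (φ : Formula L k) {ρ ρ′} → Pointwise _≈_ ρ ρ′ → Sat M φ ρ → Sat M φ ρ′
  Sat-cong (t ≐ u)    e s a b p q = s a b (Value-cong e⁻¹ p) (Value-cong e⁻¹ q)
    where e⁻¹ = Pointwise.sym ≈-sym e
  Sat-cong (rel R ts) e s as p    = s as (Values-cong (Pointwise.sym ≈-sym e) p)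
  Sat-cong ⊥′         e s         = s
  Sat-cong (φ ∧′ ψ)   e (s , t)   = Sat-cong φ e s , Sat-cong ψ e t
  Sat-cong (φ ∨′ ψ)   e s         = ¬¬-map [ inj₁ ∘ Sat-cong φ e , inj₂ ∘ Sat-cong ψ e ] s
  Sat-cong (φ ⇒ ψ)    e s         = Sat-cong ψ e ∘ s ∘ Sat-cong φ (Pointwise.sym ≈-sym e)
  Sat-cong (∀′ φ)     e s a       = Sat-cong φ (≈-refl ∷ e) (s a)
  Sat-cong (∃′ φ)     e s         = ¬¬-map (λ (a , p) → a , Sat-cong φ (≈-refl ∷ e) p) s

  -- Values of terms exist only classically, so the environment obtained by evaluating σ is
  -- described by a relation rather than computed.
  Values-of : ∀ {m n} → Vec Carrier n → Vector (Term L n) m → Vec Carrier m → Set ℓ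
  Values-of ρ σ ρ′ = ∀ i → Value M ρ (σ i) (lookup ρ′ i)

  module _ {m n} {ρ : Vec Carrier n} {σ : Vector (Term L n) m} {ρ′ : Vec Carrier m}
           (vs : Values-of ρ σ ρ′) where
    mutual
      Value-subst : ∀ t {a} → Value M ρ (substᵗ σ t) a → Value M ρ′ t a
      Value-subst (var i)    p              = val-var (Value-unique (vs i) p)
      Value-subst (app f ts) (val-app ps g) = val-app (Values-subst ts ps) g

      Values-subst : ∀ {l} (ts : Vec (Term L m) l) {as : Vec Carrier l} →
                     Pointwise (Value M ρ) (substᵗˢ σ ts) as → Pointwise (Value M ρ′) ts as
      Values-subst []       []       = []
      Values-subst (t ∷ ts) (p ∷ ps) = Value-subst t p ∷ Values-subst ts ps

    mutual
      Value-subst⁻ : ∀ t {a} → Value M ρ′ t a → Value M ρ (substᵗ σ t) a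
      Value-subst⁻ (var i)    (val-var p)    = Value-resp p (vs i)
      Value-subst⁻ (app f ts) (val-app ps g) = val-app (Values-subst⁻ ts ps) g

      Values-subst⁻ : ∀ {l} (ts : Vec (Term L m) l) {as : Vec Carrier l} →
                      Pointwise (Value M ρ′) ts as → Pointwise (Value M ρ) (substᵗˢ σ ts) as
      Values-subst⁻ []       []       = []
      Values-subst⁻ (t ∷ ts) (p ∷ ps) = Value-subst⁻ t p ∷ Values-subst⁻ ts ps

  Value-weaken : ∀ {k} {ρ : Vec Carrier k} {a} t {b} → Value M (a ∷ ρ) (weaken t) b ⟺ Value M ρ t b
  Value-weaken t = Value-subst (λ i → val-var ≈-refl) t , Value-subst⁻ (λ i → val-var ≈-refl) t

  Values-of-lift : ∀ {m n} {ρ : Vec Carrier n} {σ : Vector (Term L n) m} {ρ′ : Vec Carrier m} a →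
                   Values-of ρ σ ρ′ → Values-of (a ∷ ρ) (lift σ) (a ∷ ρ′)
  Values-of-lift         a vs zero    = val-var ≈-refl
  Values-of-lift {σ = σ} a vs (suc i) = proj₂ (Value-weaken (σ i)) (vs i)

  Sat-subst : ∀ {m n} (φ : Formula L m) {ρ : Vec Carrier n} {σ ρ′} → Values-of ρ σ ρ′ →
              Sat M (φ [ σ ]) ρ ⟺ Sat M φ ρ′
  Sat-subst (t ≐ u) vs =
    (λ s a b p q → s a b (Value-subst⁻ vs t p) (Value-subst⁻ vs u q)) ,
    (λ s a b p q → s a b (Value-subst vs t p) (Value-subst vs u q))
  Sat-subst (rel R ts) vs =
    (λ s as p → s as (Values-subst⁻ vs ts p)) , (λ s as p → s as (Values-subst vs ts p))
  Sat-subst ⊥′       vs = ⟺-refl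
  Sat-subst (φ ∧′ ψ) vs = ×-⟺ (Sat-subst φ vs) (Sat-subst ψ vs)
  Sat-subst (φ ∨′ ψ) vs = ¬¬-⟺ (⊎-⟺ (Sat-subst φ vs) (Sat-subst ψ vs))
  Sat-subst (φ ⇒ ψ)  vs = →-⟺ (Sat-subst φ vs) (Sat-subst ψ vs)
  Sat-subst (∀′ φ)   vs = Π-⟺ λ a → Sat-subst φ (Values-of-lift a vs)
  Sat-subst (∃′ φ)   vs = ¬¬-⟺ (∃-⟺ λ a → Sat-subst φ (Values-of-lift a vs))

  Sat-close : ∀ {k} (φ : Formula L k) → Sat M (close φ) [] ⟺ (∀ ρ → Sat M φ ρ)
  Sat-close {zero}  φ = (λ { s [] → s }) , (λ s → s [])
  Sat-close {suc k} φ =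
    ⟺-trans (Sat-close (∀′ φ)) ((λ { s (a ∷ ρ) → s ρ a }) , (λ s ρ a → s (a ∷ ρ)))

-- Δ₀ formulas of set theory

infix  8 _∈ᵇ_ _≈ᵇ_
infixr 7 _∧ᵇ_
infixr 6 _∨ᵇ_
infixr 5 _⇒ᵇ_

-- As ℒ∈ has no function symbols, atoms can relate variables directly: the semantics then needs no
-- `Value`, and being Δ₀ is built into the syntax.
data BFormula (k : ℕ) : Set where
  _∈ᵇ_ _≈ᵇ_        : Fin k → Fin k → BFormula k
  ⊥ᵇ               : BFormula k
  _∧ᵇ_ _∨ᵇ_ _⇒ᵇ_   : BFormula k → BFormula k → BFormula k
  ∀∈ ∃∈            : Fin k → BFormula (suc k) → BFormula k

⌜_⌝ : ∀ {k} → BFormula k → Formula ℒ∈ k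
⌜ i ∈ᵇ j ⌝ = var i ∈′ var j
⌜ i ≈ᵇ j ⌝ = var i ≐ var j
⌜ ⊥ᵇ ⌝     = ⊥′
⌜ φ ∧ᵇ ψ ⌝ = ⌜ φ ⌝ ∧′ ⌜ ψ ⌝
⌜ φ ∨ᵇ ψ ⌝ = ⌜ φ ⌝ ∨′ ⌜ ψ ⌝
⌜ φ ⇒ᵇ ψ ⌝ = ⌜ φ ⌝ ⇒ ⌜ ψ ⌝
⌜ ∀∈ i φ ⌝ = ∀′ (var zero ∈′ var (suc i) ⇒ ⌜ φ ⌝)
⌜ ∃∈ i φ ⌝ = ∃′ (var zero ∈′ var (suc i) ∧′ ⌜ φ ⌝)

⌜⌝-Δ₀ : ∀ {k} (φ : BFormula k) → Δ₀ mem ⌜ φ ⌝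
⌜⌝-Δ₀ (i ∈ᵇ j) = atom mem _
⌜⌝-Δ₀ (i ≈ᵇ j) = eq _ _
⌜⌝-Δ₀ ⊥ᵇ       = false
⌜⌝-Δ₀ (φ ∧ᵇ ψ) = and (⌜⌝-Δ₀ φ) (⌜⌝-Δ₀ ψ)
⌜⌝-Δ₀ (φ ∨ᵇ ψ) = or (⌜⌝-Δ₀ φ) (⌜⌝-Δ₀ ψ)
⌜⌝-Δ₀ (φ ⇒ᵇ ψ) = imp (⌜⌝-Δ₀ φ) (⌜⌝-Δ₀ ψ)
⌜⌝-Δ₀ (∀∈ i φ) = ball (var i) (⌜⌝-Δ₀ φ)
⌜⌝-Δ₀ (∃∈ i φ) = bex (var i) (⌜⌝-Δ₀ φ)

-- The renaming is a vector, so that for explicit indices the renamed environment `map (lookup ρ) r`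
-- computes to an explicit list.
rename : ∀ {m n} → Vec (Fin n) m → BFormula m → BFormula n
rename r (i ∈ᵇ j) = lookup r i ∈ᵇ lookup r j
rename r (i ≈ᵇ j) = lookup r i ≈ᵇ lookup r j
rename r ⊥ᵇ       = ⊥ᵇ
rename r (φ ∧ᵇ ψ) = rename r φ ∧ᵇ rename r ψ
rename r (φ ∨ᵇ ψ) = rename r φ ∨ᵇ rename r ψ
rename r (φ ⇒ᵇ ψ) = rename r φ ⇒ᵇ rename r ψ
rename r (∀∈ i φ) = ∀∈ (lookup r i) (rename (zero ∷ map suc r) φ)
rename r (∃∈ i φ) = ∃∈ (lookup r i) (rename (zero ∷ map suc r) φ)

infix 8 _⊆ᵇ_

emptyᵇ : ∀ {k} → Fin k → BFormula k
emptyᵇ x = ∀∈ x ⊥ᵇ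

_⊆ᵇ_ : ∀ {k} → Fin k → Fin k → BFormula k
x ⊆ᵇ y = ∀∈ x (zero ∈ᵇ suc y)

-- y = x ∪ {x}
succᵇ : ∀ {k} → Fin k → Fin k → BFormula k
succᵇ x y = x ∈ᵇ y ∧ᵇ x ⊆ᵇ y ∧ᵇ ∀∈ y (zero ∈ᵇ suc x ∨ᵇ zero ≈ᵇ suc x)

transitiveᵇ : ∀ {k} → Fin k → BFormula k
transitiveᵇ x = ∀∈ x (zero ⊆ᵇ suc x)

zeroOrSucᵇ : ∀ {k} → Fin k → BFormula k
zeroOrSucᵇ x = emptyᵇ x ∨ᵇ ∃∈ x (succᵇ zero (suc x))

-- p is a set such as {{x}, {x, y}}; only the injectivity of pairing is
-- needed, so p need not be determined by x and y.
pairᵇ : ∀ {k} → Fin k → Fin k → Fin k → BFormula k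
pairᵇ p x y = ∀∈ p (suc x ∈ᵇ zero)
           ∧ᵇ ∃∈ p (∀∈ zero (zero ≈ᵇ suc (suc x)))
           ∧ᵇ ∃∈ p (suc y ∈ᵇ zero)
           ∧ᵇ ∀∈ p (∀∈ zero (zero ≈ᵇ suc (suc x) ∨ᵇ zero ≈ᵇ suc (suc y)))

-- The natural numbers are the x for which naturalᵇ holds of all y ∷ x ∷ []:
-- no y witnesses a failure of ∈-induction below x.
naturalᵇ : BFormula 2
naturalᵇ = transitiveᵇ (# 1) ∧ᵇ zeroOrSucᵇ (# 1) ∧ᵇ ∀∈ (# 1) (zeroOrSucᵇ (# 0))
        ∧ᵇ (∀∈ (# 1) ((# 0) ⊆ᵇ (# 1) ⇒ᵇ (# 0) ∈ᵇ (# 1)) ⇒ᵇ (# 1) ⊆ᵇ (# 0))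

-- Without the induction clause: a possibly ill-founded number.
pseudonaturalᵇ : BFormula 1
pseudonaturalᵇ = transitiveᵇ (# 0) ∧ᵇ zeroOrSucᵇ (# 0) ∧ᵇ ∀∈ (# 0) (zeroOrSucᵇ (# 0))
              ∧ᵇ (emptyᵇ (# 0) ∨ᵇ ∃∈ (# 0) (emptyᵇ (# 0)))
              ∧ᵇ ∀∈ (# 0) (succᵇ (# 0) (# 1) ∨ᵇ ∃∈ (# 1) (succᵇ (# 1) (# 0)))

-- Primitive recursion with base c = F(a, 0) and step k = G(a, j), for
-- F(a, b + 1) = G(a, F(a, b)), given by base on c ∷ a ∷ [] and by step on
-- w ∷ k ∷ a ∷ j ∷ [], where w is a witness.  The result recᵇ on W ∷ c ∷ a ∷ b ∷ []
-- asserts that c = F(a, b) is computed by a set g ∈ W of pairs, each of which is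
-- justified by another one; W contains all components and witnesses.

module _ (base : BFormula 2) (step : BFormula 4) where

  -- on c ∷ b ∷ p ∷ g ∷ W ∷ a ∷ []
  justifiedᵇ : BFormula 6
  justifiedᵇ = emptyᵇ (# 1) ∧ᵇ rename (# 0 ∷ # 5 ∷ []) base
    ∨ᵇ ∃∈ (# 3) (∃∈ (# 5) (∃∈ (# 6)
         (pairᵇ (# 2) (# 1) (# 0) ∧ᵇ succᵇ (# 1) (# 4) ∧ᵇ
          ∃∈ (# 7) (rename (# 0 ∷ # 4 ∷ # 9 ∷ # 1 ∷ []) step))))

  -- on g ∷ W ∷ a ∷ []
  computationᵇ : BFormula 3
  computationᵇ = ∀∈ (# 0) (∃∈ (# 2) (∃∈ (# 3)
    (pairᵇ (# 2) (# 1) (# 0) ∧ᵇ justifiedᵇ)))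

  recᵇ : BFormula 4
  recᵇ = ∃∈ (# 0) (rename (# 0 ∷ # 1 ∷ # 3 ∷ []) computationᵇ ∧ᵇ ∃∈ (# 0) (pairᵇ (# 0) (# 5) (# 3)))

oneᵇ : BFormula 1
oneᵇ = ∃∈ (# 0) (emptyᵇ (# 0) ∧ᵇ succᵇ (# 0) (# 1))

-- The step of timesᵇ is j + a, not a + j: its value is then unique for every j,
-- number or not, as the recursion of plusᵇ is on its second argument.
plusᵇ timesᵇ : BFormula 4
plusᵇ  = recᵇ ((# 0) ≈ᵇ (# 1)) (succᵇ (# 3) (# 1))
timesᵇ = recᵇ (emptyᵇ (# 0)) (rename (# 0 ∷ # 1 ∷ # 3 ∷ # 2 ∷ []) plusᵇ)

-- `recᵇ` lists its variables as W, c, a, b, so that binding W leaves the value first and then the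
-- arguments.
arithmetic : Interpretation ℒA ℒ∈
arithmetic = record
  { domain   = ∀′ ⌜ naturalᵇ ⌝
  ; equality = v 0 ≐ v 1
  ; function = λ { zeroᶠ  → ⌜ emptyᵇ zero ⌝
                 ; oneᶠ   → ⌜ oneᵇ ⌝
                 ; plusᶠ  → ∃′ ⌜ plusᵇ ⌝
                 ; timesᶠ → ∃′ ⌜ timesᵇ ⌝ }
  ; relation = λ { less → v 0 ∈′ v 1 }
  }

-- Semantics of Δ₀ formulas and the basic set-theoretic predicates

module BoundedSemantics {ℓ} (M : RawStructure ℒ∈ ℓ) (isS : IsStructure M) where
  open RawStructure M using (holds)
  open RawStructure M public using (Carrier; _≈_)
  open IsStructure isS using (isEquivalence; ≈-stable; holds-stable; holds-cong)
  open IsEquivalence isEquivalence public renaming (refl to ≈-refl; sym to ≈-sym; trans to ≈-trans) using ()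
  open Satisfaction M isS public

  infix 4 _∈_ _⊆_

  _∈_ : Carrier → Carrier → Set ℓ
  x ∈ y = holds mem (x ∷ y ∷ [])

  ∈-cong : ∀ {x x′ y y′} → x ≈ x′ → y ≈ y′ → x ∈ y → x′ ∈ y′
  ∈-cong p q = holds-cong mem (p ∷ q ∷ [])

  ∈-stable : ∀ {x y} → Stable (x ∈ y)
  ∈-stable = holds-stable mem

  ⟦_⟧ : ∀ {k} → BFormula k → Vec Carrier k → Set ℓ
  ⟦ i ∈ᵇ j ⟧ ρ = lookup ρ i ∈ lookup ρ j
  ⟦ i ≈ᵇ j ⟧ ρ = lookup ρ i ≈ lookup ρ j
  ⟦ ⊥ᵇ ⟧     ρ = ⊥
  ⟦ φ ∧ᵇ ψ ⟧ ρ = ⟦ φ ⟧ ρ × ⟦ ψ ⟧ ρ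
  ⟦ φ ∨ᵇ ψ ⟧ ρ = ¬ ¬ (⟦ φ ⟧ ρ ⊎ ⟦ ψ ⟧ ρ)
  ⟦ φ ⇒ᵇ ψ ⟧ ρ = ⟦ φ ⟧ ρ → ⟦ ψ ⟧ ρ
  ⟦ ∀∈ i φ ⟧ ρ = ∀ x → x ∈ lookup ρ i → ⟦ φ ⟧ (x ∷ ρ)
  ⟦ ∃∈ i φ ⟧ ρ = ¬ ¬ (∃[ x ] x ∈ lookup ρ i × ⟦ φ ⟧ (x ∷ ρ))

  Sat-∈ : ∀ {k} {ρ : Vec Carrier k} i j → Sat M (var i ∈′ var j) ρ ⟺ lookup ρ i ∈ lookup ρ j
  Sat-∈ i j = (λ s → s _ (val-var ≈-refl ∷ val-var ≈-refl ∷ [])) ,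
              (λ { h _ (val-var p ∷ val-var q ∷ []) → ∈-cong p q h })

  Sat-≈ : ∀ {k} {ρ : Vec Carrier k} i j → Sat M (var i ≐ var j) ρ ⟺ lookup ρ i ≈ lookup ρ j
  Sat-≈ i j = (λ s → s _ _ (val-var ≈-refl) (val-var ≈-refl)) ,
              (λ { h _ _ (val-var p) (val-var q) → ≈-trans (≈-sym p) (≈-trans h q) })

  Sat-⌜⌝ : ∀ {k} (φ : BFormula k) {ρ} → Sat M ⌜ φ ⌝ ρ ⟺ ⟦ φ ⟧ ρ
  Sat-⌜⌝ (i ∈ᵇ j) = Sat-∈ i j
  Sat-⌜⌝ (i ≈ᵇ j) = Sat-≈ i j
  Sat-⌜⌝ ⊥ᵇ       = ⟺-refl
  Sat-⌜⌝ (φ ∧ᵇ ψ) = ×-⟺ (Sat-⌜⌝ φ) (Sat-⌜⌝ ψ)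
  Sat-⌜⌝ (φ ∨ᵇ ψ) = ¬¬-⟺ (⊎-⟺ (Sat-⌜⌝ φ) (Sat-⌜⌝ ψ))
  Sat-⌜⌝ (φ ⇒ᵇ ψ) = →-⟺ (Sat-⌜⌝ φ) (Sat-⌜⌝ ψ)
  Sat-⌜⌝ (∀∈ i φ) = Π-⟺ λ a → →-⟺ (Sat-∈ zero (suc i)) (Sat-⌜⌝ φ)
  Sat-⌜⌝ (∃∈ i φ) = ¬¬-⟺ (∃-⟺ λ a → ×-⟺ (Sat-∈ zero (suc i)) (Sat-⌜⌝ φ))

  ⟦⟧-stable : ∀ {k} (φ : BFormula k) {ρ} → Stable (⟦ φ ⟧ ρ)
  ⟦⟧-stable φ s = proj₁ (Sat-⌜⌝ φ) (Sat-stable ⌜ φ ⌝ (¬¬-map (proj₂ (Sat-⌜⌝ φ)) s))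

  ⟦⟧-cong : ∀ {k} (φ : BFormula k) {ρ ρ′} → Pointwise _≈_ ρ ρ′ → ⟦ φ ⟧ ρ → ⟦ φ ⟧ ρ′
  ⟦⟧-cong φ e = proj₁ (Sat-⌜⌝ φ) ∘ Sat-cong ⌜ φ ⌝ e ∘ proj₂ (Sat-⌜⌝ φ)

  ⟦⟧-rename-lift : ∀ {m n} (φ : BFormula (suc m)) (r : Vec (Fin n) m) {a ρ} →
                   ⟦ rename (zero ∷ map suc r) φ ⟧ (a ∷ ρ) ⟺ ⟦ φ ⟧ (a ∷ map (lookup ρ) r)
  ⟦⟧-rename : ∀ {m n} (φ : BFormula m) (r : Vec (Fin n) m) {ρ} →
              ⟦ rename r φ ⟧ ρ ⟺ ⟦ φ ⟧ (map (lookup ρ) r)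
  ⟦⟧-rename (i ∈ᵇ j) r {ρ}
    rewrite lookup-map i (lookup ρ) r | lookup-map j (lookup ρ) r = ⟺-refl
  ⟦⟧-rename (i ≈ᵇ j) r {ρ}
    rewrite lookup-map i (lookup ρ) r | lookup-map j (lookup ρ) r = ⟺-refl
  ⟦⟧-rename ⊥ᵇ       r = ⟺-refl
  ⟦⟧-rename (φ ∧ᵇ ψ) r = ×-⟺ (⟦⟧-rename φ r) (⟦⟧-rename ψ r)
  ⟦⟧-rename (φ ∨ᵇ ψ) r = ¬¬-⟺ (⊎-⟺ (⟦⟧-rename φ r) (⟦⟧-rename ψ r))
  ⟦⟧-rename (φ ⇒ᵇ ψ) r = →-⟺ (⟦⟧-rename φ r) (⟦⟧-rename ψ r)
  ⟦⟧-rename (∀∈ i φ) r {ρ} rewrite lookup-map i (lookup ρ) r =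
    Π-⟺ λ a → →-⟺ ⟺-refl (⟦⟧-rename-lift φ r)
  ⟦⟧-rename (∃∈ i φ) r {ρ} rewrite lookup-map i (lookup ρ) r =
    ¬¬-⟺ (∃-⟺ λ a → ×-⟺ ⟺-refl (⟦⟧-rename-lift φ r))

  ⟦⟧-rename-lift φ r {a} {ρ} =
    subst (λ e → ⟦ rename (zero ∷ map suc r) φ ⟧ (a ∷ ρ) ⟺ ⟦ φ ⟧ (a ∷ e)) (sym (map-∘ (lookup (a ∷ ρ)) suc r))
      (⟦⟧-rename φ (zero ∷ map suc r))

  -- `Empty`, `_⊆_`, `Succ`, `Transitive` and `ZeroOrSuc` agree by definition with the meanings of
  -- the corresponding Δ₀ formulas: the predicates serve for reasoning, the formulas for separation
  -- and congruence.
  Empty : Carrier → Set ℓ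
  Empty x = ∀ y → y ∈ x → ⊥ {ℓ}

  _⊆_ : Carrier → Carrier → Set ℓ
  x ⊆ y = ∀ z → z ∈ x → z ∈ y

  Succ : Carrier → Carrier → Set ℓ
  Succ x y = x ∈ y × x ⊆ y × (∀ u → u ∈ y → ¬ ¬ (u ∈ x ⊎ u ≈ x))

  Transitive : Carrier → Set ℓ
  Transitive x = ∀ y → y ∈ x → y ⊆ x

  ZeroOrSuc : Carrier → Set ℓ
  ZeroOrSuc x = ¬ ¬ (Empty x ⊎ ¬ ¬ (∃[ z ] z ∈ x × Succ z x))

  IsPair : Carrier → Carrier → Carrier → Set ℓ
  IsPair p x y = ⟦ pairᵇ (# 0) (# 1) (# 2) ⟧ (p ∷ x ∷ y ∷ [])

  N : Carrier → Set ℓ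
  N x = Sat M (∀′ ⌜ naturalᵇ ⌝) (x ∷ [])

  Inductive : Carrier → Set ℓ
  Inductive x = ∀ y → (∀ u → u ∈ x → u ⊆ y → u ∈ y) → x ⊆ y

  N-⟺ : ∀ {x} → N x ⟺ Transitive x × ZeroOrSuc x × (∀ u → u ∈ x → ZeroOrSuc u) × Inductive x
  N-⟺ {x} =
    -- The first three clauses do not mention y, so the instance y = x supplies them.
    (λ n → let t , z , zs , _ = proj₁ (Sat-⌜⌝ naturalᵇ) (n x) in
           t , z , zs , λ y → proj₂ (proj₂ (proj₂ (proj₁ (Sat-⌜⌝ naturalᵇ) (n y))))) ,
    (λ (t , z , zs , i) y → proj₂ (Sat-⌜⌝ naturalᵇ) (t , z , zs , i y))

  Empty-cong : ∀ {x y} → x ≈ y → Empty x → Empty y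
  Empty-cong p = ⟦⟧-cong (emptyᵇ (# 0)) (p ∷ [])

  Succ-cong : ∀ {x x′ y y′} → x ≈ x′ → y ≈ y′ → Succ x y → Succ x′ y′
  Succ-cong p q = ⟦⟧-cong (succᵇ (# 0) (# 1)) (p ∷ q ∷ [])

  N-stable : ∀ {x} → Stable (N x)
  N-stable = Sat-stable (∀′ ⌜ naturalᵇ ⌝)

  -- The member of p that contains nothing but x′ also contains x, which settles the first
  -- components. Next, y is x′ or y′, and y′ is x or y; in the one remaining case, y = x′ and y′ =
  -- x, all four coincide.
  IsPair-injective : ∀ {p x y x′ y′} → IsPair p x y → IsPair p x′ y′ → x ≈ x′ × y ≈ y′
  IsPair-injective {p} {x} {y} {x′} {y′} (a , b , c , d) (a′ , b′ , c′ , d′) = x≈x′ , ≈-stable y≈y′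
    where
    x≈x′ : x ≈ x′
    x≈x′ = ≈-stable do
      s , s∈p , h ← b′
      return (h x (a s s∈p))

    y≈y′ : ¬ ¬ (y ≈ y′)
    y≈y′ = do
      e , e∈p , y∈e ← c
      e′ , e′∈p , y′∈e′ ← c′
      inj₁ y≈x′ ← d′ e e∈p y y∈e
        where inj₂ p → return p
      inj₁ y′≈x ← d e′ e′∈p y′ y′∈e′
        where inj₂ p → return (≈-sym p)
      return (≈-trans y≈x′ (≈-trans (≈-sym x≈x′) (≈-sym y′≈x)))

-- Cumulativity of the quantifier hierarchy

Σₙ-suc : ∀ {L} {R : Language.Reln L 2} {n k} {φ : Formula L k} → Σₙ R n φ → Σₙ R (suc n) φ
Πₙ-suc : ∀ {L} {R : Language.Reln L 2} {n k} {φ : Formula L k} → Πₙ R n φ → Πₙ R (suc n) φ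

Σₙ-suc (Δ₀⇒Σ δ) = Π⇒Σ (Δ₀⇒Π δ)
Σₙ-suc (Π⇒Σ π)  = Π⇒Σ (Πₙ-suc π)
Σₙ-suc (ex σ)   = ex (Σₙ-suc σ)

Πₙ-suc (Δ₀⇒Π δ) = Σ⇒Π (Δ₀⇒Σ δ)
Πₙ-suc (Σ⇒Π σ)  = Σ⇒Π (Σₙ-suc σ)
Πₙ-suc (all π)  = all (Πₙ-suc π)

Σ₁⊆Σₙ : ∀ {L} {R : Language.Reln L 2} n {k} {φ : Formula L k} → Σₙ R 1 φ → Σₙ R (suc n) φ
Σ₁⊆Σₙ zero    σ = σ
Σ₁⊆Σₙ (suc n) σ = Σₙ-suc (Σ₁⊆Σₙ n σ)

-- Elementary constructions of sets

module SetTheory {ℓ} (M : RawStructure ℒ∈ ℓ) (isS : IsStructure M)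
                 (n : ℕ) (M⊨ : M ⊨ (ReS₀ ∪ Sep (Σₙ mem (suc n)))) where
  open BoundedSemantics M isS public
  open IsStructure isS using (≈-stable)

  extensional : ∀ {x y} → (∀ z → z ∈ x ⟺ z ∈ y) → x ≈ y
  extensional {x} {y} h = proj₁ (Sat-≈ _ _) (M⊨ _ (inj₁ (inj₁ extensionality)) x y λ z →
    proj₁ (e z) , proj₂ (e z))
    where
    e : ∀ z → _ ⟺ _
    e z = ⟺-trans (Sat-∈ (# 0) (# 2)) (⟺-trans (h z) (⟺-sym (Sat-∈ (# 0) (# 1))))

  empty-exists : ¬ ¬ (∃[ x ] Empty x)
  empty-exists = do
    x , h ← M⊨ _ (inj₁ (inj₁ emptySet))
    return (x , λ y y∈x → h y (proj₂ (Sat-∈ _ _) y∈x))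

  pair-exists : ∀ x y → ¬ ¬ (∃[ z ] ∀ w → w ∈ z ⟺ ¬ ¬ (w ≈ x ⊎ w ≈ y))
  pair-exists x y = do
    z , h ← M⊨ _ (inj₁ (inj₁ pairing)) x y
    return (z , λ w → ⟺-trans (⟺-sym (Sat-∈ _ _)) (⟺-trans (h w) (¬¬-⟺ (⊎-⟺ (Sat-≈ _ _) (Sat-≈ _ _)))))

  union-exists : ∀ x → ¬ ¬ (∃[ z ] ∀ w → w ∈ z ⟺ ¬ ¬ (∃[ y ] y ∈ x × w ∈ y))
  union-exists x = do
    z , h ← M⊨ _ (inj₁ (inj₁ union)) x
    return (z , λ w → ⟺-trans (⟺-sym (Sat-∈ _ _))
      (⟺-trans (h w) (¬¬-⟺ (∃-⟺ λ y → ×-⟺ (Sat-∈ _ _) (Sat-∈ _ _)))))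

  difference-exists : ∀ x y → ¬ ¬ (∃[ z ] ∀ w → w ∈ z ⟺ w ∈ x × ¬ w ∈ y)
  difference-exists x y = do
    z , h ← M⊨ _ (inj₁ (inj₁ difference)) x y
    return (z , λ w → ⟺-trans (⟺-sym (Sat-∈ _ _))
      (⟺-trans (h w) (×-⟺ (Sat-∈ _ _)
        ((λ f w∈y → contradiction (f (proj₂ (Sat-∈ _ _) w∈y)) λ ()) ,
         (λ f s → contradiction (proj₁ (Sat-∈ _ _) s) f)))))

  separate : ∀ {k} (φ : Formula ℒ∈ (suc k)) → Sat M (separation φ) [] → ∀ ρ a →
             ¬ ¬ (∃[ b ] ∀ x → x ∈ b ⟺ x ∈ a × Sat M φ (x ∷ ρ))
  separate φ s ρ a = do
    b , h ← proj₁ (Sat-close _) s ρ a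
    return (b , λ x → ⟺-trans (⟺-sym (Sat-∈ _ _)) (⟺-trans (h x) (×-⟺ (Sat-∈ _ _)
      (Sat-subst φ λ { zero → val-var ≈-refl ; (suc i) → val-var ≈-refl }))))

  separate-bounded : ∀ {k} (φ : BFormula (suc k)) ρ a →
                     ¬ ¬ (∃[ b ] ∀ x → x ∈ b ⟺ x ∈ a × ⟦ φ ⟧ (x ∷ ρ))
  separate-bounded φ ρ a = do
    b , h ← separate ⌜ φ ⌝ (M⊨ _ (inj₁ (inj₂ (sep (⌜⌝-Δ₀ φ))))) ρ a
    return (b , λ x → ⟺-trans (h x) (×-⟺ ⟺-refl (Sat-⌜⌝ φ)))

  -- The level is written `suc n`, one above the module parameter, so that Σ₁-Separation is always
  -- included.
  separate-Σₙ : ∀ {k} (φ : Formula ℒ∈ (suc k)) → Σₙ mem (suc n) φ → ∀ ρ a →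
                ¬ ¬ (∃[ b ] ∀ x → x ∈ b ⟺ x ∈ a × Sat M φ (x ∷ ρ))
  separate-Σₙ φ σ = separate φ (M⊨ _ (inj₂ (sep σ)))

  -- x ∪ {y} is obtained as the union of {x, {y}}.
  adjoin : ∀ x y → ¬ ¬ (∃[ z ] ∀ w → w ∈ z ⟺ ¬ ¬ (w ∈ x ⊎ w ≈ y))
  adjoin x y = do
    s , hs ← pair-exists y y
    t , ht ← pair-exists x s
    z , hz ← union-exists t
    return (z , λ w →
      (λ w∈z → do
        u , u∈t , w∈u ← proj₁ (hz w) w∈z
        inj₁ u≈x ← proj₁ (ht u) u∈t
          where inj₂ u≈s → ¬¬-map [ inj₂ , inj₂ ] (proj₁ (hs w) (∈-cong ≈-refl u≈s w∈u))
        return (inj₁ (∈-cong ≈-refl u≈x w∈u))) ,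
      (λ p → proj₂ (hz w) (p >>= λ
        { (inj₁ w∈x) → return (x , proj₂ (ht x) (return (inj₁ ≈-refl)) , w∈x)
        ; (inj₂ w≈y) → return (s , proj₂ (ht s) (return (inj₂ ≈-refl)) , proj₂ (hs w) (return (inj₁ w≈y)))
        })))

  -- The source of all bounding sets: finitely many objects found classically become members of one
  -- set, over which a Δ₀ formula can then quantify.
  adjoin-all : ∀ x ys → ¬ ¬ (∃[ z ] x ⊆ z × All (_∈ z) ys)
  adjoin-all x []       = return (x , (λ _ p → p) , [])
  adjoin-all x (y ∷ ys) = do
    z , x⊆z , ys∈z ← adjoin-all x ys
    z′ , h ← adjoin z y
    let z⊆z′ = λ w w∈z → proj₂ (h w) (return (inj₁ w∈z))
    return (z′ , (λ w → z⊆z′ w ∘ x⊆z w) , proj₂ (h y) (return (inj₂ ≈-refl)) ∷ All.map (z⊆z′ _) ys∈z)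

  IsPair-exists : ∀ x y → ¬ ¬ (∃[ p ] IsPair p x y)
  IsPair-exists x y = do
    s , hs ← pair-exists x x
    d , hd ← pair-exists x y
    p , hp ← pair-exists s d
    let s∈p = proj₂ (hp s) (return (inj₁ ≈-refl))
        d∈p = proj₂ (hp d) (return (inj₂ ≈-refl))
        x∈s = proj₂ (hs x) (return (inj₁ ≈-refl))
        x∈d = proj₂ (hd x) (return (inj₁ ≈-refl))
        y∈d = proj₂ (hd y) (return (inj₂ ≈-refl))
    return (p ,
      (λ e e∈p → ∈-stable (¬¬-map [ (λ e≈s → ∈-cong ≈-refl (≈-sym e≈s) x∈s) , (λ e≈d → ∈-cong ≈-refl (≈-sym e≈d) x∈d) ]
                                  (proj₁ (hp e) e∈p))) ,
      return (s , s∈p , λ z z∈s → ≈-stable (¬¬-map [ id , id ] (proj₁ (hs z) z∈s))) ,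
      return (d , d∈p , y∈d) ,
      (λ e e∈p z z∈e → proj₁ (hp e) e∈p >>= λ
        { (inj₁ e≈s) → ¬¬-map [ inj₁ , inj₁ ] (proj₁ (hs z) (∈-cong ≈-refl e≈s z∈e))
        ; (inj₂ e≈d) → proj₁ (hd z) (∈-cong ≈-refl e≈d z∈e) }))

-- Numbers: induction, order, and a Δ₀ definition with parameter

module Numbers {ℓ} (M : RawStructure ℒ∈ ℓ) (isS : IsStructure M)
               (n : ℕ) (M⊨ : M ⊨ (ReS₀ ∪ Sep (Σₙ mem (suc n)))) where
  open SetTheory M isS n M⊨ public
  open IsStructure isS using (≈-stable)

  N-transitive : ∀ {x} → N x → Transitive x
  N-transitive = proj₁ ∘ proj₁ N-⟺

  N-zeroOrSuc : ∀ {x} → N x → ZeroOrSuc x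
  N-zeroOrSuc = proj₁ ∘ proj₂ ∘ proj₁ N-⟺

  -- The induction clause of x is applied to the set of its transitive members. A nonempty w in x is
  -- the successor of some z in w; this z is already transitive, and every member of w is z or lies
  -- in z.
  ∈N-transitive : ∀ {x u} → N x → u ∈ x → Transitive u
  ∈N-transitive {x} {u} nx u∈x = ⟦⟧-stable (transitiveᵇ (# 0)) {u ∷ []} do
    let t , _ , zs , i = proj₁ N-⟺ nx
    y , hy ← separate-bounded (transitiveᵇ (# 0)) [] x
    return (proj₂ (proj₁ (hy u) (i y (λ w w∈x w⊆y → ∈-stable do
      inj₂ s ← zs w w∈x
        where inj₁ e → return (proj₂ (hy w) (w∈x , λ z z∈w → contradiction (e z z∈w) λ ()))
      z , z∈w , _ , z⊆w , h ← s
      return (proj₂ (hy w) (w∈x , λ a a∈w b b∈a → ∈-stable do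
        inj₁ a∈z ← h a a∈w
          where inj₂ a≈z → return (z⊆w b (∈-cong ≈-refl a≈z b∈a))
        return (z⊆w b (proj₂ (proj₁ (hy z) (w⊆y z z∈w)) a a∈z b b∈a))))) u u∈x)))

  -- Only the induction clause needs an argument. Given a test set y for u, the clause of x is
  -- applied to those members of x that lie in y if they lie in u; transitivity of u keeps the
  -- hypothesis applicable.
  ∈N : ∀ {x u} → N x → u ∈ x → N u
  ∈N {x} {u} nx u∈x = proj₂ N-⟺
    ( tu
    , zs u u∈x
    , (λ w w∈u → zs w (t u u∈x w w∈u))
    , λ y p w w∈u → ∈-stable do
        y′ , hy ← separate-bounded ((# 0) ∈ᵇ (# 1) ⇒ᵇ (# 0) ∈ᵇ (# 2)) (u ∷ y ∷ []) x
        let h = i y′ λ a a∈x a⊆y′ → proj₂ (hy a) (a∈x , λ a∈u →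
                  p a a∈u λ b b∈a → proj₂ (proj₁ (hy b) (a⊆y′ b b∈a)) (tu a a∈u b b∈a))
        return (proj₂ (proj₁ (hy w) (h w (t u u∈x w w∈u))) w∈u) )
    where
    t = N-transitive nx
    tu = ∈N-transitive nx u∈x
    zs = proj₁ (proj₂ (proj₂ (proj₁ N-⟺ nx)))
    i = proj₂ (proj₂ (proj₂ (proj₁ N-⟺ nx)))

  N-zero : ∀ {e} → Empty e → N e
  N-zero {e} h = proj₂ N-⟺
    ( (λ y y∈e → absurd y∈e) , return (inj₁ h) , (λ y y∈e → absurd y∈e) , (λ _ _ z z∈e → absurd z∈e) )
    where
    absurd : ∀ {a} {A : Set a} {y} → y ∈ e → A
    absurd y∈e = contradiction (h _ y∈e) λ ()

  N-suc : ∀ {x s} → Succ x s → N x → N s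
  N-suc {x} {s} sx@(x∈s , x⊆s , h) nx = proj₂ N-⟺
    ( (λ w w∈s z z∈w → ∈-stable do
        inj₁ w∈x ← h w w∈s
          where inj₂ w≈x → return (x⊆s z (∈-cong ≈-refl w≈x z∈w))
        return (x⊆s z (t w w∈x z z∈w)))
    , return (inj₂ (return (x , x∈s , sx)))
    , (λ w w∈s → h w w∈s >>= λ
        { (inj₁ w∈x) → zs w w∈x
        ; (inj₂ w≈x) → ⟦⟧-cong (zeroOrSucᵇ (# 0)) (≈-sym w≈x ∷ []) zx })
    , λ y p w w∈s →
        let x⊆y = i y λ u u∈x → p u (x⊆s u u∈x) in
        ∈-stable (¬¬-map [ x⊆y w , (λ w≈x → ∈-cong (≈-sym w≈x) ≈-refl (p x x∈s x⊆y)) ] (h w w∈s)) )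
    where
    t = N-transitive nx
    zx = N-zeroOrSuc nx
    zs = proj₁ (proj₂ (proj₂ (proj₁ N-⟺ nx)))
    i = proj₂ (proj₂ (proj₂ (proj₁ N-⟺ nx)))

  Succ-exists : ∀ x → ¬ ¬ (∃[ s ] Succ x s)
  Succ-exists x = do
    s , h ← adjoin x x
    return (s , proj₂ (h x) (return (inj₂ ≈-refl)) , (λ z z∈x → proj₂ (h z) (return (inj₁ z∈x))) , λ u → proj₁ (h u))

  -- Agreement is demanded at numbers only, which is what induction uses and what allows P to be
  -- replaced by a formula equivalent to it on the numbers.
  Separable : ∀ {p} → (Carrier → Set p) → Set _
  Separable P = ∀ a → ¬ ¬ (∃[ b ] ∀ x → x ∈ a → N x → (x ∈ b ⟺ P x))

  bounded-separable : ∀ {k} (φ : BFormula (suc k)) ρ → Separable (λ x → ⟦ φ ⟧ (x ∷ ρ))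
  bounded-separable φ ρ a = do
    b , h ← separate-bounded φ ρ a
    return (b , λ x x∈a _ → proj₂ ∘ proj₁ (h x) , λ p → proj₂ (h x) (x∈a , p))

  Σₙ-separable : ∀ {k} (φ : Formula ℒ∈ (suc k)) → Σₙ mem (suc n) φ → ∀ ρ → Separable (λ x → Sat M φ (x ∷ ρ))
  Σₙ-separable φ σ ρ a = do
    b , h ← separate-Σₙ φ σ ρ a
    return (b , λ x x∈a _ → proj₂ ∘ proj₁ (h x) , λ p → proj₂ (h x) (x∈a , p))

  Σ₁-separable : ∀ {k} (φ : BFormula (suc (suc k))) ρ →
                 Separable (λ x → ¬ ¬ (∃[ w ] ⟦ φ ⟧ (w ∷ x ∷ ρ)))
  Σ₁-separable φ ρ a = do
    b , h ← Σₙ-separable (∃′ ⌜ φ ⌝) (Σ₁⊆Σₙ n (ex (Π⇒Σ (Δ₀⇒Π (⌜⌝-Δ₀ φ))))) ρ a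
    return (b , λ x x∈a nx → ⟺-trans (h x x∈a nx) (¬¬-⟺ (∃-⟺ λ w → Sat-⌜⌝ φ)))

  Separable-⟺ : ∀ {p q} {P : Carrier → Set p} {Q : Carrier → Set q} →
                (∀ x → N x → P x ⟺ Q x) → Separable P → Separable Q
  Separable-⟺ e sepP a = do
    b , h ← sepP a
    return (b , λ x x∈a nx → ⟺-trans (h x x∈a nx) (e x nx))

  module _ {p} {P : Carrier → Set p} (sepP : Separable P) (st : ∀ {x} → Stable (P x)) where

    -- The induction clause gives P for the members of x; one more application of the hypothesis
    -- gives P at x itself.
    ∈-induction : (∀ u → N u → (∀ w → w ∈ u → P w) → P u) → ∀ x → N x → P x
    ∈-induction f x nx = st do
      b , h ← sepP x
      let i = proj₂ (proj₂ (proj₂ (proj₁ N-⟺ nx)))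
          t = N-transitive nx
          x⊆b = i b λ u u∈x u⊆b → proj₂ (h u u∈x (∈N nx u∈x)) (f u (∈N nx u∈x) λ w w∈u →
                  let w∈x = t u u∈x w w∈u in proj₁ (h w w∈x (∈N nx w∈x)) (u⊆b w w∈u))
      return (f x nx λ w w∈x → proj₁ (h w w∈x (∈N nx w∈x)) (x⊆b w w∈x))

    N-induction : (∀ e → Empty e → P e) →
                  (∀ x s → N x → N s → Succ x s → P x → P s) → ∀ x → N x → P x
    N-induction base step = ∈-induction λ u nu ih → st (N-zeroOrSuc nu >>= λ
      { (inj₁ e) → return (base u e)
      ; (inj₂ s) → do
          z , z∈u , sz ← s
          return (step z u (∈N nu z∈u) nu sz (ih z z∈u)) })

  -- If u ∈ u, then the induction hypothesis for u already covers u itself.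
  ∈-irrefl : ∀ {x} → N x → ¬ x ∈ x
  ∈-irrefl nx x∈x = contradiction
    (∈-induction (bounded-separable ((# 0) ∈ᵇ (# 0) ⇒ᵇ ⊥ᵇ) [])
                 (λ {x} → ⟦⟧-stable ((# 0) ∈ᵇ (# 0) ⇒ᵇ ⊥ᵇ) {x ∷ []})
                 (λ u _ ih u∈u → ih u u∈u u∈u) _ nx x∈x)
    λ ()

  Empty-unique : ∀ {x y} → Empty x → Empty y → x ≈ y
  Empty-unique h k = extensional λ z →
    (λ z∈x → contradiction (h z z∈x) λ ()) , (λ z∈y → contradiction (k z z∈y) λ ())

  Succ-unique : ∀ {x s t} → Succ x s → Succ x t → s ≈ t
  Succ-unique (x∈s , x⊆s , h) (x∈t , x⊆t , k) = extensional λ z →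
    (λ z∈s → ∈-stable (¬¬-map [ x⊆t z , (λ e → ∈-cong (≈-sym e) ≈-refl x∈t) ] (h z z∈s))) ,
    (λ z∈t → ∈-stable (¬¬-map [ x⊆s z , (λ e → ∈-cong (≈-sym e) ≈-refl x∈s) ] (k z z∈t)))

  Succ-injective : ∀ {x y s} → N s → Succ x s → Succ y s → x ≈ y
  Succ-injective {x} {y} ns (x∈s , _ , h) (y∈s , _ , k) = ≈-stable do
    inj₁ x∈y ← k x x∈s
      where inj₂ e → return e
    inj₁ y∈x ← h y y∈s
      where inj₂ e → return (≈-sym e)
    contradiction (N-transitive (∈N ns x∈s) y y∈x x x∈y) (∈-irrefl (∈N ns x∈s))

  Empty-Succ : ∀ {x s} {a} {A : Set a} → Empty s → Succ x s → A
  Empty-Succ e (x∈s , _) = contradiction (e _ x∈s) λ ()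

  N-bottom : ∀ {x} → N x → ¬ ¬ (Empty x ⊎ ¬ ¬ (∃[ e ] e ∈ x × Empty e))
  N-bottom = N-induction (bounded-separable φ []) (λ {x} → ⟦⟧-stable φ {x ∷ []})
    (λ e h → return (inj₁ h))
    (λ x s _ _ (x∈s , x⊆s , _) ih → ih >>= λ
      { (inj₁ e) → return (inj₂ (return (x , x∈s , e)))
      ; (inj₂ h) → return (inj₂ (¬¬-map (λ (z , z∈x , e) → z , x⊆s z z∈x , e) h)) })
    _
    where φ = emptyᵇ (# 0) ∨ᵇ ∃∈ (# 0) (emptyᵇ (# 0))

  -- With `N-bottom`, this is the Δ₀ trace of well-foundedness kept in `pseudonaturalᵇ`. It also
  -- yields the discreteness of the order.
  N-next : ∀ {x} → N x → ∀ i → i ∈ x → ¬ ¬ (Succ i x ⊎ ¬ ¬ (∃[ s ] s ∈ x × Succ i s))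
  N-next = N-induction (bounded-separable φ []) (λ {x} → ⟦⟧-stable φ {x ∷ []})
    (λ e h i i∈e → contradiction (h i i∈e) λ ())
    (λ x s _ _ sx@(x∈s , x⊆s , k) ih i i∈s → k i i∈s >>= λ
      { (inj₁ i∈x) → ih i i∈x >>= λ
          { (inj₁ h) → return (inj₂ (return (x , x∈s , h)))
          ; (inj₂ h) → return (inj₂ (¬¬-map (λ (z , z∈x , e) → z , x⊆s z z∈x , e) h)) }
      ; (inj₂ i≈x) → return (inj₁ (Succ-cong (≈-sym i≈x) ≈-refl sx)) })
    _
    where φ = ∀∈ (# 0) (succᵇ (# 0) (# 1) ∨ᵇ ∃∈ (# 1) (succᵇ (# 1) (# 0)))

  -- Induction on y with x as a parameter. In the case y ∈ x, `N-next` says that the successor of y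
  -- is x or lies in x.
  trichotomy : ∀ {x y} → N x → N y → ¬ ¬ (x ∈ y ⊎ ¬ ¬ (x ≈ y ⊎ y ∈ x))
  trichotomy {x} nx = N-induction (bounded-separable φ (x ∷ [])) (λ {y} → ⟦⟧-stable φ {y ∷ x ∷ []})
    (λ e h → N-bottom nx >>= λ
      { (inj₁ h′) → return (inj₂ (return (inj₁ (Empty-unique h′ h))))
      ; (inj₂ p) → do
          e′ , e′∈x , h′ ← p
          return (inj₂ (return (inj₂ (∈-cong (Empty-unique h′ h) ≈-refl e′∈x)))) })
    (λ y s ny ns sy@(y∈s , y⊆s , _) ih → ih >>= λ
      { (inj₁ x∈y) → return (inj₁ (y⊆s x x∈y))
      ; (inj₂ q) → q >>= λ
        { (inj₁ x≈y) → return (inj₁ (∈-cong (≈-sym x≈y) ≈-refl y∈s))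
        ; (inj₂ y∈x) → N-next nx y y∈x >>= λ
          { (inj₁ sx) → return (inj₂ (return (inj₁ (Succ-unique sx sy))))
          ; (inj₂ p) → do
              s′ , s′∈x , sy′ ← p
              return (inj₂ (return (inj₂ (∈-cong (Succ-unique sy′ sy) ≈-refl s′∈x)))) } } })
    _
    where φ = (# 1) ∈ᵇ (# 0) ∨ᵇ (# 1) ≈ᵇ (# 0) ∨ᵇ (# 0) ∈ᵇ (# 1)

  Pseudonatural : Carrier → Set ℓ
  Pseudonatural x = ⟦ pseudonaturalᵇ ⟧ (x ∷ [])

  N⇒Pseudonatural : ∀ {x} → N x → Pseudonatural x
  N⇒Pseudonatural nx =
    let t , z , zs , _ = proj₁ N-⟺ nx in t , z , zs , N-bottom nx , N-next nx

  -- Induction on m. Zero lies in x, since otherwise x would be empty and hence a number. If i lies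
  -- in x but its successor does not, then x is the successor of the number i, again a number.
  ill-founded-bound : ∀ {x} → Pseudonatural x → ¬ N x → ∀ m → N m → m ∈ x
  ill-founded-bound {x} (t , z , zs , bot , next) ¬nx =
    N-induction (bounded-separable ((# 0) ∈ᵇ (# 1)) (x ∷ [])) ∈-stable
      (λ e h → ∈-stable (bot >>= λ
        { (inj₁ h′) → contradiction (N-zero h′) ¬nx
        ; (inj₂ p) → do
            e′ , e′∈x , h′ ← p
            return (∈-cong (Empty-unique h′ h) ≈-refl e′∈x) }))
      (λ i s ni _ si i∈x → ∈-stable (next i i∈x >>= λ
        { (inj₁ sx) → contradiction (N-suc sx ni) ¬nx
        ; (inj₂ p) → do
            s′ , s′∈x , si′ ← p
            return (∈-cong (Succ-unique si′ si) ≈-refl s′∈x) }))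

  -- Either every pseudonatural is a natural number, or an ill-founded one bounds the
  -- naturals, which then form a set by Σ₁-separation and difference.
  N-bounded-definable : ¬ ¬ (Σ[ p ∈ Carrier ] Σ[ φ ∈ BFormula 2 ] ∀ x → N x ⟺ ⟦ φ ⟧ (x ∷ p ∷ []))
  N-bounded-definable = ¬¬-excluded-middle {A = ∀ x → Pseudonatural x → N x} >>= λ
    { (yes wf) → do
        -- Here the parameter is a dummy: pseudonaturality itself defines the numbers.
        e , _ ← empty-exists
        return (e , rename (# 0 ∷ []) pseudonaturalᵇ , λ x →
          ⟺-trans (N⇒Pseudonatural , wf x) (⟺-sym (⟦⟧-rename pseudonaturalᵇ (# 0 ∷ []) {x ∷ e ∷ []})))
    ; (no ¬wf) → do
        x , px , ¬nx ← (λ k → ¬wf λ x px → N-stable λ ¬nx → k (x , px , ¬nx))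
        -- Numberhood is Π₁, so Σ₁-Separation yields the members of x that are not numbers; removing
        -- them from x leaves the numbers.
        b , hb ← separate-Σₙ (∃′ (¬′ ⌜ naturalᵇ ⌝))
                   (Σ₁⊆Σₙ n (ex (Π⇒Σ (Δ₀⇒Π (imp (⌜⌝-Δ₀ naturalᵇ) false))))) [] x
        ω , hω ← difference-exists x b
        return (ω , ((# 0) ∈ᵇ (# 1)) , λ z →
          (λ nz → proj₂ (hω z) (ill-founded-bound px ¬nx z nz , λ z∈b →
            proj₂ (proj₁ (hb z) z∈b) λ (y , f) → contradiction (f (nz y)) λ ())) ,
          (λ z∈ω → N-stable λ ¬nz → let z∈x , z∉b = proj₁ (hω z) z∈ω in
            z∉b (proj₂ (hb z) (z∈x , λ k → ¬nz λ y → Sat-stable ⌜ naturalᵇ ⌝ λ f →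
              k (y , λ s → contradiction s f))))) }

-- Primitive recursion: uniqueness and totality

module Recursion {ℓ} (M : RawStructure ℒ∈ ℓ) (isS : IsStructure M)
                 (n : ℕ) (M⊨ : M ⊨ (ReS₀ ∪ Sep (Σₙ mem (suc n)))) where
  open Numbers M isS n M⊨ public
  open IsStructure isS using (≈-stable)

  module Rec (base : BFormula 2) (step : BFormula 4) where

    Base : Carrier → Carrier → Set ℓ
    Base a c = ⟦ base ⟧ (c ∷ a ∷ [])

    Step : Carrier → Carrier → Carrier → Carrier → Set ℓ
    Step w a j k = ⟦ step ⟧ (w ∷ k ∷ a ∷ j ∷ [])

    -- The nested bounded quantifiers of `justifiedᵇ` are gathered under one double negation, so
    -- that a single match opens them all.
    Justified : (g W a b c : Carrier) → Set ℓ
    Justified g W a b c = ¬ ¬ (Empty b × Base a c ⊎ (Σ[ q ∈ Carrier ] Σ[ i ∈ Carrier ] Σ[ j ∈ Carrier ] Σ[ w ∈ Carrier ]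
      (q ∈ g × i ∈ W × j ∈ W × w ∈ W) × IsPair q i j × Succ i b × Step w a j c))

    IsComputation : (g W a : Carrier) → Set ℓ
    IsComputation g W a = ∀ p → p ∈ g → ¬ ¬ (Σ[ b ∈ Carrier ] Σ[ c ∈ Carrier ]
      b ∈ W × c ∈ W × IsPair p b c × Justified g W a b c)

    Computes : (W a b c : Carrier) → Set ℓ
    Computes W a b c = ¬ ¬ (Σ[ g ∈ Carrier ] Σ[ p ∈ Carrier ]
      g ∈ W × IsComputation g W a × p ∈ g × IsPair p b c)

    justified-⟺ : ∀ {c b p g W a} → ⟦ justifiedᵇ base step ⟧ (c ∷ b ∷ p ∷ g ∷ W ∷ a ∷ []) ⟺ Justified g W a b c
    justified-⟺ {c} {b} {p} {g} {W} {a} =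
      (λ h → h >>= λ
        { (inj₁ (e , s)) → return (inj₁ (e , proj₁ base-⟺ s))
        ; (inj₂ h) → do
            q , q∈g , h ← h
            i , i∈W , h ← h
            j , j∈W , pr , sc , h ← h
            w , w∈W , s ← h
            return (inj₂ (q , i , j , w , (q∈g , i∈W , j∈W , w∈W) , pr , sc , proj₁ (step-⟺ q i j w) s)) }) ,
      (λ h → h >>= λ
        { (inj₁ (e , s)) → return (inj₁ (e , proj₂ base-⟺ s))
        ; (inj₂ (q , i , j , w , (q∈g , i∈W , j∈W , w∈W) , pr , sc , s)) →
            return (inj₂ (return (q , q∈g , return (i , i∈W , return (j , j∈W , pr , sc ,
              return (w , w∈W , proj₂ (step-⟺ q i j w) s)))))) })
      where
      base-⟺ = ⟦⟧-rename base (# 0 ∷ # 5 ∷ []) {c ∷ b ∷ p ∷ g ∷ W ∷ a ∷ []}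
      step-⟺ = λ q i j w →
        ⟦⟧-rename step (# 0 ∷ # 4 ∷ # 9 ∷ # 1 ∷ []) {w ∷ j ∷ i ∷ q ∷ c ∷ b ∷ p ∷ g ∷ W ∷ a ∷ []}

    computation-⟺ : ∀ {g W a} → ⟦ computationᵇ base step ⟧ (g ∷ W ∷ a ∷ []) ⟺ IsComputation g W a
    computation-⟺ =
      (λ h p p∈g → do
        b , b∈W , h ← h p p∈g
        c , c∈W , pr , h ← h
        return (b , c , b∈W , c∈W , pr , proj₁ (justified-⟺ {p = p}) h)) ,
      (λ h p p∈g → do
        b , c , b∈W , c∈W , pr , h ← h p p∈g
        return (b , b∈W , return (c , c∈W , pr , proj₂ (justified-⟺ {p = p}) h)))

    rec-⟺ : ∀ {W c a b} → ⟦ recᵇ base step ⟧ (W ∷ c ∷ a ∷ b ∷ []) ⟺ Computes W a b c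
    rec-⟺ {W} {c} {a} {b} =
      (λ h → do
        g , g∈W , h , k ← h
        p , p∈g , pr ← k
        return (g , p , g∈W , proj₁ (comp-⟺ g) h , p∈g , pr)) ,
      (λ h → do
        g , p , g∈W , h , p∈g , pr ← h
        return (g , g∈W , proj₂ (comp-⟺ g) h , return (p , p∈g , pr)))
      where
      comp-⟺ = λ g → ⟺-trans
        (⟦⟧-rename (computationᵇ base step) (# 0 ∷ # 1 ∷ # 3 ∷ []) {g ∷ W ∷ c ∷ a ∷ b ∷ []}) computation-⟺

    Justified-mono : ∀ {g g′ W W′ a b c} → g ⊆ g′ → W ⊆ W′ → Justified g W a b c → Justified g′ W′ a b c
    Justified-mono g⊆ W⊆ = ¬¬-map λ
      { (inj₁ h) → inj₁ h
      ; (inj₂ (q , i , j , w , (q∈g , i∈W , j∈W , w∈W) , h)) →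
          inj₂ (q , i , j , w , (g⊆ q q∈g , W⊆ i i∈W , W⊆ j j∈W , W⊆ w w∈W) , h) }

    Justified-cong : ∀ {g W a b b′ c c′} → b ≈ b′ → c ≈ c′ → Justified g W a b c → Justified g W a b′ c′
    Justified-cong b≈ c≈ = ¬¬-map λ
      { (inj₁ (e , h)) → inj₁ (Empty-cong b≈ e , ⟦⟧-cong base (c≈ ∷ ≈-refl ∷ []) h)
      ; (inj₂ (q , i , j , w , ∈s , pr , sc , h)) →
          inj₂ (q , i , j , w , ∈s , pr , Succ-cong ≈-refl b≈ sc , ⟦⟧-cong step (≈-refl ∷ c≈ ∷ ≈-refl ∷ ≈-refl ∷ []) h) }

    -- The computation provides some components of p; by injectivity of pairs they are b and c up to
    -- `_≈_`.
    entry : ∀ {g W a p b c} → IsComputation g W a → p ∈ g → IsPair p b c → c ∈ W × Justified g W a b c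
    entry {b = b} {c} h p∈g pr =
      ∈-stable (get >>= λ (c∈W , _) → return c∈W) , (get >>= λ (_ , j) → j)
      where
      get = do
        b′ , c′ , _ , c′∈W , pr′ , j ← h _ p∈g
        let b′≈b , c′≈c = IsPair-injective pr′ pr
        return (∈-cong c′≈c ≈-refl c′∈W , Justified-cong b′≈b c′≈c j)

    extend : ∀ {g W a p b c g′ W′} → IsComputation g W a → (∀ q → q ∈ g′ ⟺ ¬ ¬ (q ∈ g ⊎ q ≈ p)) → W ⊆ W′ →
             IsPair p b c → b ∈ W′ → c ∈ W′ → Justified g′ W′ a b c → IsComputation g′ W′ a
    extend {b = b} {c} h hg′ W⊆ pr b∈W′ c∈W′ j q q∈g′ = proj₁ (hg′ q) q∈g′ >>= λ
      { (inj₁ q∈g) → do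
          b′ , c′ , b′∈W , c′∈W , pr′ , j′ ← h q q∈g
          return (b′ , c′ , W⊆ b′ b′∈W , W⊆ c′ c′∈W , pr′ ,
                  Justified-mono (λ r r∈g → proj₂ (hg′ r) (return (inj₁ r∈g))) W⊆ j′)
      ; (inj₂ q≈p) → return (b , c , b∈W′ , c∈W′ ,
          ⟦⟧-cong (pairᵇ (# 0) (# 1) (# 2)) (≈-sym q≈p ∷ ≈-refl ∷ ≈-refl ∷ []) pr , j) }

    Computes-zero : ∀ {a b c} → Empty b → Base a c → ¬ ¬ (∃[ W ] Computes W a b c)
    Computes-zero {a} {b} {c} e h = do
      ∅ , ∅-empty ← empty-exists
      p , pr ← IsPair-exists b c
      g , hg ← adjoin ∅ p
      W , ∅⊆W , g∈W ∷ b∈W ∷ c∈W ∷ [] ← adjoin-all ∅ (g ∷ b ∷ c ∷ [])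
      let none = λ q q∈∅ → contradiction (∅-empty q q∈∅) λ ()
      return (W , return (g , p , g∈W ,
        extend {g = ∅} {W = ∅} none hg ∅⊆W pr b∈W c∈W (return (inj₁ (e , h))) ,
        proj₂ (hg p) (return (inj₂ ≈-refl)) , pr))

    Computes-suc : ∀ {W a b b′ c w k} → Computes W a b c → Succ b b′ → Step w a c k →
                   ¬ ¬ (∃[ W′ ] Computes W′ a b′ k)
    Computes-suc {W} {a} {b} {b′} {c} {w} {k} h sc s = do
      g , p , g∈W , hg , p∈g , pr ← h
      p′ , pr′ ← IsPair-exists b′ k
      g′ , hg′ ← adjoin g p′
      W′ , W⊆W′ , g′∈W′ ∷ b∈W′ ∷ b′∈W′ ∷ c∈W′ ∷ w∈W′ ∷ k∈W′ ∷ [] ←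
        adjoin-all W (g′ ∷ b ∷ b′ ∷ c ∷ w ∷ k ∷ [])
      return (W′ , return (g′ , p′ , g′∈W′ ,
        extend hg hg′ W⊆W′ pr′ b′∈W′ k∈W′
          (return (inj₂ (p , b , c , w , (proj₂ (hg′ p) (return (inj₁ p∈g)) , b∈W′ , c∈W′ , w∈W′) , pr , sc , s))) ,
        proj₂ (hg′ p′) (return (inj₂ ≈-refl)) , pr′))

    -- Bounds the value by the witness; the quantifier over values in the induction for totality
    -- thereby becomes bounded.
    Computes-∈ : ∀ {W a b c} → Computes W a b c → c ∈ W
    Computes-∈ h = ∈-stable do
      g , p , g∈W , hg , p∈g , pr ← h
      return (proj₁ (entry hg p∈g pr))

    -- Two computations are fixed as parameters. Their agreement at b, with the values bounded by W
    -- and W′, is then Δ₀, and ∈-induction on b applies. Intermediate values need not be numbers, so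
    -- the step has to be single-valued at every j.
    Computes-unique : ∀ {a} → (∀ {c c′} → Base a c → Base a c′ → c ≈ c′) →
                      (∀ {w w′ j k k′} → Step w a j k → Step w′ a j k′ → k ≈ k′) →
                      ∀ {W W′ b c c′} → N b → Computes W a b c → Computes W′ a b c′ → c ≈ c′
    Computes-unique {a} base-unique step-unique {W} {W′} {b} {c} {c′} nb h h′ = ≈-stable do
      g , p , g∈W , hg , p∈g , pr ← h
      g′ , p′ , g′∈W′ , hg′ , p′∈g′ , pr′ ← h′
      return (∈-induction (bounded-separable φ (g ∷ W ∷ g′ ∷ W′ ∷ []))
        (λ {b} → ⟦⟧-stable φ {b ∷ g ∷ W ∷ g′ ∷ W′ ∷ []})
        (λ b nb ih p p∈g c _ p′ p′∈g′ c′ _ pr pr′ → ≈-stable do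
          j ← proj₂ (entry hg p∈g pr)
          j′ ← proj₂ (entry hg′ p′∈g′ pr′)
          compare nb ih j j′)
        b nb p p∈g c (proj₁ (entry hg p∈g pr)) p′ p′∈g′ c′ (proj₁ (entry hg′ p′∈g′ pr′)) pr pr′)
      where
      φ : BFormula 5
      φ = ∀∈ (# 1) (∀∈ (# 3) (∀∈ (# 5) (∀∈ (# 7)
            (pairᵇ (# 3) (# 4) (# 2) ⇒ᵇ pairᵇ (# 1) (# 4) (# 0) ⇒ᵇ (# 2) ≈ᵇ (# 0)))))

      compare : ∀ {g g′ b c c′} → N b →
        (∀ z → z ∈ b → ⟦ φ ⟧ (z ∷ g ∷ W ∷ g′ ∷ W′ ∷ [])) →
        (Empty b × Base a c ⊎ (Σ[ q ∈ Carrier ] Σ[ i ∈ Carrier ] Σ[ j ∈ Carrier ] Σ[ w ∈ Carrier ]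
          (q ∈ g × i ∈ W × j ∈ W × w ∈ W) × IsPair q i j × Succ i b × Step w a j c)) →
        (Empty b × Base a c′ ⊎ (Σ[ q ∈ Carrier ] Σ[ i ∈ Carrier ] Σ[ j ∈ Carrier ] Σ[ w ∈ Carrier ]
          (q ∈ g′ × i ∈ W′ × j ∈ W′ × w ∈ W′) × IsPair q i j × Succ i b × Step w a j c′)) →
        ¬ ¬ (c ≈ c′)
      compare nb ih (inj₁ (_ , s)) (inj₁ (_ , s′)) = return (base-unique s s′)
      compare nb ih (inj₁ (e , _)) (inj₂ (_ , _ , _ , _ , _ , _ , sc , _)) = Empty-Succ e sc
      compare nb ih (inj₂ (_ , _ , _ , _ , _ , _ , sc , _)) (inj₁ (e , _)) = Empty-Succ e sc
      compare nb ih (inj₂ (q , i , j , w , (q∈ , _ , j∈ , _) , pr , sc , s))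
                    (inj₂ (q′ , i′ , j′ , w′ , (q′∈ , _ , j′∈ , _) , pr′ , sc′ , s′)) =
        return (step-unique s (⟦⟧-cong step (≈-refl ∷ ≈-refl ∷ ≈-refl ∷ ≈-sym j≈j′ ∷ []) s′))
        where
        i′≈i = Succ-injective nb sc′ sc
        j≈j′ = ih i (proj₁ sc) q q∈ j j∈ q′ q′∈ j′ j′∈ pr
                 (⟦⟧-cong (pairᵇ (# 0) (# 1) (# 2)) (≈-refl ∷ i′≈i ∷ ≈-refl ∷ []) pr′)

    module _ {p : Carrier} (δ : BFormula 2) (Nδ : ∀ x → N x ⟺ ⟦ δ ⟧ (x ∷ p ∷ [])) where

      -- Induction on b. Numberhood of the value is expressed by `δ` and the value is sought inside
      -- W, which makes the induction formula Σ₁ in a and p.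
      Computes-total : (∀ {a} → N a → ¬ ¬ (∃[ c ] N c × Base a c)) →
                       (∀ {a j} → N a → N j → ¬ ¬ (∃[ w ] ∃[ k ] N k × Step w a j k)) →
                       ∀ {a b} → N a → N b → ¬ ¬ (∃[ c ] N c × ¬ ¬ (∃[ W ] Computes W a b c))
      Computes-total base-total step-total {a} na =
        N-induction {P = λ b → ¬ ¬ (∃[ c ] N c × ¬ ¬ (∃[ W ] Computes W a b c))}
          (Separable-⟺ (λ b _ →
            (λ h → do
              W , h ← h
              c , _ , d , h ← h
              return (c , proj₂ (Nδ c) (proj₁ (δ-⟺ c W b) d) , return (W , proj₁ (rec′ c W b) h))) ,
            (λ h → do
              c , nc , h ← h
              W , h ← h
              return (W , return (c , Computes-∈ h , proj₂ (δ-⟺ c W b) (proj₁ (Nδ c) nc) , proj₂ (rec′ c W b) h))))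
            (Σ₁-separable φ (a ∷ p ∷ [])))
          negated-stable
          (λ e h → do
            c , nc , s ← base-total na
            return (c , nc , Computes-zero h s))
          (λ b b′ nb _ sc h → do
            c , nc , h ← h
            W , h ← h
            w , k , nk , s ← step-total na nc
            return (k , nk , Computes-suc h sc s))
          _
        where
        φ : BFormula 4
        φ = ∃∈ (# 0) (rename (# 0 ∷ # 4 ∷ []) δ ∧ᵇ rename (# 1 ∷ # 0 ∷ # 3 ∷ # 2 ∷ []) (recᵇ base step))
        δ-⟺ = λ c W b → ⟦⟧-rename δ (# 0 ∷ # 4 ∷ []) {c ∷ W ∷ b ∷ a ∷ p ∷ []}
        rec′ = λ c W b → ⟺-trans (⟦⟧-rename (recᵇ base step) (# 1 ∷ # 0 ∷ # 3 ∷ # 2 ∷ []) {c ∷ W ∷ b ∷ a ∷ p ∷ []}) rec-⟺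

-- Addition, multiplication and the structure of numbers

module Model {ℓ} (M : RawStructure ℒ∈ ℓ) (isS : IsStructure M)
             (n : ℕ) (M⊨ : M ⊨ (ReS₀ ∪ Sep (Σₙ mem (suc n)))) where
  open Recursion M isS n M⊨ public
  open IsStructure isS using (≈-stable)

  module PlusRec  = Rec ((# 0) ≈ᵇ (# 1)) (succᵇ (# 3) (# 1))
  module TimesRec = Rec (emptyᵇ (# 0)) (rename (# 0 ∷ # 1 ∷ # 3 ∷ # 2 ∷ []) plusᵇ)

  Plus Times : Carrier → Carrier → Carrier → Set ℓ
  Plus a b c  = ¬ ¬ (∃[ W ] ⟦ plusᵇ ⟧ (W ∷ c ∷ a ∷ b ∷ []))
  Times a b c = ¬ ¬ (∃[ W ] ⟦ timesᵇ ⟧ (W ∷ c ∷ a ∷ b ∷ []))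

  Plus-⟺ : ∀ {a b c} → Plus a b c ⟺ ¬ ¬ (∃[ W ] PlusRec.Computes W a b c)
  Plus-⟺ = ¬¬-⟺ (∃-⟺ λ _ → PlusRec.rec-⟺)

  Times-⟺ : ∀ {a b c} → Times a b c ⟺ ¬ ¬ (∃[ W ] TimesRec.Computes W a b c)
  Times-⟺ = ¬¬-⟺ (∃-⟺ λ _ → TimesRec.rec-⟺)

  TimesStep-⟺ : ∀ {w a j k} → TimesRec.Step w a j k ⟺ ⟦ plusᵇ ⟧ (w ∷ k ∷ j ∷ a ∷ [])
  TimesStep-⟺ {w} {a} {j} {k} = ⟦⟧-rename plusᵇ (# 0 ∷ # 1 ∷ # 3 ∷ # 2 ∷ []) {w ∷ k ∷ a ∷ j ∷ []}

  Plus-zero : ∀ {a b} → Empty b → Plus a b a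
  Plus-zero e = proj₂ Plus-⟺ (PlusRec.Computes-zero e ≈-refl)

  Plus-suc : ∀ {a b b′ c c′} → Plus a b c → Succ b b′ → Succ c c′ → Plus a b′ c′
  Plus-suc {c = c} h sb sc = proj₂ Plus-⟺ do
    W , h ← proj₁ Plus-⟺ h
    PlusRec.Computes-suc {w = c} h sb sc

  Times-zero : ∀ {a b c} → Empty b → Empty c → Times a b c
  Times-zero e e′ = proj₂ Times-⟺ (TimesRec.Computes-zero e e′)

  Times-suc : ∀ {a b b′ c c′} → Times a b c → Succ b b′ → Plus c a c′ → Times a b′ c′
  Times-suc h sb s = proj₂ Times-⟺ do
    W , h ← proj₁ Times-⟺ h
    w , s ← s
    TimesRec.Computes-suc {w = w} h sb (proj₂ TimesStep-⟺ s)

  Plus-unique : ∀ {a b c c′} → N b → Plus a b c → Plus a b c′ → c ≈ c′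
  Plus-unique nb h h′ = ≈-stable do
    W , h ← proj₁ Plus-⟺ h
    W′ , h′ ← proj₁ Plus-⟺ h′
    return (PlusRec.Computes-unique (λ p q → ≈-trans p (≈-sym q)) Succ-unique nb h h′)

  Times-unique : ∀ {a b c c′} → N a → N b → Times a b c → Times a b c′ → c ≈ c′
  Times-unique na nb h h′ = ≈-stable do
    W , h ← proj₁ Times-⟺ h
    W′ , h′ ← proj₁ Times-⟺ h′
    return (TimesRec.Computes-unique Empty-unique
      (λ s s′ → Plus-unique na (return (_ , proj₁ TimesStep-⟺ s)) (return (_ , proj₁ TimesStep-⟺ s′)))
      nb h h′)

  -- `N-bounded-definable` provides `δ` and p only classically; that is enough, as they do not occur
  -- in the doubly negated conclusion.
  Plus-total : ∀ {a b} → N a → N b → ¬ ¬ (∃[ c ] N c × Plus a b c)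
  Plus-total na nb = do
    p , δ , Nδ ← N-bounded-definable
    c , nc , h ← PlusRec.Computes-total δ Nδ (λ {a} na → return (a , na , ≈-refl))
      (λ {_} {j} na nj → do
        k , s ← Succ-exists j
        -- The step formula of addition does not mention its witness, so j fills the place.
        return (j , k , N-suc s nj , s)) na nb
    return (c , nc , proj₂ Plus-⟺ h)

  Times-total : ∀ {a b} → N a → N b → ¬ ¬ (∃[ c ] N c × Times a b c)
  Times-total na nb = do
    p , δ , Nδ ← N-bounded-definable
    c , nc , h ← TimesRec.Computes-total δ Nδ
      (λ na → do
        e , h ← empty-exists
        return (e , N-zero h , h))
      (λ na nj → do
        k , nk , h ← Plus-total nj na
        w , h ← h
        return (w , k , nk , proj₂ TimesStep-⟺ h)) na nb
    return (c , nc , proj₂ Times-⟺ h)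

  One : Carrier → Set ℓ
  One x = ⟦ oneᵇ ⟧ (x ∷ [])

  One-unique : ∀ {x y} → One x → One y → x ≈ y
  One-unique h k = ≈-stable do
    d , _ , d-empty , s ← h
    e , _ , e-empty , t ← k
    return (Succ-unique s (Succ-cong (Empty-unique e-empty d-empty) ≈-refl t))

  One-exists : ¬ ¬ (∃[ x ] N x × One x)
  One-exists = do
    e , h ← empty-exists
    x , s ← Succ-exists e
    return (x , N-suc s (N-zero h) , return (e , proj₁ s , h , s))

  Num : Set ℓ
  Num = Σ Carrier N

  nums : ∀ {k} → Vec Num k → Vec Carrier k
  nums = map proj₁

  𝒩 : RawStructure ℒA ℓ
  𝒩 = defined arithmetic M

  𝒩-isStructure : IsStructure 𝒩
  𝒩-isStructure = record
    { nonempty = do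
        e , h ← empty-exists
        return (e , N-zero h)
    ; isEquivalence = record
        { refl  = proj₂ (Sat-≈ _ _) ≈-refl
        ; sym   = λ p → proj₂ (Sat-≈ _ _) (≈-sym (proj₁ (Sat-≈ _ _) p))
        ; trans = λ p q → proj₂ (Sat-≈ _ _) (≈-trans (proj₁ (Sat-≈ _ _) p) (proj₁ (Sat-≈ _ _) q)) }
    ; ≈-stable = Sat-stable (v 0 ≐ v 1)
    ; graph-stable = λ f → Sat-stable (function f)
    ; graph-cong = λ f ps p → Sat-cong (function f) (proj₁ (Sat-≈ _ _) p ∷ ≈-nums ps)
    ; graph-total = total
    ; graph-unique = λ f {xs} {a} {b} h k → proj₂ (Sat-≈ _ _) (unique f {xs} {a} {b} h k)
    ; holds-stable = λ R → Sat-stable (relation R)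
    ; holds-cong = λ R ps → Sat-cong (relation R) (≈-nums ps)
    }
    where
    open Interpretation arithmetic
    open RawStructure 𝒩 using (graph) renaming (_≈_ to _≈ᴺ_)

    ≈-nums : ∀ {m} {as bs : Vec Num m} → Pointwise _≈ᴺ_ as bs → Pointwise _≈_ (nums as) (nums bs)
    ≈-nums = Pointwise.map⁺ (proj₁ (Sat-≈ _ _))

    total : ∀ {m} (f : ArithFunc m) xs → ¬ ¬ (∃[ a ] graph f xs a)
    total zeroᶠ [] = do
      e , h ← empty-exists
      return ((e , N-zero h) , proj₂ (Sat-⌜⌝ (emptyᵇ zero)) h)
    total oneᶠ [] = do
      x , nx , h ← One-exists
      return ((x , nx) , proj₂ (Sat-⌜⌝ oneᵇ) h)
    total plusᶠ ((a , na) ∷ (b , nb) ∷ []) = do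
      c , nc , h ← Plus-total na nb
      return ((c , nc) , ¬¬-map (λ (W , s) → W , proj₂ (Sat-⌜⌝ plusᵇ) s) h)
    total timesᶠ ((a , na) ∷ (b , nb) ∷ []) = do
      c , nc , h ← Times-total na nb
      return ((c , nc) , ¬¬-map (λ (W , s) → W , proj₂ (Sat-⌜⌝ timesᵇ) s) h)

    unique : ∀ {m} (f : ArithFunc m) {xs a b} → graph f xs a → graph f xs b → proj₁ a ≈ proj₁ b
    unique zeroᶠ {[]} h k = Empty-unique (proj₁ (Sat-⌜⌝ (emptyᵇ zero)) h) (proj₁ (Sat-⌜⌝ (emptyᵇ zero)) k)
    unique oneᶠ  {[]} h k = One-unique (proj₁ (Sat-⌜⌝ oneᵇ) h) (proj₁ (Sat-⌜⌝ oneᵇ) k)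
    unique plusᶠ {(a , na) ∷ (b , nb) ∷ []} h k = Plus-unique nb
      (¬¬-map (λ (W , s) → W , proj₁ (Sat-⌜⌝ plusᵇ) s) h) (¬¬-map (λ (W , s) → W , proj₁ (Sat-⌜⌝ plusᵇ) s) k)
    unique timesᶠ {(a , na) ∷ (b , nb) ∷ []} h k = Times-unique na nb
      (¬¬-map (λ (W , s) → W , proj₁ (Sat-⌜⌝ timesᵇ) s) h) (¬¬-map (λ (W , s) → W , proj₁ (Sat-⌜⌝ timesᵇ) s) k)

-- Σ₁ and Δ₁ relations on the numbers

module Definability {ℓ} (M : RawStructure ℒ∈ ℓ) (isS : IsStructure M)
                    (n : ℕ) (M⊨ : M ⊨ (ReS₀ ∪ Sep (Σₙ mem (suc n)))) where
  open Model M isS n M⊨ public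

  skip : ∀ m {k} → Vec (Fin (m + k)) k
  skip m = map (m ↑ʳ_) (allFin _)

  lookup-skip : ∀ {a} {A : Set a} {m k} (xs : Vec A m) (ρ : Vec A k) → map (lookup (xs ++ ρ)) (skip m) ≡ ρ
  lookup-skip {m = m} xs ρ =
    trans (sym (map-∘ (lookup (xs ++ ρ)) (m ↑ʳ_) (allFin _)))
          (trans (map-cong (lookup-++ʳ xs ρ) (allFin _)) (map-lookup-allFin ρ))

  -- Used under m new binders: the indices `is` fill the first l places of φ, and the old
  -- environment fills the others unchanged.
  ⟦⟧-shift : ∀ {l m k} (φ : BFormula (l + k)) (is : Vec (Fin (m + k)) l) (xs : Vec Carrier m) {ρ : Vec Carrier k} →
             ⟦ rename (is ++ skip m) φ ⟧ (xs ++ ρ) ⟺ ⟦ φ ⟧ (map (lookup (xs ++ ρ)) is ++ ρ)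
  ⟦⟧-shift {m = m} φ is xs {ρ} = subst (λ e → ⟦ rename (is ++ skip m) φ ⟧ (xs ++ ρ) ⟺ ⟦ φ ⟧ e)
    (trans (map-++ (lookup (xs ++ ρ)) is (skip m)) (cong (map (lookup (xs ++ ρ)) is ++_) (lookup-skip xs ρ)))
    (⟦⟧-rename φ (is ++ skip m))

  module Relations {p : Carrier} (δ : BFormula 2) (Nδ : ∀ x → N x ⟺ ⟦ δ ⟧ (x ∷ p ∷ [])) where

    -- The double negations admit relations R built with plain `∃` and `⊎`, which need not be
    -- stable. There is a single unbounded witness w, and p is present for the sake of `δ`.
    Σ₁ : ∀ {r k} → (Vec Num k → Set r) → Set (r ⊔ˡ ℓ)
    Σ₁ {k = k} R = Σ[ φ ∈ BFormula (2 + k) ] ∀ ρ → ¬ ¬ R ρ ⟺ ¬ ¬ (∃[ w ] ⟦ φ ⟧ (w ∷ p ∷ nums ρ))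

    Σ₁-resp : ∀ {q r k} {Q : Vec Num k → Set q} {R : Vec Num k → Set r} →
              (∀ ρ → ¬ ¬ Q ρ ⟺ ¬ ¬ R ρ) → Σ₁ Q → Σ₁ R
    Σ₁-resp e (φ , h) = φ , λ ρ → ⟺-trans (⟺-sym (e ρ)) (h ρ)

    Σ₁-bounded : ∀ {k} (φ : BFormula (suc k)) → Σ₁ (λ ρ → ⟦ φ ⟧ (p ∷ nums ρ))
    Σ₁-bounded φ = rename (skip 1) φ , λ ρ → ¬¬-⟺
      ( (λ h → p , proj₂ (⟦⟧-shift φ [] (p ∷ [])) h)
      , (λ (w , h) → proj₁ (⟦⟧-shift φ [] (w ∷ [])) h) )

    Σ₁-rename : ∀ {r k m} {R : Vec Num k → Set r} (is : Vec (Fin m) k) → Σ₁ R → Σ₁ (λ ρ → R (map (lookup ρ) is))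
    Σ₁-rename is (φ , h) = rename (# 0 ∷ # 1 ∷ map (2 ↑ʳ_) is) φ , λ ρ →
      ⟺-trans (h (map (lookup ρ) is)) (¬¬-⟺ (∃-⟺ λ w → ⟺-sym
        (subst (λ e → ⟦ rename (# 0 ∷ # 1 ∷ map (2 ↑ʳ_) is) φ ⟧ (w ∷ p ∷ nums ρ) ⟺ ⟦ φ ⟧ (w ∷ p ∷ e))
          (trans (sym (map-∘ _ _ is)) (trans (map-cong (λ i → lookup-map i proj₁ ρ) is) (map-∘ _ _ is)))
          (⟦⟧-rename φ (# 0 ∷ # 1 ∷ map (2 ↑ʳ_) is) {w ∷ p ∷ nums ρ}))))

    -- Two unbounded witnesses become one: a set u containing both, over which the matrix quantifies
    -- boundedly. Correctness needs no minimality of u, since its members are tested by the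
    -- matrices.
    Σ₁-∧ : ∀ {q r k} {Q : Vec Num k → Set q} {R : Vec Num k → Set r} → Σ₁ Q → Σ₁ R → Σ₁ (λ ρ → Q ρ × R ρ)
    Σ₁-∧ (φ , h) (ψ , k) =
      ∃∈ (# 0) (∃∈ (# 1) (rename (# 1 ∷ skip 3) φ ∧ᵇ rename (# 0 ∷ skip 3) ψ)) , λ ρ →
      (λ qr → do
        w , s ← proj₁ (h ρ) (¬¬-map proj₁ qr)
        w′ , t ← proj₁ (k ρ) (¬¬-map proj₂ qr)
        u , _ , w∈u ∷ w′∈u ∷ [] ← adjoin-all p (w ∷ w′ ∷ [])
        return (u , return (w , w∈u , return (w′ , w′∈u ,
          proj₂ (⟦⟧-shift φ (# 1 ∷ []) (w′ ∷ w ∷ u ∷ [])) s ,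
          proj₂ (⟦⟧-shift ψ (# 0 ∷ []) (w′ ∷ w ∷ u ∷ [])) t)))) ,
      (λ f → do
        u , f ← f
        w , _ , f ← f
        w′ , _ , s , t ← f
        q ← proj₂ (h ρ) (return (w , proj₁ (⟦⟧-shift φ (# 1 ∷ []) (w′ ∷ w ∷ u ∷ [])) s))
        r ← proj₂ (k ρ) (return (w′ , proj₁ (⟦⟧-shift ψ (# 0 ∷ []) (w′ ∷ w ∷ u ∷ [])) t))
        return (q , r))

    Σ₁-∨ : ∀ {q r k} {Q : Vec Num k → Set q} {R : Vec Num k → Set r} → Σ₁ Q → Σ₁ R → Σ₁ (λ ρ → Q ρ ⊎ R ρ)
    Σ₁-∨ (φ , h) (ψ , k) = φ ∨ᵇ ψ , λ ρ →
      (λ qr → qr >>= λ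
        { (inj₁ q) → ¬¬-map (λ (w , s) → w , return (inj₁ s)) (proj₁ (h ρ) (return q))
        ; (inj₂ r) → ¬¬-map (λ (w , s) → w , return (inj₂ s)) (proj₁ (k ρ) (return r)) }) ,
      (λ f → do
        w , f ← f
        inj₁ s ← f
          where inj₂ s → ¬¬-map inj₂ (proj₂ (k ρ) (return (w , s)))
        ¬¬-map inj₁ (proj₂ (h ρ) (return (w , s))))

    -- The number x joins its witness inside u. That x is a number is tested by `δ`; the Π₁
    -- definition would leave Σ₁.
    Σ₁-∃ : ∀ {r k} {R : Vec Num (suc k) → Set r} → Σ₁ R → Σ₁ (λ ρ → ∃[ x ] R (x ∷ ρ))
    Σ₁-∃ (φ , h) =
      ∃∈ (# 0) (rename (# 0 ∷ # 2 ∷ []) δ ∧ᵇ ∃∈ (# 1) (rename (# 0 ∷ # 3 ∷ # 1 ∷ skip 4) φ)) , λ ρ →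
      (λ f → do
        (x , nx) , r ← f
        w , s ← proj₁ (h _) (return r)
        u , _ , w∈u ∷ x∈u ∷ [] ← adjoin-all p (w ∷ x ∷ [])
        return (u , return (x , x∈u ,
          proj₂ (⟦⟧-rename δ (# 0 ∷ # 2 ∷ []) {x ∷ u ∷ p ∷ nums ρ}) (proj₁ (Nδ x) nx) ,
          return (w , w∈u , proj₂ (⟦⟧-shift φ (# 0 ∷ # 3 ∷ # 1 ∷ []) (w ∷ x ∷ u ∷ p ∷ [])) s)))) ,
      (λ f → do
        u , f ← f
        x , _ , d , f ← f
        w , _ , s ← f
        let nx = proj₂ (Nδ x) (proj₁ (⟦⟧-rename δ (# 0 ∷ # 2 ∷ []) {x ∷ u ∷ p ∷ nums ρ}) d)
        r ← proj₂ (h ((x , nx) ∷ ρ)) (return (w ,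
              proj₁ (⟦⟧-shift φ (# 0 ∷ # 3 ∷ # 1 ∷ []) (w ∷ x ∷ u ∷ p ∷ [])) s))
        return ((x , nx) , r))

    -- Σ₁-collection below z: the witnesses for the x < z are gathered by induction.
    Σ₁-∀∈ : ∀ {r k} {R : Vec Num (2 + k) → Set r} → Σ₁ R →
            Σ₁ (λ { (z ∷ ρ) → ∀ x → proj₁ x ∈ proj₁ z → ¬ ¬ R (x ∷ z ∷ ρ) })
    Σ₁-∀∈ {k = k} (φ , h) =
      ∀∈ (# 2) (∃∈ (# 1) (rename (# 0 ∷ # 3 ∷ # 1 ∷ skip 4) φ)) , λ { ((z , nz) ∷ ρ) →
      (λ f → do
        u , g ← collect z nz ρ (λ x x∈z → f >>= λ f → proj₁ (h _) (f (x , ∈N nz x∈z) x∈z)) z nz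
        return (u , λ x x∈z → do
          w , w∈u , s ← g x x∈z x∈z
          return (w , w∈u , proj₂ (⟦⟧-shift φ (# 0 ∷ # 3 ∷ # 1 ∷ []) (w ∷ x ∷ u ∷ p ∷ [])) s))) ,
      (λ f → return λ (x , nx) x∈z → do
        u , f ← f
        w , _ , s ← f x x∈z
        proj₂ (h _) (return (w , proj₁ (⟦⟧-shift φ (# 0 ∷ # 3 ∷ # 1 ∷ []) (w ∷ x ∷ u ∷ p ∷ [])) s))) }
      where
      collect : ∀ z → N z → (ρ : Vec Num k) →
                (∀ x → x ∈ z → ¬ ¬ (∃[ w ] ⟦ φ ⟧ (w ∷ p ∷ x ∷ z ∷ nums ρ))) →
                ∀ i → N i → ¬ ¬ (∃[ u ] ∀ x → x ∈ i → x ∈ z → ¬ ¬ (∃[ w ] w ∈ u × ⟦ φ ⟧ (w ∷ p ∷ x ∷ z ∷ nums ρ)))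
      collect z nz ρ f i ni = N-induction
        (Separable-⟺ (λ i _ → ¬¬-⟺ (∃-⟺ λ u → Π-⟺ λ x → →-⟺ ⟺-refl (→-⟺ ⟺-refl
          (¬¬-⟺ (∃-⟺ λ w → ×-⟺ ⟺-refl (⟦⟧-shift φ (# 0 ∷ # 4 ∷ # 1 ∷ []) (w ∷ x ∷ u ∷ i ∷ p ∷ [])))))))
          (Σ₁-separable ψ (p ∷ z ∷ nums ρ)))
        negated-stable
        (λ e e-empty → return (p , λ x x∈e → contradiction (e-empty x x∈e) λ ()))
        (λ i s ni _ (_ , _ , k) ih → do
          u , g ← ih
          -- The induction passes through all numbers i, while witnesses are promised below z only;
          -- for i outside z nothing has to be added.
          no i∉z ← ¬¬-excluded-middle {A = i ∈ z}
            where
            yes i∈z → do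
              w , t ← f i i∈z
              u′ , u⊆u′ , w∈u′ ∷ [] ← adjoin-all u (w ∷ [])
              return (u′ , λ x x∈s x∈z → k x x∈s >>= λ
                { (inj₁ x∈i) → ¬¬-map (λ (w , w∈u , t) → w , u⊆u′ w w∈u , t) (g x x∈i x∈z)
                ; (inj₂ x≈i) → return (w , w∈u′ ,
                    ⟦⟧-cong φ (≈-refl ∷ ≈-refl ∷ ≈-sym x≈i ∷ Pointwise.refl ≈-refl) t) })
          return (u , λ x x∈s x∈z → k x x∈s >>= λ
            { (inj₁ x∈i) → g x x∈i x∈z
            ; (inj₂ x≈i) → contradiction (∈-cong x≈i ≈-refl x∈z) i∉z }))
        i ni
        where
        ψ : BFormula (4 + k)
        ψ = ∀∈ (# 1) ((# 0) ∈ᵇ (# 4) ⇒ᵇ ∃∈ (# 1) (rename (# 0 ∷ # 4 ∷ # 1 ∷ skip 5) φ))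

-- Δ₀ formulas of arithmetic are Δ₁

module Translation {ℓ} (M : RawStructure ℒ∈ ℓ) (isS : IsStructure M)
                   (n : ℕ) (M⊨ : M ⊨ (ReS₀ ∪ Sep (Σₙ mem (suc n)))) where
  open Definability M isS n M⊨ public
  open RawStructure 𝒩 using () renaming (graph to graph𝒩; _≈_ to _≈𝒩_)
  module S𝒩 = Satisfaction 𝒩 𝒩-isStructure

  Value-unique𝒩 : ∀ {k} {ρ : Vec Num k} {t a b} → Value 𝒩 ρ t a → Value 𝒩 ρ t b → proj₁ a ≈ proj₁ b
  Value-unique𝒩 s t = proj₁ (Sat-≈ _ _) (S𝒩.Value-unique s t)

  ≈𝒩-refl : ∀ {a} → a ≈𝒩 a
  ≈𝒩-refl = proj₂ (Sat-≈ _ _) ≈-refl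

  less-⟺ : ∀ {k} {ρ : Vec Num k} (t : Term ℒA k) x {z} → Value 𝒩 ρ t z →
           Sat 𝒩 (var zero <′ weaken t) (x ∷ ρ) ⟺ proj₁ x ∈ proj₁ z
  less-⟺ {ρ = ρ} t x {z} tz =
    (λ s → proj₁ (Sat-∈ _ _) (s (x ∷ z ∷ []) (x-value ∷ z-value ∷ []))) ,
    (λ { h _ (a ∷ b ∷ []) → proj₂ (Sat-∈ _ _) (∈-cong (Value-unique𝒩 x-value a) (Value-unique𝒩 z-value b) h) })
    where
    x-value : Value 𝒩 (x ∷ ρ) (var zero) x
    x-value = val-var (≈𝒩-refl {x})

    z-value : Value 𝒩 (x ∷ ρ) (weaken t) z
    z-value = proj₂ (S𝒩.Value-weaken t) tz

  module Δ₁Relations {p : Carrier} (δ : BFormula 2) (Nδ : ∀ x → N x ⟺ ⟦ δ ⟧ (x ∷ p ∷ [])) where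
    open Relations δ Nδ

    Σ₁-shift : ∀ {r l} m {k} {R : Vec Num (l + k) → Set r} (is : Vec (Fin (m + k)) l) →
               Σ₁ R → Σ₁ (λ ρ → R (map (lookup ρ) is ++ drop m ρ))
    Σ₁-shift m {R = R} is s = Σ₁-resp
      (λ ρ → subst (λ e → ¬ ¬ R (map (lookup ρ) (is ++ skip m)) ⟺ ¬ ¬ R e) (lookups ρ) ⟺-refl)
      (Σ₁-rename {R = R} (is ++ skip m) s)
      where
      lookups : ∀ ρ → map (lookup ρ) (is ++ skip m) ≡ map (lookup ρ) is ++ drop m ρ
      lookups ρ = trans (map-++ (lookup ρ) is (skip m)) (cong (map (lookup ρ) is ++_)
        (subst (λ e → map (lookup e) (skip m) ≡ drop m ρ) (take++drop≡id m ρ) (lookup-skip (take m ρ) (drop m ρ))))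

    graph-Σ₁ : ∀ {m} (f : ArithFunc m) → Σ₁ (λ ρ → graph𝒩 f (tail ρ) (head ρ))
    graph-Σ₁ zeroᶠ = Σ₁-resp (λ { (_ ∷ []) → ¬¬-⟺ (⟺-sym (Sat-⌜⌝ (emptyᵇ zero))) }) (Σ₁-bounded (emptyᵇ (# 1)))
    graph-Σ₁ oneᶠ  = Σ₁-resp
      (λ { (c ∷ []) → ¬¬-⟺ (⟺-trans (⟦⟧-rename oneᵇ (# 1 ∷ []) {p ∷ proj₁ c ∷ []}) (⟺-sym (Sat-⌜⌝ oneᵇ))) })
      (Σ₁-bounded (rename (# 1 ∷ []) oneᵇ))
    graph-Σ₁ plusᶠ = rename (# 0 ∷ # 2 ∷ # 3 ∷ # 4 ∷ []) plusᵇ , λ { ((c , _) ∷ (a , _) ∷ (b , _) ∷ []) →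
      ⟺-trans (negated-stable , return) (¬¬-⟺ (∃-⟺ λ w → ⟺-trans (Sat-⌜⌝ plusᵇ)
        (⟺-sym (⟦⟧-rename plusᵇ (# 0 ∷ # 2 ∷ # 3 ∷ # 4 ∷ []) {w ∷ p ∷ c ∷ a ∷ b ∷ []})))) }
    graph-Σ₁ timesᶠ = rename (# 0 ∷ # 2 ∷ # 3 ∷ # 4 ∷ []) timesᵇ , λ { ((c , _) ∷ (a , _) ∷ (b , _) ∷ []) →
      ⟺-trans (negated-stable , return) (¬¬-⟺ (∃-⟺ λ w → ⟺-trans (Sat-⌜⌝ timesᵇ)
        (⟺-sym (⟦⟧-rename timesᵇ (# 0 ∷ # 2 ∷ # 3 ∷ # 4 ∷ []) {w ∷ p ∷ c ∷ a ∷ b ∷ []})))) }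

    -- Terms are unnested: the values of the immediate subterms are numbers under existential
    -- quantifiers.
    value-Σ₁ : ∀ {k} (t : Term ℒA k) → Σ₁ (λ ρ → Value 𝒩 (tail ρ) t (head ρ))

    private
      constant-Σ₁ : ∀ {k} (f : ArithFunc 0) → Σ₁ (λ ρ → Value 𝒩 {k = k} (tail ρ) (app f []) (head ρ))
      constant-Σ₁ f = Σ₁-resp (λ { (a ∷ ρ) → ¬¬-⟺ ((λ g → val-app [] g) , (λ { (val-app [] g) → g })) })
        (Σ₁-rename (# 0 ∷ []) (graph-Σ₁ f))

      binary-Σ₁ : ∀ {k} (f : ArithFunc 2) (t u : Term ℒA k) →
                  Σ₁ (λ ρ → Value 𝒩 (tail ρ) t (head ρ)) → Σ₁ (λ ρ → Value 𝒩 (tail ρ) u (head ρ)) →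
                  Σ₁ (λ ρ → Value 𝒩 (tail ρ) (app f (t ∷ u ∷ [])) (head ρ))
      binary-Σ₁ f t u st su = Σ₁-resp
        (λ { (a ∷ ρ) → ¬¬-⟺
          ( (λ { (x , y , tx , uy , g) → val-app (tx ∷ uy ∷ []) g })
          , (λ { (val-app (tx ∷ uy ∷ []) g) → _ , _ , tx , uy , g }) ) })
        (Σ₁-∃ (Σ₁-∃ (Σ₁-∧ (Σ₁-shift 3 (# 1 ∷ []) st) (Σ₁-∧ (Σ₁-shift 3 (# 0 ∷ []) su)
          (Σ₁-rename (# 2 ∷ # 1 ∷ # 0 ∷ []) (graph-Σ₁ f))))))

    value-Σ₁ (var i) = Σ₁-resp
      (λ { (a ∷ ρ) → ¬¬-⟺
        ( (λ h → val-var (proj₂ (Sat-≈ _ _) (subst (_≈ proj₁ a) (lookup-map i proj₁ ρ) h)))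
        , (λ { (val-var h) → subst (_≈ proj₁ a) (sym (lookup-map i proj₁ ρ)) (proj₁ (Sat-≈ _ _) h) }) ) })
      (Σ₁-bounded (suc (suc i) ≈ᵇ # 1))
    value-Σ₁ (app zeroᶠ [])            = constant-Σ₁ zeroᶠ
    value-Σ₁ (app oneᶠ [])             = constant-Σ₁ oneᶠ
    value-Σ₁ (app plusᶠ (t ∷ u ∷ []))  = binary-Σ₁ plusᶠ t u (value-Σ₁ t) (value-Σ₁ u)
    value-Σ₁ (app timesᶠ (t ∷ u ∷ [])) = binary-Σ₁ timesᶠ t u (value-Σ₁ t) (value-Σ₁ u)

    Δ₁ : ∀ {k} → (Vec Num k → Set ℓ) → Set ℓ
    Δ₁ R = Σ₁ R × Σ₁ (λ ρ → ¬ R ρ)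

    -- Values exist and are unique, so "for all values" is equivalent to "for some values"; the
    -- latter is Σ₁ both for B and for its negation.
    atomic-Δ₁ : ∀ {k} (B : BFormula 2) (t u : Term ℒA k) →
      Δ₁ (λ ρ → ∀ a b → Value 𝒩 ρ t a → Value 𝒩 ρ u b → ⟦ B ⟧ (proj₁ a ∷ proj₁ b ∷ []))
    atomic-Δ₁ B t u =
      Σ₁-resp (λ ρ →
          (λ h → return λ a b ta ub → ⟦⟧-stable B (¬¬-map (λ (a′ , b′ , ta′ , ub′ , s) →
            ⟦⟧-cong B (Value-unique𝒩 ta′ ta ∷ Value-unique𝒩 ub′ ub ∷ []) s) h)) ,
          (λ h → do
            h ← h
            a , ta ← S𝒩.Value-total ρ t
            b , ub ← S𝒩.Value-total ρ u
            return (a , b , ta , ub , h a b ta ub)))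
        (values B) ,
      Σ₁-resp (λ ρ →
          (λ h → do
            a , b , ta , ub , s ← h
            return λ f → contradiction (s (f a b ta ub)) λ ()) ,
          (λ h → do
            ¬f ← h
            a , ta ← S𝒩.Value-total ρ t
            b , ub ← S𝒩.Value-total ρ u
            return (a , b , ta , ub , λ s → contradiction
              (λ a′ b′ ta′ ub′ → ⟦⟧-cong B (Value-unique𝒩 ta ta′ ∷ Value-unique𝒩 ub ub′ ∷ []) s) ¬f)))
        (values (B ⇒ᵇ ⊥ᵇ))
      where
      values : ∀ C → Σ₁ (λ ρ → ∃[ a ] ∃[ b ] Value 𝒩 ρ t a × Value 𝒩 ρ u b × ⟦ C ⟧ (proj₁ a ∷ proj₁ b ∷ []))
      values C = Σ₁-∃ (Σ₁-∃ (Σ₁-∧ (Σ₁-shift 2 (# 1 ∷ []) (value-Σ₁ t)) (Σ₁-∧ (Σ₁-shift 2 (# 0 ∷ []) (value-Σ₁ u))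
        (Σ₁-resp {R = λ ρ → ⟦ C ⟧ (proj₁ (head (tail ρ)) ∷ proj₁ (head ρ) ∷ [])}
          (λ { ((b , _) ∷ (a , _) ∷ ρ) → ¬¬-⟺ (⟦⟧-rename C (# 2 ∷ # 1 ∷ []) {p ∷ b ∷ a ∷ nums ρ}) })
          (Σ₁-bounded (rename (# 2 ∷ # 1 ∷ []) C))))))

    below-value-Σ₁ : ∀ {k} (t : Term ℒA k) {R Q : Vec Num (suc k) → Set ℓ} →
      (∀ x z ρ → Value 𝒩 ρ t z → R (x ∷ ρ) ⟺ (proj₁ x ∈ proj₁ z × Q (x ∷ ρ))) →
      Σ₁ Q → Σ₁ (λ ρ → ∃[ x ] R (x ∷ ρ))
    below-value-Σ₁ t e s = Σ₁-resp
      (λ ρ →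
        (λ h → do
          z , x , tz , x∈z , q ← h
          return (x , proj₂ (e x z ρ tz) (x∈z , q))) ,
        (λ h → do
          x , r ← h
          z , tz ← S𝒩.Value-total ρ t
          return (z , x , tz , proj₁ (e x z ρ tz) r)))
      (Σ₁-∃ (Σ₁-∃ (Σ₁-∧ (Σ₁-shift 2 (# 1 ∷ []) (value-Σ₁ t))
        (Σ₁-∧ (Σ₁-bounded (# 1 ∈ᵇ # 2)) (Σ₁-shift 2 (# 0 ∷ []) s)))))

    -- The value z of the bounding term is guessed by an existential quantifier, and collection
    -- below z does the rest. This serves bounded ∀ as well as the complement of bounded ∃;
    -- `below-value-Σ₁` serves the two dual cases.
    all-below-value-Σ₁ : ∀ {k} (t : Term ℒA k) {R Q : Vec Num (suc k) → Set ℓ} →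
      (∀ x z ρ → Value 𝒩 ρ t z → ¬ ¬ R (x ∷ ρ) ⟺ (proj₁ x ∈ proj₁ z → ¬ ¬ Q (x ∷ ρ))) →
      Σ₁ Q → Σ₁ (λ ρ → ∀ x → ¬ ¬ R (x ∷ ρ))
    all-below-value-Σ₁ t {Q = Q} e s = Σ₁-resp
      (λ ρ →
        (λ h → do
          z , tz , f ← h
          return λ x → proj₂ (e x z ρ tz) (f x)) ,
        (λ h → do
          f ← h
          z , tz ← S𝒩.Value-total ρ t
          return (z , tz , λ x → proj₁ (e x z ρ tz) (f x))))
      (Σ₁-∃ (Σ₁-∧ (value-Σ₁ t) (Σ₁-resp
        {R = λ ρ → ∀ x → proj₁ x ∈ proj₁ (head ρ) → ¬ ¬ Q (x ∷ tail ρ)} (λ { (z ∷ ρ) → ⟺-refl }) (Σ₁-∀∈ (Σ₁-shift 2 (# 0 ∷ []) s)))))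

    -- Both halves are proved in one induction, because implications and complements of quantifiers
    -- call for the opposite half of a subformula.
    Δ₀-Δ₁ : ∀ {k} {φ : Formula ℒA k} → Δ₀ less φ → Δ₁ (Sat 𝒩 φ)
    Δ₀-Δ₁ (eq t u) =
      let s , s′ = atomic-Δ₁ (# 0 ≈ᵇ # 1) t u in
      Σ₁-resp (λ ρ → ¬¬-⟺ e) s , Σ₁-resp (λ ρ → ¬¬-⟺ (→-⟺ e ⟺-refl)) s′
      where
      e : ∀ {ρ} → (∀ a b → Value 𝒩 ρ t a → Value 𝒩 ρ u b → proj₁ a ≈ proj₁ b) ⟺ Sat 𝒩 (t ≐ u) ρ
      e = Π-⟺ λ a → Π-⟺ λ b → →-⟺ ⟺-refl (→-⟺ ⟺-refl (⟺-sym (Sat-≈ _ _)))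
    Δ₀-Δ₁ (atom less (t ∷ u ∷ [])) =
      let s , s′ = atomic-Δ₁ (# 0 ∈ᵇ # 1) t u in
      Σ₁-resp (λ ρ → ¬¬-⟺ e) s , Σ₁-resp (λ ρ → ¬¬-⟺ (→-⟺ e ⟺-refl)) s′
      where
      e : ∀ {ρ} → (∀ a b → Value 𝒩 ρ t a → Value 𝒩 ρ u b → proj₁ a ∈ proj₁ b) ⟺ Sat 𝒩 (t <′ u) ρ
      e = (λ { f (a ∷ b ∷ []) (ta ∷ ub ∷ []) → proj₂ (Sat-∈ _ _) (f a b ta ub) }) ,
          (λ f a b ta ub → proj₁ (Sat-∈ _ _) (f (a ∷ b ∷ []) (ta ∷ ub ∷ [])))
    Δ₀-Δ₁ false =
      Σ₁-bounded ⊥ᵇ , Σ₁-resp (λ ρ → ¬¬-⟺ ((λ _ ()) , (λ _ ()))) (Σ₁-bounded (⊥ᵇ ⇒ᵇ ⊥ᵇ))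
    Δ₀-Δ₁ (and d e) =
      let s , s′ = Δ₀-Δ₁ d
          t , t′ = Δ₀-Δ₁ e in
      Σ₁-∧ s t ,
      Σ₁-resp (λ ρ →
        (λ h → do
          inj₁ ¬a ← h
            where inj₂ ¬b → return λ (a , b) → ¬b b
          return λ (a , b) → ¬a a) ,
        (λ h k → h λ ¬ab → k (inj₁ λ a → k (inj₂ λ b → ¬ab (a , b)))))
        (Σ₁-∨ s′ t′)
    Δ₀-Δ₁ (or d e) =
      let s , s′ = Δ₀-Δ₁ d
          t , t′ = Δ₀-Δ₁ e in
      Σ₁-resp (λ ρ → return , negated-stable) (Σ₁-∨ s t) ,
      Σ₁-resp (λ ρ →
        (λ h → ¬¬-map (λ (¬a , ¬b) ¬ab → ¬ab ([ ¬a , ¬b ])) h) ,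
        (λ h → ¬¬-map (λ ¬¬¬k → (λ a → ¬¬¬k (return (inj₁ a))) , (λ b → ¬¬¬k (return (inj₂ b)))) h))
        (Σ₁-∧ s′ t′)
    Δ₀-Δ₁ (imp {ψ = ψ} d e) =
      let s , s′ = Δ₀-Δ₁ d
          t , t′ = Δ₀-Δ₁ e in
      Σ₁-resp (λ ρ →
        (λ h → return λ a → S𝒩.Sat-stable ψ (¬¬-map [ (λ ¬a → contradiction a ¬a) , id ] h)) ,
        (λ h k → h λ f → k (inj₁ λ a → k (inj₂ (f a)))))
        (Σ₁-∨ s′ t) ,
      Σ₁-resp (λ ρ →
        ¬¬-map (λ (a , ¬b) f → ¬b (f a)) ,
        (λ h k → h λ ¬f → ¬f λ a → S𝒩.Sat-stable ψ λ ¬b → k (a , ¬b)))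
        (Σ₁-∧ s t′)
    Δ₀-Δ₁ (ball t {φ} d) =
      let s , s′ = Δ₀-Δ₁ d in
      Σ₁-resp (λ ρ → ¬¬-⟺ (Π-⟺ λ x → S𝒩.Sat-stable (var zero <′ weaken t ⇒ φ) , return))
        (all-below-value-Σ₁ t {R = λ ρ → Sat 𝒩 (var zero <′ weaken t) ρ → Sat 𝒩 φ ρ} (λ x z ρ tz →
          (λ h x∈z → ¬¬-map (λ f → f (proj₂ (less-⟺ t x tz) x∈z)) h) ,
          (λ f → return λ l → S𝒩.Sat-stable φ (f (proj₁ (less-⟺ t x tz) l)))) s) ,
      Σ₁-resp (λ ρ →
        (λ h → ¬¬-map (λ (x , ¬f) f → ¬f (f x)) h) ,
        (λ h k → h λ ¬f → ¬f λ x → S𝒩.Sat-stable (var zero <′ weaken t ⇒ φ) λ ¬g → k (x , ¬g)))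
        (below-value-Σ₁ t {R = λ ρ → ¬ (Sat 𝒩 (var zero <′ weaken t) ρ → Sat 𝒩 φ ρ)} (λ x z ρ tz →
          (λ ¬f → ∈-stable (λ x∉z → ¬f λ l → contradiction (proj₁ (less-⟺ t x tz) l) x∉z) , λ a → ¬f λ _ → a) ,
          (λ (x∈z , ¬a) f → ¬a (f (proj₂ (less-⟺ t x tz) x∈z)))) s′)
    Δ₀-Δ₁ (bex t {φ} d) =
      let s , s′ = Δ₀-Δ₁ d in
      Σ₁-resp (λ ρ → return , negated-stable)
        (below-value-Σ₁ t {R = λ ρ → Sat 𝒩 (var zero <′ weaken t) ρ × Sat 𝒩 φ ρ} (λ x z ρ tz → ×-⟺ (less-⟺ t x tz) ⟺-refl) s) ,
      Σ₁-resp (λ ρ → ¬¬-⟺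
        ( (λ f h → h λ (x , l , a) → f x λ g → g l a)
        , (λ h x → return λ l a → h (return (x , l , a))) ))
        (all-below-value-Σ₁ t {R = λ ρ → Sat 𝒩 (var zero <′ weaken t) ρ → ¬ Sat 𝒩 φ ρ} (λ x z ρ tz →
          (λ h x∈z → ¬¬-map (λ f → f (proj₂ (less-⟺ t x tz) x∈z)) h) ,
          (λ f → return λ l a → f (proj₁ (less-⟺ t x tz) l) λ ¬a → ¬a a)) s′)

-- Translation of the arithmetical hierarchy, and Σₙ-induction

module InductionScheme {ℓ} (M : RawStructure ℒ∈ ℓ) (isS : IsStructure M)
                       (n : ℕ) (M⊨ : M ⊨ (ReS₀ ∪ Sep (Σₙ mem (suc n)))) where
  open Translation M isS n M⊨ public
  open IsStructure isS using (nonempty)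

  -- A relativised ∃ guards by conjunction, a relativised ∀ by implication. Either guard has to move
  -- inwards through blocks of both kinds, hence the uniform treatment.
  data Guard : Set where
    conjunctive conditional : Guard

  Guarded : Guard → Set ℓ → Set ℓ → Set ℓ
  Guarded conjunctive A B = A × B
  Guarded conditional A B = A → B

  -- In the conditional case with a failing guard any element is a witness, and nonemptiness of the
  -- universe provides one. `Guarded-∀` uses it to extract the guard in the conjunctive case.
  Guarded-∃ : ∀ g {A} {B : Carrier → Set ℓ} → Stable A →
              ¬ ¬ (∃[ a ] Guarded g A (B a)) ⟺ Guarded g A (¬ ¬ (∃[ a ] B a))
  Guarded-∃ conjunctive st =
    (λ h → st (¬¬-map (λ (_ , x , _) → x) h) , ¬¬-map (λ (a , _ , b) → a , b) h) ,
    (λ (x , h) → ¬¬-map (λ (a , b) → a , x , b) h)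
  Guarded-∃ conditional {A} st =
    (λ h x → ¬¬-map (λ (a , f) → a , f x) h) ,
    (λ f → ¬¬-excluded-middle {A = A} >>= λ
      { (yes x) → ¬¬-map (λ (a , b) → a , λ _ → b) (f x)
      ; (no ¬x) → ¬¬-map (λ a → a , λ x → contradiction x ¬x) nonempty })

  Guarded-∀ : ∀ g {A} {B : Carrier → Set ℓ} → Stable A →
              (∀ a → Guarded g A (B a)) ⟺ Guarded g A (∀ a → B a)
  Guarded-∀ conjunctive st =
    (λ f → st (¬¬-map (λ a → proj₁ (f a)) nonempty) , proj₂ ∘ f) , (λ (x , f) a → x , f a)
  Guarded-∀ conditional st = (λ f x a → f a x) , (λ f a x → f x a)

  -- Quantifiers relativised to the numbers do not leave Σₙ or Πₙ, since the matrix
  -- absorbs the Δ₀ guard.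

  PrenexGuard : (FormulaClass ℒ∈) → Guard → ∀ {k} → BFormula k → Formula ℒ∈ k → Set ℓ
  PrenexGuard Γ g {k} γ φ = Σ[ ψ ∈ Formula ℒ∈ k ] Γ ψ × (∀ ρ → Sat M ψ ρ ⟺ Guarded g (⟦ γ ⟧ ρ) (Sat M φ ρ))

  guard-Σₙ : ∀ g {m k} (γ : BFormula k) {φ} → Σₙ mem m φ → PrenexGuard (Σₙ mem m) g γ φ
  guard-Πₙ : ∀ g {m k} (γ : BFormula k) {φ} → Πₙ mem m φ → PrenexGuard (Πₙ mem m) g γ φ

  guard-Δ₀ : ∀ g {k} (γ : BFormula k) {φ} → Δ₀ mem φ → PrenexGuard (Δ₀ mem) g γ φ
  guard-Δ₀ conjunctive γ {φ} d = ⌜ γ ⌝ ∧′ φ , and (⌜⌝-Δ₀ γ) d , λ ρ → ×-⟺ (Sat-⌜⌝ γ) ⟺-refl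
  guard-Δ₀ conditional γ {φ} d = ⌜ γ ⌝ ⇒ φ , imp (⌜⌝-Δ₀ γ) d , λ ρ → →-⟺ (Sat-⌜⌝ γ) ⟺-refl

  Guarded-weaken : ∀ g {k} (γ : BFormula k) {a ρ B} → Guarded g (⟦ rename (skip 1) γ ⟧ (a ∷ ρ)) B ⟺ Guarded g (⟦ γ ⟧ ρ) B
  Guarded-weaken conjunctive γ {a} = ×-⟺ (⟦⟧-shift γ [] (a ∷ [])) ⟺-refl
  Guarded-weaken conditional γ {a} = →-⟺ (⟦⟧-shift γ [] (a ∷ [])) ⟺-refl

  guard-Σₙ g γ (Δ₀⇒Σ d) = let ψ , e , h = guard-Δ₀ g γ d in ψ , Δ₀⇒Σ e , h
  guard-Σₙ g γ (Π⇒Σ π)  = let ψ , e , h = guard-Πₙ g γ π in ψ , Π⇒Σ e , h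
  guard-Σₙ g γ (ex σ)   =
    let ψ , e , h = guard-Σₙ g (rename (skip 1) γ) σ in
    ∃′ ψ , ex e , λ ρ → ⟺-trans (¬¬-⟺ (∃-⟺ λ a → ⟺-trans (h (a ∷ ρ)) (Guarded-weaken g γ)))
                               (Guarded-∃ g (⟦⟧-stable γ))

  guard-Πₙ g γ (Δ₀⇒Π d) = let ψ , e , h = guard-Δ₀ g γ d in ψ , Δ₀⇒Π e , h
  guard-Πₙ g γ (Σ⇒Π σ)  = let ψ , e , h = guard-Σₙ g γ σ in ψ , Σ⇒Π e , h
  guard-Πₙ g γ (all π)  =
    let ψ , e , h = guard-Πₙ g (rename (skip 1) γ) π in
    ∀′ ψ , all e , λ ρ → ⟺-trans (Π-⟺ λ a → ⟺-trans (h (a ∷ ρ)) (Guarded-weaken g γ))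
                                (Guarded-∀ g (⟦⟧-stable γ))

  module _ {p : Carrier} (δ : BFormula 2) (Nδ : ∀ x → N x ⟺ ⟦ δ ⟧ (x ∷ p ∷ [])) where
    open Relations δ Nδ
    open Δ₁Relations δ Nδ

    -- With the parameter in last place, `env (x ∷ ρ)` is by definition `proj₁ x ∷ env ρ`, so the
    -- binders of a formula and of its translation match. `Σ₁` keeps p next to the witness instead;
    -- `reorder` mediates.
    env : ∀ {k} → Vec Num k → Vec Carrier (k + 1)
    env ρ = nums ρ ++ p ∷ []

    Translated : (FormulaClass ℒ∈) → ∀ {k} → Formula ℒA k → Set ℓ
    Translated Γ {k} φ = Σ[ ψ ∈ Formula ℒ∈ (k + 1) ] Γ ψ × (∀ ρ → Sat M ψ (env ρ) ⟺ Sat 𝒩 φ ρ)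

    private
      reorder : ∀ k → Vec (Fin (suc (k + 1))) (2 + k)
      reorder k = zero ∷ suc (k ↑ʳ zero) ∷ map (λ i → suc (i ↑ˡ 1)) (allFin k)

      ⟦⟧-reorder : ∀ {k} (φ : BFormula (2 + k)) w (ρ : Vec Num k) →
                   ⟦ rename (reorder k) φ ⟧ (w ∷ env ρ) ⟺ ⟦ φ ⟧ (w ∷ p ∷ nums ρ)
      ⟦⟧-reorder {k} φ w ρ = subst (λ e → ⟦ rename (reorder k) φ ⟧ (w ∷ env ρ) ⟺ ⟦ φ ⟧ (w ∷ e))
        (cong₂ _∷_ (lookup-++ʳ (nums ρ) (p ∷ []) zero)
          (trans (sym (map-∘ (lookup (w ∷ env ρ)) (λ i → suc (i ↑ˡ 1)) (allFin k)))
            (trans (map-cong (lookup-++ˡ (nums ρ) (p ∷ [])) (allFin k)) (map-lookup-allFin (nums ρ)))))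
        (⟦⟧-rename φ (reorder k))

      isNumber : ∀ k → BFormula (suc (k + 1))
      isNumber k = rename (zero ∷ suc (k ↑ʳ zero) ∷ []) δ

      isNumber-⟺ : ∀ {k} a (ρ : Vec Num k) → ⟦ isNumber k ⟧ (a ∷ env ρ) ⟺ N a
      isNumber-⟺ {k} a ρ = ⟺-trans
        (subst (λ q → ⟦ isNumber k ⟧ (a ∷ env ρ) ⟺ ⟦ δ ⟧ (a ∷ q ∷ [])) (lookup-++ʳ (nums ρ) (p ∷ []) zero)
          (⟦⟧-rename δ (zero ∷ suc (k ↑ʳ zero) ∷ [])))
        (⟺-sym (Nδ a))

    -- The recursion ends at level one, not zero. There the matrix takes its Σ₁ form; `translate-Πₙ`
    -- takes the negation of the Σ₁ form of the complement. Either way the new quantifier joins the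
    -- innermost block.
    translate-Σₙ : ∀ {m k} {φ : Formula ℒA k} → Σₙ less (suc m) φ → Translated (Σₙ mem (suc m)) φ
    translate-Πₙ : ∀ {m k} {φ : Formula ℒA k} → Πₙ less (suc m) φ → Translated (Πₙ mem (suc m)) φ

    translate-Σₙ {φ = φ} (Π⇒Σ (Δ₀⇒Π d)) =
      let (χ , h) , _ = Δ₀-Δ₁ d in
      ∃′ ⌜ rename (reorder _) χ ⌝ , ex (Π⇒Σ (Δ₀⇒Π (⌜⌝-Δ₀ (rename (reorder _) χ)))) , λ ρ →
        ⟺-trans (¬¬-⟺ (∃-⟺ λ w → ⟺-trans (Sat-⌜⌝ (rename (reorder _) χ)) (⟦⟧-reorder χ w ρ)))
          (⟺-trans (⟺-sym (h ρ)) (S𝒩.Sat-stable φ , return))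
    translate-Σₙ {suc m} (Π⇒Σ π@(Σ⇒Π _)) = let ψ , e , h = translate-Πₙ π in ψ , Π⇒Σ e , h
    translate-Σₙ {suc m} (Π⇒Σ π@(all _)) = let ψ , e , h = translate-Πₙ π in ψ , Π⇒Σ e , h
    translate-Σₙ (ex {φ = φ} σ) =
      let ψ , e , h    = translate-Σₙ σ
          ψ′ , e′ , h′ = guard-Σₙ conjunctive (isNumber _) e in
      ∃′ ψ′ , ex e′ , λ ρ → ¬¬-⟺
        ( (λ (a , s) → let d , t = proj₁ (h′ _) s
                           na = proj₁ (isNumber-⟺ a ρ) d in (a , na) , proj₁ (h ((a , na) ∷ ρ)) t)
        , (λ ((a , na) , s) → a , proj₂ (h′ _) (proj₂ (isNumber-⟺ a ρ) na , proj₂ (h ((a , na) ∷ ρ)) s)) )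

    translate-Πₙ {φ = φ} (Σ⇒Π (Δ₀⇒Σ d)) =
      let _ , (χ , h) = Δ₀-Δ₁ d
          χ′ = rename (reorder _) χ ⇒ᵇ ⊥ᵇ in
      ∀′ ⌜ χ′ ⌝ , all (Σ⇒Π (Δ₀⇒Σ (⌜⌝-Δ₀ χ′))) , λ ρ →
        (λ f → S𝒩.Sat-stable φ λ ¬s → proj₁ (h ρ) (return ¬s) λ (w , t) →
          contradiction (proj₁ (Sat-⌜⌝ χ′) (f w) (proj₂ (⟦⟧-reorder χ w ρ) t)) λ ()) ,
        (λ s w → proj₂ (Sat-⌜⌝ χ′) λ t → contradiction
          (λ ¬s → ¬s s) (proj₂ (h ρ) (return (w , proj₁ (⟦⟧-reorder χ w ρ) t))))
    translate-Πₙ {suc m} (Σ⇒Π σ@(Π⇒Σ _)) = let ψ , e , h = translate-Σₙ σ in ψ , Σ⇒Π e , h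
    translate-Πₙ {suc m} (Σ⇒Π σ@(ex _)) = let ψ , e , h = translate-Σₙ σ in ψ , Σ⇒Π e , h
    translate-Πₙ (all {φ = φ} π) =
      let ψ , e , h    = translate-Πₙ π
          ψ′ , e′ , h′ = guard-Πₙ conditional (isNumber _) e in
      ∀′ ψ′ , all e′ , λ ρ →
        (λ f (a , na) → proj₁ (h ((a , na) ∷ ρ)) (proj₁ (h′ _) (f a) (proj₂ (isNumber-⟺ a ρ) na))) ,
        (λ f a → proj₂ (h′ _) λ d →
          let na = proj₁ (isNumber-⟺ a ρ) d in proj₂ (h ((a , na) ∷ ρ)) (f (a , na)))

  𝒩-induction : ∀ {k} {φ : Formula ℒA (suc k)} → Σₙ less (suc n) φ → ∀ ρ →
                (∀ z → Empty (proj₁ z) → Sat 𝒩 φ (z ∷ ρ)) →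
                (∀ x s → Succ (proj₁ x) (proj₁ s) → Sat 𝒩 φ (x ∷ ρ) → Sat 𝒩 φ (s ∷ ρ)) →
                ∀ x → Sat 𝒩 φ (x ∷ ρ)
  𝒩-induction {φ = φ} σ ρ base step (x , nx) = S𝒩.Sat-stable φ do
    p , δ , Nδ ← N-bounded-definable
    let ψ , e , h = translate-Σₙ δ Nδ σ
    -- Elements of the structure carry a proof of numberhood, but P is a predicate on sets; so P
    -- quantifies over all such proofs, on which the translated formula does not depend.
    return (N-induction {P = λ x → ∀ nx → Sat 𝒩 φ ((x , nx) ∷ ρ)}
      (Separable-⟺ (λ x nx →
        (λ s nx′ → proj₁ (h ((x , nx′) ∷ ρ)) s) , (λ f → proj₂ (h ((x , nx) ∷ ρ)) (f nx)))
        (Σₙ-separable ψ e (nums ρ ++ p ∷ [])))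
      (λ s nx → S𝒩.Sat-stable φ (¬¬-map (λ f → f nx) s))
      (λ e e-empty ne → base (e , ne) e-empty)
      (λ x s nx _ sc f ns → step (x , nx) (s , ns) sc (f nx))
      x nx nx)

-- Terms have values only classically.  Passing to singleton predicates turns
-- the function symbols into functions, so that one can reason equationally.

module Points {L : Language} {ℓ} (A : RawStructure L ℓ) (isA : IsStructure A) where
  open RawStructure A
  open IsStructure isA
  open IsEquivalence isEquivalence renaming (refl to ≈-refl; sym to ≈-sym; trans to ≈-trans) using ()
  open Satisfaction A isA

  infix 4 _≃_

  record Point : Set (lsuc ℓ) where
    no-eta-equality
    infix 4 _∋_
    field
      _∋_      : Carrier → Set ℓ
      ∋-total  : ¬ ¬ (∃[ a ] _∋_ a)
      ∋-unique : ∀ {a b} → _∋_ a → _∋_ b → a ≈ b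
      ∋-resp   : ∀ {a b} → a ≈ b → _∋_ a → _∋_ b

  open Point public

  point : Carrier → Point
  point a ._∋_            = a ≈_
  point a .∋-total        = return (a , ≈-refl)
  point a .∋-unique p q   = ≈-trans (≈-sym p) q
  point a .∋-resp e p     = ≈-trans p e

  All∋ : ∀ {m} → Vec Point m → Vec Carrier m → Set ℓ
  All∋ []       []       = Lift ℓ ⊤
  All∋ (x ∷ xs) (a ∷ as) = x ∋ a × All∋ xs as

  All∋-total : ∀ {m} (xs : Vec Point m) → ¬ ¬ (∃[ as ] All∋ xs as)
  All∋-total []       = return ([] , _)
  All∋-total (x ∷ xs) = do
    a , p   ← ∋-total x
    as , ps ← All∋-total xs
    return (a ∷ as , p , ps)

  record _≃_ (x y : Point) : Set ℓ where
    constructor equal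
    field
      same : ∀ {a b} → x ∋ a → y ∋ b → a ≈ b

  open _≃_ public

  record Related {m} (R : Language.Reln L m) (xs : Vec Point m) : Set ℓ where
    constructor related
    field
      relation : ∀ {as} → All∋ xs as → holds R as

  open Related public

  ≃-stable : ∀ {x y} → Stable (x ≃ y)
  ≃-stable s = equal λ p q → ≈-stable (¬¬-map (λ e → same e p q) s)

  ≃-intro : ∀ {x y a b} → x ∋ a → y ∋ b → a ≈ b → x ≃ y
  ≃-intro {x} {y} p q e = equal λ p′ q′ → ≈-trans (∋-unique x p′ p) (≈-trans e (∋-unique y q q′))

  -- Transitivity goes through a representative of the middle point, which exists only classically;
  -- stability of `_≈_` absorbs this.
  ≃-isEquivalence : IsEquivalence _≃_
  ≃-isEquivalence = record
    { refl  = λ {x} → equal (∋-unique x)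
    ; sym   = λ e → equal λ p q → ≈-sym (same e q p)
    ; trans = λ {x} {y} e f → equal λ p r → ≈-stable do
        b , q ← ∋-total y
        return (≈-trans (same e p q) (same f q r)) }

  All∋-≈ : ∀ {m} {xs ys : Vec Point m} {as bs} → Pointwise _≃_ xs ys → All∋ xs as → All∋ ys bs → Pointwise _≈_ as bs
  All∋-≈ {as = []}    {[]}    []       _        _        = []
  All∋-≈ {as = _ ∷ _} {_ ∷ _} (e ∷ es) (p , ps) (q , qs) = same e p q ∷ All∋-≈ es ps qs

  All∋-unique : ∀ {m} {xs : Vec Point m} {as bs} → All∋ xs as → All∋ xs bs → Pointwise _≈_ as bs
  All∋-unique = All∋-≈ (Pointwise.refl (IsEquivalence.refl ≃-isEquivalence))

  Related-intro : ∀ {m} (R : Language.Reln L m) {xs as} → All∋ xs as → holds R as → Related R xs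
  Related-intro R ps h = related λ qs → holds-cong R (All∋-unique ps qs) h

  Related-cong : ∀ {m} (R : Language.Reln L m) {xs ys} → Pointwise _≃_ xs ys → Related R xs → Related R ys
  Related-cong R {xs} es r = related λ qs → holds-stable R do
    as , ps ← All∋-total xs
    return (holds-cong R (All∋-≈ es ps qs) (relation r ps))

  Related-stable : ∀ {m} (R : Language.Reln L m) {xs} → Stable (Related R xs)
  Related-stable R s = related λ ps → holds-stable R (¬¬-map (λ r → relation r ps) s)

  apply : ∀ {m} → Language.Func L m → Vec Point m → Point
  apply f xs ._∋_ b = ∃[ as ] All∋ xs as × graph f as b
  apply f xs .∋-total = do
    as , ps ← All∋-total xs
    b , g   ← graph-total f as
    return (b , as , ps , g)
  apply f xs .∋-unique (as , ps , g) (bs , qs , h) =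
    graph-unique f (graph-cong f (All∋-unique ps qs) ≈-refl g) h
  apply f xs .∋-resp e (as , ps , g) = as , ps , graph-cong f (Pointwise.refl ≈-refl) e g

  apply-cong : ∀ {m} (f : Language.Func L m) {xs ys} → Pointwise _≃_ xs ys → apply f xs ≃ apply f ys
  apply-cong f es = equal λ (as , ps , g) (bs , qs , h) →
    graph-unique f (graph-cong f (All∋-≈ es ps qs) ≈-refl g) h

  mutual
    eval : ∀ {k} → Term L k → Vec Point k → Point
    eval (var i)    xs = lookup xs i
    eval (app f ts) xs = apply f (evals ts xs)

    evals : ∀ {k m} → Vec (Term L k) m → Vec Point k → Vec Point m
    evals []       xs = []
    evals (t ∷ ts) xs = eval t xs ∷ evals ts xs

  All∋-lookup : ∀ {k} {xs : Vec Point k} {ρ} → All∋ xs ρ → ∀ i → lookup xs i ∋ lookup ρ i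
  All∋-lookup {xs = _ ∷ _} {_ ∷ _} (p , _)  zero    = p
  All∋-lookup {xs = _ ∷ _} {_ ∷ _} (_ , ps) (suc i) = All∋-lookup ps i

  module _ {k} {xs : Vec Point k} {ρ : Vec Carrier k} (ps : All∋ xs ρ) where
    mutual
      Value⇒∋ : ∀ t {a} → Value A ρ t a → eval t xs ∋ a
      Value⇒∋ (var i)    (val-var e)              = ∋-resp (lookup xs i) e (All∋-lookup ps i)
      Value⇒∋ (app f ts) (val-app {as = as} vs g) = as , Values⇒∋ ts vs , g

      Values⇒∋ : ∀ {m} (ts : Vec (Term L k) m) {as} → Pointwise (Value A ρ) ts as → All∋ (evals ts xs) as
      Values⇒∋ []       []       = _
      Values⇒∋ (t ∷ ts) (v ∷ vs) = Value⇒∋ t v , Values⇒∋ ts vs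

    mutual
      ∋⇒Value : ∀ t {a} → eval t xs ∋ a → Value A ρ t a
      ∋⇒Value (var i)    q             = val-var (∋-unique (lookup xs i) (All∋-lookup ps i) q)
      ∋⇒Value (app f ts) (as , qs , g) = val-app (∋⇒Values ts qs) g

      ∋⇒Values : ∀ {m} (ts : Vec (Term L k) m) {as} → All∋ (evals ts xs) as → Pointwise (Value A ρ) ts as
      ∋⇒Values []       {[]}    _        = []
      ∋⇒Values (t ∷ ts) {_ ∷ _} (q , qs) = ∋⇒Value t q ∷ ∋⇒Values ts qs

    Sat-≐-⟺ : ∀ t u → Sat A (t ≐ u) ρ ⟺ eval t xs ≃ eval u xs
    Sat-≐-⟺ t u = (λ s → equal λ p q → s _ _ (∋⇒Value t p) (∋⇒Value u q)) ,
                  (λ e a b p q → same e (Value⇒∋ t p) (Value⇒∋ u q))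

    Sat-rel-⟺ : ∀ {m} (R : Language.Reln L m) ts → Sat A (rel R ts) ρ ⟺ Related R (evals ts xs)
    Sat-rel-⟺ R ts = (λ s → related λ qs → s _ (∋⇒Values ts qs)) , (λ r as vs → relation r (Values⇒∋ ts vs))

  points : ∀ {k} → Vec Carrier k → Vec Point k
  points = map point

  points-∋ : ∀ {k} (ρ : Vec Carrier k) → All∋ (points ρ) ρ
  points-∋ []      = _
  points-∋ (a ∷ ρ) = ≈-refl , points-∋ ρ

-- The axioms of PA⁻

module PointArithmetic {ℓ} (A : RawStructure ℒA ℓ) (isA : IsStructure A) where
  open Satisfaction A isA
  open Points A isA public
  open IsEquivalence ≃-isEquivalence public using () renaming (refl to ≃-refl; sym to ≃-sym; trans to ≃-trans)

  infixl 11 _⊗_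
  infixl 10 _⊕_
  infix  4  _≺_

  𝟎 𝟏 : Point
  𝟎 = apply zeroᶠ []
  𝟏 = apply oneᶠ []

  _⊕_ _⊗_ : Point → Point → Point
  x ⊕ y = apply plusᶠ (x ∷ y ∷ [])
  x ⊗ y = apply timesᶠ (x ∷ y ∷ [])

  _≺_ : Point → Point → Set ℓ
  x ≺ y = Related less (x ∷ y ∷ [])

  ≃-setoid : Setoid (lsuc ℓ) ℓ
  ≃-setoid = record { isEquivalence = ≃-isEquivalence }

  ⊕-cong : ∀ {x x′ y y′} → x ≃ x′ → y ≃ y′ → x ⊕ y ≃ x′ ⊕ y′
  ⊕-cong p q = apply-cong plusᶠ (p ∷ q ∷ [])

  ⊗-cong : ∀ {x x′ y y′} → x ≃ x′ → y ≃ y′ → x ⊗ y ≃ x′ ⊗ y′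
  ⊗-cong p q = apply-cong timesᶠ (p ∷ q ∷ [])

  ≺-resp : ∀ {x x′ y y′} → x ≃ x′ → y ≃ y′ → x ≺ y → x′ ≺ y′
  ≺-resp p q = Related-cong less (p ∷ q ∷ [])

  ⊕-congˡ : ∀ {x x′} y → x ≃ x′ → x ⊕ y ≃ x′ ⊕ y
  ⊕-congˡ y p = ⊕-cong p ≃-refl

  ⊕-congʳ : ∀ x {y y′} → y ≃ y′ → x ⊕ y ≃ x ⊕ y′
  ⊕-congʳ x q = ⊕-cong ≃-refl q

  ⊗-congʳ : ∀ x {y y′} → y ≃ y′ → x ⊗ y ≃ x ⊗ y′
  ⊗-congʳ x q = ⊗-cong ≃-refl q

  ≺-stable : ∀ {x y} → Stable (x ≺ y)
  ≺-stable = Related-stable less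

  -- Satisfaction at points: at all, equivalently some, of their representatives.
  SatPoints : ∀ {k} → Formula ℒA k → Vec Point k → Set ℓ
  SatPoints φ xs = ∀ ρ → All∋ xs ρ → Sat A φ ρ

  SatPoints-intro : ∀ {k} (φ : Formula ℒA k) {xs ρ} → All∋ xs ρ → Sat A φ ρ → SatPoints φ xs
  SatPoints-intro φ ps s _ qs =
    Sat-cong φ (All∋-unique ps qs) s

  -- The interface between set theory and algebra: recursion equations, a discrete linear order with
  -- least element 0, and Δ₀-induction. PA⁻ is derived from these alone.
  record DiscreteArithmetic : Set (lsuc ℓ) where
    field
      ⊕-identityʳ     : ∀ x → x ⊕ 𝟎 ≃ x
      ⊕-suc           : ∀ x y → x ⊕ (y ⊕ 𝟏) ≃ (x ⊕ y) ⊕ 𝟏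
      ⊗-zeroʳ         : ∀ x → x ⊗ 𝟎 ≃ 𝟎
      ⊗-suc           : ∀ x y → x ⊗ (y ⊕ 𝟏) ≃ x ⊗ y ⊕ x
      ≺-trans         : ∀ x y z → x ≺ y → y ≺ z → x ≺ z
      ≺-irrefl        : ∀ x → ¬ x ≺ x
      ≺-trichotomy    : ∀ x y → ¬ ¬ (x ≺ y ⊎ ¬ ¬ (x ≃ y ⊎ y ≺ x))
      ⊀𝟎              : ∀ x → ¬ x ≺ 𝟎
      ≺-suc           : ∀ x → x ≺ x ⊕ 𝟏
      ≺⇒suc≼          : ∀ x y → x ≺ y → ¬ ¬ (x ⊕ 𝟏 ≺ y ⊎ x ⊕ 𝟏 ≃ y)
      point-induction : ∀ {k} {φ : Formula ℒA (suc k)} → Δ₀ less φ → ∀ xs →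
                        SatPoints φ (𝟎 ∷ xs) → (∀ x → SatPoints φ (x ∷ xs) → SatPoints φ (x ⊕ 𝟏 ∷ xs)) →
                        ∀ x → SatPoints φ (x ∷ xs)

module PeanoAxioms {ℓ} (A : RawStructure ℒA ℓ) (isA : IsStructure A)
                   (facts : PointArithmetic.DiscreteArithmetic A isA) where
  open Satisfaction A isA
  open PointArithmetic A isA
  open DiscreteArithmetic facts
  open RawStructure A using (Carrier)
  open IsEquivalence (IsStructure.isEquivalence isA) using () renaming (refl to ≈-refl)
  open SetoidReasoning ≃-setoid

  -- The terms t and u present the equation as an atomic formula with parameters xs, as induction
  -- requires; `eval` then computes to the intended expressions on points.
  ≃-induction : ∀ {k} (t u : Term ℒA (suc k)) xs → eval t (𝟎 ∷ xs) ≃ eval u (𝟎 ∷ xs) →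
                (∀ x → eval t (x ∷ xs) ≃ eval u (x ∷ xs) → eval t (x ⊕ 𝟏 ∷ xs) ≃ eval u (x ⊕ 𝟏 ∷ xs)) →
                ∀ x → eval t (x ∷ xs) ≃ eval u (x ∷ xs)
  ≃-induction t u xs base step x = elim x (point-induction (eq t u) xs (intro 𝟎 base)
    (λ x s → intro (x ⊕ 𝟏) (step x (elim x s))) x)
    where
    intro : ∀ x → eval t (x ∷ xs) ≃ eval u (x ∷ xs) → SatPoints (t ≐ u) (x ∷ xs)
    intro x e ρ ps = proj₂ (Sat-≐-⟺ {xs = x ∷ xs} ps t u) e

    elim : ∀ x → SatPoints (t ≐ u) (x ∷ xs) → eval t (x ∷ xs) ≃ eval u (x ∷ xs)
    elim x s = ≃-stable do
      ρ , ps ← All∋-total (x ∷ xs)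
      return (proj₁ (Sat-≐-⟺ {xs = x ∷ xs} ps t u) (s ρ ps))

  ≺-induction : ∀ {k} (t u : Term ℒA (suc k)) xs → eval t (𝟎 ∷ xs) ≺ eval u (𝟎 ∷ xs) →
                (∀ x → eval t (x ∷ xs) ≺ eval u (x ∷ xs) → eval t (x ⊕ 𝟏 ∷ xs) ≺ eval u (x ⊕ 𝟏 ∷ xs)) →
                ∀ x → eval t (x ∷ xs) ≺ eval u (x ∷ xs)
  ≺-induction t u xs base step x = elim x (point-induction (atom less (t ∷ u ∷ [])) xs (intro 𝟎 base)
    (λ x s → intro (x ⊕ 𝟏) (step x (elim x s))) x)
    where
    intro : ∀ x → eval t (x ∷ xs) ≺ eval u (x ∷ xs) → SatPoints (t <′ u) (x ∷ xs)
    intro x e ρ ps = proj₂ (Sat-rel-⟺ {xs = x ∷ xs} ps less (t ∷ u ∷ [])) e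

    elim : ∀ x → SatPoints (t <′ u) (x ∷ xs) → eval t (x ∷ xs) ≺ eval u (x ∷ xs)
    elim x s = ≺-stable do
      ρ , ps ← All∋-total (x ∷ xs)
      return (proj₁ (Sat-rel-⟺ {xs = x ∷ xs} ps less (t ∷ u ∷ [])) (s ρ ps))

  -- Commutative semiring laws

  ⊕-identityˡ : ∀ x → 𝟎 ⊕ x ≃ x
  ⊕-identityˡ = ≃-induction (0′ +′ v 0) (v 0) [] (⊕-identityʳ 𝟎) λ x ih → begin
    𝟎 ⊕ (x ⊕ 𝟏)   ≈⟨ ⊕-suc 𝟎 x ⟩
    (𝟎 ⊕ x) ⊕ 𝟏   ≈⟨ ⊕-congˡ 𝟏 ih ⟩
    x ⊕ 𝟏         ∎

  suc-⊕ : ∀ x y → (x ⊕ 𝟏) ⊕ y ≃ (x ⊕ y) ⊕ 𝟏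
  suc-⊕ x = ≃-induction ((v 1 +′ 1′) +′ v 0) ((v 1 +′ v 0) +′ 1′) (x ∷ [])
    (begin
      (x ⊕ 𝟏) ⊕ 𝟎   ≈⟨ ⊕-identityʳ (x ⊕ 𝟏) ⟩
      x ⊕ 𝟏         ≈⟨ ⊕-congˡ 𝟏 (⊕-identityʳ x) ⟨
      (x ⊕ 𝟎) ⊕ 𝟏   ∎)
    λ y ih → begin
      (x ⊕ 𝟏) ⊕ (y ⊕ 𝟏)   ≈⟨ ⊕-suc (x ⊕ 𝟏) y ⟩
      ((x ⊕ 𝟏) ⊕ y) ⊕ 𝟏   ≈⟨ ⊕-congˡ 𝟏 ih ⟩
      ((x ⊕ y) ⊕ 𝟏) ⊕ 𝟏   ≈⟨ ⊕-congˡ 𝟏 (⊕-suc x y) ⟨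
      (x ⊕ (y ⊕ 𝟏)) ⊕ 𝟏   ∎

  ⊕-comm : ∀ x y → x ⊕ y ≃ y ⊕ x
  ⊕-comm x = ≃-induction (v 1 +′ v 0) (v 0 +′ v 1) (x ∷ [])
    (≃-trans (⊕-identityʳ x) (≃-sym (⊕-identityˡ x)))
    λ y ih → begin
      x ⊕ (y ⊕ 𝟏)   ≈⟨ ⊕-suc x y ⟩
      (x ⊕ y) ⊕ 𝟏   ≈⟨ ⊕-congˡ 𝟏 ih ⟩
      (y ⊕ x) ⊕ 𝟏   ≈⟨ suc-⊕ y x ⟨
      (y ⊕ 𝟏) ⊕ x   ∎

  ⊕-assoc : ∀ x y z → (x ⊕ y) ⊕ z ≃ x ⊕ (y ⊕ z)
  ⊕-assoc x y = ≃-induction ((v 1 +′ v 2) +′ v 0) (v 1 +′ (v 2 +′ v 0)) (x ∷ y ∷ [])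
    (begin
      (x ⊕ y) ⊕ 𝟎   ≈⟨ ⊕-identityʳ (x ⊕ y) ⟩
      x ⊕ y         ≈⟨ ⊕-congʳ x (⊕-identityʳ y) ⟨
      x ⊕ (y ⊕ 𝟎)   ∎)
    λ z ih → begin
      (x ⊕ y) ⊕ (z ⊕ 𝟏)   ≈⟨ ⊕-suc (x ⊕ y) z ⟩
      ((x ⊕ y) ⊕ z) ⊕ 𝟏   ≈⟨ ⊕-congˡ 𝟏 ih ⟩
      (x ⊕ (y ⊕ z)) ⊕ 𝟏   ≈⟨ ⊕-suc x (y ⊕ z) ⟨
      x ⊕ ((y ⊕ z) ⊕ 𝟏)   ≈⟨ ⊕-congʳ x (⊕-suc y z) ⟨
      x ⊕ (y ⊕ (z ⊕ 𝟏))   ∎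

  ⊕-swap : ∀ x y z → (x ⊕ y) ⊕ z ≃ (x ⊕ z) ⊕ y
  ⊕-swap x y z = begin
    (x ⊕ y) ⊕ z   ≈⟨ ⊕-assoc x y z ⟩
    x ⊕ (y ⊕ z)   ≈⟨ ⊕-congʳ x (⊕-comm y z) ⟩
    x ⊕ (z ⊕ y)   ≈⟨ ⊕-assoc x z y ⟨
    (x ⊕ z) ⊕ y   ∎

  ⊗-zeroˡ : ∀ x → 𝟎 ⊗ x ≃ 𝟎
  ⊗-zeroˡ = ≃-induction (0′ ·′ v 0) 0′ [] (⊗-zeroʳ 𝟎) λ x ih → begin
    𝟎 ⊗ (x ⊕ 𝟏)   ≈⟨ ⊗-suc 𝟎 x ⟩
    𝟎 ⊗ x ⊕ 𝟎     ≈⟨ ⊕-identityʳ (𝟎 ⊗ x) ⟩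
    𝟎 ⊗ x         ≈⟨ ih ⟩
    𝟎             ∎

  suc-⊗ : ∀ x y → (x ⊕ 𝟏) ⊗ y ≃ x ⊗ y ⊕ y
  suc-⊗ x = ≃-induction ((v 1 +′ 1′) ·′ v 0) (v 1 ·′ v 0 +′ v 0) (x ∷ [])
    (begin
      (x ⊕ 𝟏) ⊗ 𝟎   ≈⟨ ⊗-zeroʳ (x ⊕ 𝟏) ⟩
      𝟎             ≈⟨ ⊗-zeroʳ x ⟨
      x ⊗ 𝟎         ≈⟨ ⊕-identityʳ (x ⊗ 𝟎) ⟨
      x ⊗ 𝟎 ⊕ 𝟎     ∎)
    λ y ih → begin
      (x ⊕ 𝟏) ⊗ (y ⊕ 𝟏)           ≈⟨ ⊗-suc (x ⊕ 𝟏) y ⟩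
      (x ⊕ 𝟏) ⊗ y ⊕ (x ⊕ 𝟏)       ≈⟨ ⊕-suc ((x ⊕ 𝟏) ⊗ y) x ⟩
      ((x ⊕ 𝟏) ⊗ y ⊕ x) ⊕ 𝟏       ≈⟨ ⊕-congˡ 𝟏 (⊕-congˡ x ih) ⟩
      ((x ⊗ y ⊕ y) ⊕ x) ⊕ 𝟏       ≈⟨ ⊕-congˡ 𝟏 (⊕-swap (x ⊗ y) y x) ⟩
      ((x ⊗ y ⊕ x) ⊕ y) ⊕ 𝟏       ≈⟨ ⊕-suc (x ⊗ y ⊕ x) y ⟨
      (x ⊗ y ⊕ x) ⊕ (y ⊕ 𝟏)       ≈⟨ ⊕-congˡ (y ⊕ 𝟏) (⊗-suc x y) ⟨
      x ⊗ (y ⊕ 𝟏) ⊕ (y ⊕ 𝟏)       ∎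

  ⊗-comm : ∀ x y → x ⊗ y ≃ y ⊗ x
  ⊗-comm x = ≃-induction (v 1 ·′ v 0) (v 0 ·′ v 1) (x ∷ [])
    (≃-trans (⊗-zeroʳ x) (≃-sym (⊗-zeroˡ x)))
    λ y ih → begin
      x ⊗ (y ⊕ 𝟏)   ≈⟨ ⊗-suc x y ⟩
      x ⊗ y ⊕ x     ≈⟨ ⊕-congˡ x ih ⟩
      y ⊗ x ⊕ x     ≈⟨ suc-⊗ y x ⟨
      (y ⊕ 𝟏) ⊗ x   ∎

  ⊗-distribˡ-⊕ : ∀ x y z → x ⊗ (y ⊕ z) ≃ x ⊗ y ⊕ x ⊗ z
  ⊗-distribˡ-⊕ x y = ≃-induction (v 1 ·′ (v 2 +′ v 0)) (v 1 ·′ v 2 +′ v 1 ·′ v 0) (x ∷ y ∷ [])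
    (begin
      x ⊗ (y ⊕ 𝟎)     ≈⟨ ⊗-congʳ x (⊕-identityʳ y) ⟩
      x ⊗ y           ≈⟨ ⊕-identityʳ (x ⊗ y) ⟨
      x ⊗ y ⊕ 𝟎       ≈⟨ ⊕-congʳ (x ⊗ y) (⊗-zeroʳ x) ⟨
      x ⊗ y ⊕ x ⊗ 𝟎   ∎)
    λ z ih → begin
      x ⊗ (y ⊕ (z ⊕ 𝟏))       ≈⟨ ⊗-congʳ x (⊕-suc y z) ⟩
      x ⊗ ((y ⊕ z) ⊕ 𝟏)       ≈⟨ ⊗-suc x (y ⊕ z) ⟩
      x ⊗ (y ⊕ z) ⊕ x         ≈⟨ ⊕-congˡ x ih ⟩
      (x ⊗ y ⊕ x ⊗ z) ⊕ x     ≈⟨ ⊕-assoc (x ⊗ y) (x ⊗ z) x ⟩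
      x ⊗ y ⊕ (x ⊗ z ⊕ x)     ≈⟨ ⊕-congʳ (x ⊗ y) (⊗-suc x z) ⟨
      x ⊗ y ⊕ x ⊗ (z ⊕ 𝟏)     ∎

  ⊗-assoc : ∀ x y z → (x ⊗ y) ⊗ z ≃ x ⊗ (y ⊗ z)
  ⊗-assoc x y = ≃-induction ((v 1 ·′ v 2) ·′ v 0) (v 1 ·′ (v 2 ·′ v 0)) (x ∷ y ∷ [])
    (begin
      (x ⊗ y) ⊗ 𝟎   ≈⟨ ⊗-zeroʳ (x ⊗ y) ⟩
      𝟎             ≈⟨ ⊗-zeroʳ x ⟨
      x ⊗ 𝟎         ≈⟨ ⊗-congʳ x (⊗-zeroʳ y) ⟨
      x ⊗ (y ⊗ 𝟎)   ∎)
    λ z ih → begin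
      (x ⊗ y) ⊗ (z ⊕ 𝟏)         ≈⟨ ⊗-suc (x ⊗ y) z ⟩
      (x ⊗ y) ⊗ z ⊕ x ⊗ y       ≈⟨ ⊕-congˡ (x ⊗ y) ih ⟩
      x ⊗ (y ⊗ z) ⊕ x ⊗ y       ≈⟨ ⊗-distribˡ-⊕ x (y ⊗ z) y ⟨
      x ⊗ (y ⊗ z ⊕ y)           ≈⟨ ⊗-congʳ x (⊗-suc y z) ⟨
      x ⊗ (y ⊗ (z ⊕ 𝟏))         ∎

  ⊗-identityʳ : ∀ x → x ⊗ 𝟏 ≃ x
  ⊗-identityʳ x = begin
    x ⊗ 𝟏         ≈⟨ ⊗-congʳ x (⊕-identityˡ 𝟏) ⟨
    x ⊗ (𝟎 ⊕ 𝟏)   ≈⟨ ⊗-suc x 𝟎 ⟩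
    x ⊗ 𝟎 ⊕ x     ≈⟨ ⊕-congˡ x (⊗-zeroʳ x) ⟩
    𝟎 ⊕ x         ≈⟨ ⊕-identityˡ x ⟩
    x             ∎

  -- Order, subtraction and monotonicity

  ≺-respˡ : ∀ {x x′} y → x ≃ x′ → x ≺ y → x′ ≺ y
  ≺-respˡ y p = ≺-resp p ≃-refl

  ≺-respʳ : ∀ x {y y′} → y ≃ y′ → x ≺ y → x ≺ y′
  ≺-respʳ x p = ≺-resp ≃-refl p

  𝟎≼ : ∀ x → ¬ ¬ (𝟎 ≺ x ⊎ 𝟎 ≃ x)
  𝟎≼ x = ≺-trichotomy 𝟎 x >>= λ
    { (inj₁ h) → return (inj₁ h)
    ; (inj₂ h) → h >>= λ
      { (inj₁ e) → return (inj₂ e)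
      ; (inj₂ h) → contradiction h (⊀𝟎 x) } }

  𝟎≺suc : ∀ x → 𝟎 ≺ x ⊕ 𝟏
  𝟎≺suc x = ≺-stable do
    inj₁ h ← 𝟎≼ (x ⊕ 𝟏)
      where inj₂ e → contradiction (≺-respʳ x (≃-sym e) (≺-suc x)) (⊀𝟎 x)
    return h

  suc-mono-≺ : ∀ x y → x ≺ y → x ⊕ 𝟏 ≺ y ⊕ 𝟏
  suc-mono-≺ x y h = ≺-stable do
    inj₁ k ← ≺⇒suc≼ x y h
      where inj₂ e → return (≺-respˡ (y ⊕ 𝟏) (≃-sym e) (≺-suc y))
    return (≺-trans (x ⊕ 𝟏) y (y ⊕ 𝟏) k (≺-suc y))

  -- Writing a positive summand as y + 1 makes positivity part of the term, so the induction formula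
  -- is atomic.
  x≺x⊕suc : ∀ x y → x ≺ x ⊕ (y ⊕ 𝟏)
  x≺x⊕suc x = ≺-induction (v 1) (v 1 +′ (v 0 +′ 1′)) (x ∷ [])
    (≺-respʳ x (⊕-congʳ x (≃-sym (⊕-identityˡ 𝟏))) (≺-suc x))
    λ y ih → ≺-respʳ x (≃-sym (⊕-suc x (y ⊕ 𝟏)))
      (≺-trans x (x ⊕ (y ⊕ 𝟏)) ((x ⊕ (y ⊕ 𝟏)) ⊕ 𝟏) ih (≺-suc (x ⊕ (y ⊕ 𝟏))))

  y≺x⊕suc : ∀ x y → y ≺ x ⊕ (y ⊕ 𝟏)
  y≺x⊕suc x = ≺-induction (v 0) (v 1 +′ (v 0 +′ 1′)) (x ∷ [])
    (≺-respʳ 𝟎 (⊕-congʳ x (≃-sym (⊕-identityˡ 𝟏))) (𝟎≺suc x))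
    λ y ih → ≺-respʳ (y ⊕ 𝟏) (≃-sym (⊕-suc x (y ⊕ 𝟏)))
      (suc-mono-≺ y (x ⊕ (y ⊕ 𝟏)) ih)

  -- Otherwise x ⊕ z ≺ y for all z, by induction, and z = y + 1 is absurd.
  ≺⇒∃ : ∀ x y → x ≺ y → ¬ ¬ (∃[ z ] x ⊕ (z ⊕ 𝟏) ≃ y)
  ≺⇒∃ x y x≺y none = ≺-irrefl y (≺-trans y (x ⊕ (y ⊕ 𝟏)) y (y≺x⊕suc x y) (below (y ⊕ 𝟏)))
    where
    below : ∀ z → x ⊕ z ≺ y
    below = ≺-induction (v 1 +′ v 0) (v 2) (x ∷ y ∷ [])
      (≺-respˡ y (≃-sym (⊕-identityʳ x)) x≺y)
      λ z ih → ≺-stable do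
        inj₁ h ← ≺⇒suc≼ (x ⊕ z) y ih
          where inj₂ e → contradiction (z , ≃-trans (⊕-suc x z) e) none
        return (≺-respˡ y (≃-sym (⊕-suc x z)) h)

  ⊕-monoˡ-≺ : ∀ x y z → x ≺ y → x ⊕ z ≺ y ⊕ z
  ⊕-monoˡ-≺ x y z x≺y = ≺-stable do
    w , e ← ≺⇒∃ x y x≺y
    return (≺-respʳ (x ⊕ z) (begin
      (x ⊕ z) ⊕ (w ⊕ 𝟏)   ≈⟨ ⊕-swap x z (w ⊕ 𝟏) ⟩
      (x ⊕ (w ⊕ 𝟏)) ⊕ z   ≈⟨ ⊕-congˡ z e ⟩
      y ⊕ z               ∎) (x≺x⊕suc (x ⊕ z) w))

  -- With z = u + 1 and y = x + (w + 1), the product y · z exceeds x · z by z · w + z = (z · w + u)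
  -- + 1, which is positive.
  ⊗-monoˡ-≺ : ∀ x y z → 𝟎 ≺ z → x ≺ y → x ⊗ z ≺ y ⊗ z
  ⊗-monoˡ-≺ x y z 𝟎≺z x≺y = ≺-stable do
    u , d ← ≺⇒∃ 𝟎 z 𝟎≺z
    w , e ← ≺⇒∃ x y x≺y
    return (≺-respʳ (x ⊗ z) (begin
      x ⊗ z ⊕ ((z ⊗ w ⊕ u) ⊕ 𝟏)     ≈⟨ ⊕-congʳ (x ⊗ z) (⊕-suc (z ⊗ w) u) ⟨
      x ⊗ z ⊕ (z ⊗ w ⊕ (u ⊕ 𝟏))     ≈⟨ ⊕-congʳ (x ⊗ z) (⊕-congʳ (z ⊗ w) (⊕-identityˡ (u ⊕ 𝟏))) ⟨
      x ⊗ z ⊕ (z ⊗ w ⊕ (𝟎 ⊕ (u ⊕ 𝟏))) ≈⟨ ⊕-congʳ (x ⊗ z) (⊕-congʳ (z ⊗ w) d) ⟩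
      x ⊗ z ⊕ (z ⊗ w ⊕ z)           ≈⟨ ⊕-congʳ (x ⊗ z) (⊗-suc z w) ⟨
      x ⊗ z ⊕ z ⊗ (w ⊕ 𝟏)           ≈⟨ ⊕-congˡ (z ⊗ (w ⊕ 𝟏)) (⊗-comm x z) ⟩
      z ⊗ x ⊕ z ⊗ (w ⊕ 𝟏)           ≈⟨ ⊗-distribˡ-⊕ z x (w ⊕ 𝟏) ⟨
      z ⊗ (x ⊕ (w ⊕ 𝟏))             ≈⟨ ⊗-congʳ z e ⟩
      z ⊗ y                         ≈⟨ ⊗-comm z y ⟩
      y ⊗ z                         ∎) (x≺x⊕suc (x ⊗ z) (z ⊗ w ⊕ u)))

  module _ {k} (ρ : Vec Carrier k) where

    Sat-≃ : ∀ t u → Sat A (t ≐ u) ρ ⟺ eval t (points ρ) ≃ eval u (points ρ)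
    Sat-≃ = Sat-≐-⟺ {xs = points ρ} (points-∋ ρ)

    Sat-≺ : ∀ t u → Sat A (t <′ u) ρ ⟺ eval t (points ρ) ≺ eval u (points ρ)
    Sat-≺ t u = Sat-rel-⟺ {xs = points ρ} (points-∋ ρ) less (t ∷ u ∷ [])

  ⊨PA⁻ : A ⊨ PA⁻
  ⊨PA⁻ _ +-assoc = proj₂ (Sat-close {k = 3} ((v 0 +′ v 1) +′ v 2 ≐ v 0 +′ (v 1 +′ v 2)))
    λ { ρ@(a ∷ b ∷ c ∷ []) → proj₂ (Sat-≃ ρ ((v 0 +′ v 1) +′ v 2) (v 0 +′ (v 1 +′ v 2))) (⊕-assoc (point a) (point b) (point c)) }
  ⊨PA⁻ _ +-comm = proj₂ (Sat-close {k = 2} (v 0 +′ v 1 ≐ v 1 +′ v 0))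
    λ { ρ@(a ∷ b ∷ []) → proj₂ (Sat-≃ ρ (v 0 +′ v 1) (v 1 +′ v 0)) (⊕-comm (point a) (point b)) }
  ⊨PA⁻ _ ·-assoc = proj₂ (Sat-close {k = 3} ((v 0 ·′ v 1) ·′ v 2 ≐ v 0 ·′ (v 1 ·′ v 2)))
    λ { ρ@(a ∷ b ∷ c ∷ []) → proj₂ (Sat-≃ ρ ((v 0 ·′ v 1) ·′ v 2) (v 0 ·′ (v 1 ·′ v 2))) (⊗-assoc (point a) (point b) (point c)) }
  ⊨PA⁻ _ ·-comm = proj₂ (Sat-close {k = 2} (v 0 ·′ v 1 ≐ v 1 ·′ v 0))
    λ { ρ@(a ∷ b ∷ []) → proj₂ (Sat-≃ ρ (v 0 ·′ v 1) (v 1 ·′ v 0)) (⊗-comm (point a) (point b)) }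
  ⊨PA⁻ _ ·-distrib = proj₂ (Sat-close {k = 3} (v 0 ·′ (v 1 +′ v 2) ≐ v 0 ·′ v 1 +′ v 0 ·′ v 2))
    λ { ρ@(a ∷ b ∷ c ∷ []) → proj₂ (Sat-≃ ρ (v 0 ·′ (v 1 +′ v 2)) (v 0 ·′ v 1 +′ v 0 ·′ v 2))
        (⊗-distribˡ-⊕ (point a) (point b) (point c)) }
  ⊨PA⁻ _ +-identity = proj₂ (Sat-close {k = 1} (v 0 +′ 0′ ≐ v 0))
    λ { ρ@(a ∷ []) → proj₂ (Sat-≃ ρ (v 0 +′ 0′) (v 0)) (⊕-identityʳ (point a)) }
  ⊨PA⁻ _ ·-zero = proj₂ (Sat-close {k = 1} (v 0 ·′ 0′ ≐ 0′))
    λ { ρ@(a ∷ []) → proj₂ (Sat-≃ ρ (v 0 ·′ 0′) 0′) (⊗-zeroʳ (point a)) }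
  ⊨PA⁻ _ ·-identity = proj₂ (Sat-close {k = 1} (v 0 ·′ 1′ ≐ v 0))
    λ { ρ@(a ∷ []) → proj₂ (Sat-≃ ρ (v 0 ·′ 1′) (v 0)) (⊗-identityʳ (point a)) }
  ⊨PA⁻ _ <-trans = proj₂ (Sat-close {k = 3} (v 0 <′ v 1 ∧′ v 1 <′ v 2 ⇒ v 0 <′ v 2))
    λ { ρ@(a ∷ b ∷ c ∷ []) (s , t) → proj₂ (Sat-≺ ρ (v 0) (v 2)) (≺-trans (point a) (point b) (point c)
        (proj₁ (Sat-≺ ρ (v 0) (v 1)) s) (proj₁ (Sat-≺ ρ (v 1) (v 2)) t)) }
  ⊨PA⁻ _ <-irrefl = proj₂ (Sat-close {k = 1} (¬′ (v 0 <′ v 0)))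
    λ { ρ@(a ∷ []) s → contradiction (proj₁ (Sat-≺ ρ (v 0) (v 0)) s) (≺-irrefl (point a)) }
  ⊨PA⁻ _ <-total = proj₂ (Sat-close {k = 2} (v 0 <′ v 1 ∨′ v 0 ≐ v 1 ∨′ v 1 <′ v 0))
    λ { ρ@(a ∷ b ∷ []) → ¬¬-map ([ inj₁ ∘ proj₂ (Sat-≺ ρ (v 0) (v 1)) , inj₂ ∘ ¬¬-map
        ([ inj₁ ∘ proj₂ (Sat-≃ ρ (v 0) (v 1)) , inj₂ ∘ proj₂ (Sat-≺ ρ (v 1) (v 0)) ]) ])
        (≺-trichotomy (point a) (point b)) }
  ⊨PA⁻ _ +-mono = proj₂ (Sat-close {k = 3} (v 0 <′ v 1 ⇒ v 0 +′ v 2 <′ v 1 +′ v 2))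
    λ { ρ@(a ∷ b ∷ c ∷ []) s → proj₂ (Sat-≺ ρ (v 0 +′ v 2) (v 1 +′ v 2))
        (⊕-monoˡ-≺ (point a) (point b) (point c) (proj₁ (Sat-≺ ρ (v 0) (v 1)) s)) }
  ⊨PA⁻ _ ·-mono = proj₂ (Sat-close {k = 3} (0′ <′ v 2 ∧′ v 0 <′ v 1 ⇒ v 0 ·′ v 2 <′ v 1 ·′ v 2))
    λ { ρ@(a ∷ b ∷ c ∷ []) (s , t) → proj₂ (Sat-≺ ρ (v 0 ·′ v 2) (v 1 ·′ v 2))
        (⊗-monoˡ-≺ (point a) (point b) (point c) (proj₁ (Sat-≺ ρ 0′ (v 2)) s) (proj₁ (Sat-≺ ρ (v 0) (v 1)) t)) }
  ⊨PA⁻ _ subtract = proj₂ (Sat-close {k = 2} (v 0 <′ v 1 ⇒ ∃′ (v 1 +′ v 0 ≐ v 2)))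
    λ { ρ@(a ∷ b ∷ []) s → do
        z , e ← ≺⇒∃ (point a) (point b) (proj₁ (Sat-≺ ρ (v 0) (v 1)) s)
        -- The axiom asks for an element, so a representative of the difference z + 1 is chosen.
        c , p ← ∋-total (z ⊕ 𝟏)
        return (c , proj₂ (Sat-≃ (c ∷ ρ) (v 1 +′ v 0) (v 2)) (≃-trans
          (⊕-congʳ (point a) (≃-intro {point c} {z ⊕ 𝟏} ≈-refl p ≈-refl)) e)) }
  ⊨PA⁻ _ 0<1 = proj₂ (Sat-≺ [] 0′ 1′) (≺-respʳ 𝟎 (⊕-identityˡ 𝟏) (≺-suc 𝟎))
  ⊨PA⁻ _ discrete = proj₂ (Sat-close {k = 1} (0′ <′ v 0 ⇒ 1′ ≤′ v 0))
    λ { ρ@(a ∷ []) s → ¬¬-map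
        [ inj₁ ∘ proj₂ (Sat-≺ ρ 1′ (v 0)) ∘ ≺-respˡ (point a) (⊕-identityˡ 𝟏)
        , inj₂ ∘ proj₂ (Sat-≃ ρ 1′ (v 0)) ∘ ≃-trans (≃-sym (⊕-identityˡ 𝟏)) ]
        (≺⇒suc≼ 𝟎 (point a) (proj₁ (Sat-≺ ρ 0′ (v 0)) s)) }
  ⊨PA⁻ _ nonneg = proj₂ (Sat-close {k = 1} (0′ ≤′ v 0))
    λ { ρ@(a ∷ []) → ¬¬-map [ inj₁ ∘ proj₂ (Sat-≺ ρ 0′ (v 0)) , inj₂ ∘ proj₂ (Sat-≃ ρ 0′ (v 0)) ] (𝟎≼ (point a)) }

-- The numbers satisfy PA⁻ and Σₙ-induction

module Axioms {ℓ} (M : RawStructure ℒ∈ ℓ) (isS : IsStructure M)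
              (n : ℕ) (M⊨ : M ⊨ (ReS₀ ∪ Sep (Σₙ mem (suc n)))) where
  open InductionScheme M isS n M⊨
  open PointArithmetic 𝒩 𝒩-isStructure

  graph-plus-⟺ : ∀ {a b c : Num} → RawStructure.graph 𝒩 plusᶠ (a ∷ b ∷ []) c ⟺ Plus (proj₁ a) (proj₁ b) (proj₁ c)
  graph-plus-⟺ = ¬¬-⟺ (∃-⟺ λ W → Sat-⌜⌝ plusᵇ)

  graph-times-⟺ : ∀ {a b c : Num} → RawStructure.graph 𝒩 timesᶠ (a ∷ b ∷ []) c ⟺ Times (proj₁ a) (proj₁ b) (proj₁ c)
  graph-times-⟺ = ¬¬-⟺ (∃-⟺ λ W → Sat-⌜⌝ timesᵇ)

  𝟎-∋ : ∀ z → 𝟎 ∋ z ⟺ Empty (proj₁ z)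
  𝟎-∋ _ = (λ { ([] , _ , g) → proj₁ (Sat-⌜⌝ (emptyᵇ zero)) g }) , (λ e → [] , _ , proj₂ (Sat-⌜⌝ (emptyᵇ zero)) e)

  ⊕-∋ : ∀ x y {a b c} → x ∋ a → y ∋ b → Plus (proj₁ a) (proj₁ b) (proj₁ c) → (x ⊕ y) ∋ c
  ⊕-∋ x y {a} {b} {c} p q h = (a ∷ b ∷ []) , (p , q , _) , proj₂ (graph-plus-⟺ {a} {b} {c}) h

  ⊗-∋ : ∀ x y {a b c} → x ∋ a → y ∋ b → Times (proj₁ a) (proj₁ b) (proj₁ c) → (x ⊗ y) ∋ c
  ⊗-∋ x y {a} {b} {c} p q h = (a ∷ b ∷ []) , (p , q , _) , proj₂ (graph-times-⟺ {a} {b} {c}) h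

  -- One is the successor of zero, so one step of the recursion leads from a + 0 = a to the
  -- successor of a. Through this, facts about `Succ` become facts about adding one.
  ⊕𝟏-∋ : ∀ x {a s} → x ∋ a → Succ (proj₁ a) (proj₁ s) → ¬ ¬ ((x ⊕ 𝟏) ∋ s)
  ⊕𝟏-∋ x {a} {s} p sc = do
    o , o-nat , h ← One-exists
    e , _ , e-empty , eo ← h
    return (⊕-∋ x 𝟏 {a} {o , o-nat} {s} p ([] , _ , proj₂ (Sat-⌜⌝ oneᵇ) h) (Plus-suc (Plus-zero e-empty) eo sc))

  Succ-exists𝒩 : ∀ (a : Num) → ¬ ¬ (Σ[ s ∈ Num ] Succ (proj₁ a) (proj₁ s))
  Succ-exists𝒩 (a , na) = do
    s , sc ← Succ-exists a
    return ((s , N-suc sc na) , sc)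

  ≃-intro′ : ∀ x y {a} → x ∋ a → y ∋ a → x ≃ y
  ≃-intro′ x y {a} p q = ≃-intro {x} {y} p q (≈𝒩-refl {a})

  ⊕-identityʳ : ∀ x → x ⊕ 𝟎 ≃ x
  ⊕-identityʳ x = ≃-stable do
    a , p ← ∋-total x
    e , h ← empty-exists
    return (≃-intro′ (x ⊕ 𝟎) x {a} (⊕-∋ x 𝟎 {a} {e , N-zero h} {a} p (proj₂ (𝟎-∋ (e , N-zero h)) h) (Plus-zero h)) p)

  ⊕-suc : ∀ x y → x ⊕ (y ⊕ 𝟏) ≃ (x ⊕ y) ⊕ 𝟏
  ⊕-suc x y = ≃-stable do
    a , p ← ∋-total x
    b , q ← ∋-total y
    c , nc , h ← Plus-total (proj₂ a) (proj₂ b)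
    s , sb ← Succ-exists𝒩 b
    t , tc ← Succ-exists𝒩 (c , nc)
    y+1 ← ⊕𝟏-∋ y {b} {s} q sb
    r ← ⊕𝟏-∋ (x ⊕ y) {c , nc} {t} (⊕-∋ x y {a} {b} {c , nc} p q h) tc
    return (≃-intro′ (x ⊕ (y ⊕ 𝟏)) ((x ⊕ y) ⊕ 𝟏) {t} (⊕-∋ x (y ⊕ 𝟏) {a} {s} {t} p y+1 (Plus-suc h sb tc)) r)

  ⊗-zeroʳ : ∀ x → x ⊗ 𝟎 ≃ 𝟎
  ⊗-zeroʳ x = ≃-stable do
    a , p ← ∋-total x
    e , h ← empty-exists
    let z = e , N-zero h
    return (≃-intro′ (x ⊗ 𝟎) 𝟎 {z} (⊗-∋ x 𝟎 {a} {z} {z} p (proj₂ (𝟎-∋ z) h) (Times-zero h h)) (proj₂ (𝟎-∋ z) h))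

  ⊗-suc : ∀ x y → x ⊗ (y ⊕ 𝟏) ≃ x ⊗ y ⊕ x
  ⊗-suc x y = ≃-stable do
    a , p ← ∋-total x
    b , q ← ∋-total y
    c , nc , h ← Times-total (proj₂ a) (proj₂ b)
    d , nd , k ← Plus-total nc (proj₂ a)
    s , sb ← Succ-exists𝒩 b
    y+1 ← ⊕𝟏-∋ y {b} {s} q sb
    return (≃-intro′ (x ⊗ (y ⊕ 𝟏)) (x ⊗ y ⊕ x) {d , nd} (⊗-∋ x (y ⊕ 𝟏) {a} {s} {d , nd} p y+1 (Times-suc h sb k))
      (⊕-∋ (x ⊗ y) x {c , nc} {a} {d , nd} (⊗-∋ x y {a} {b} {c , nc} p q h) p k))

  ≺-∋ : ∀ x y {a b} → x ∋ a → y ∋ b → x ≺ y ⟺ proj₁ a ∈ proj₁ b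
  ≺-∋ x y {a} {b} p q =
    (λ r → proj₁ (Sat-∈ _ _) (relation r {a ∷ b ∷ []} (p , q , _))) ,
    (λ h → Related-intro less {x ∷ y ∷ []} {a ∷ b ∷ []} (p , q , _) (proj₂ (Sat-∈ _ _) h))

  ≃-intro-≈ : ∀ x y {a b} → x ∋ a → y ∋ b → proj₁ a ≈ proj₁ b → x ≃ y
  ≃-intro-≈ x y {a} {b} p q e = ≃-intro {x} {y} {a} {b} p q (proj₂ (Sat-≈ _ _) e)

  ≺-trans : ∀ x y z → x ≺ y → y ≺ z → x ≺ z
  ≺-trans x y z r s = ≺-stable do
    a , p ← ∋-total x
    b , q ← ∋-total y
    c , t ← ∋-total z
    return (proj₂ (≺-∋ x z p t) (N-transitive (proj₂ c) _ (proj₁ (≺-∋ y z q t) s) _ (proj₁ (≺-∋ x y p q) r)))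

  ≺-irrefl : ∀ x → ¬ x ≺ x
  ≺-irrefl x r = ∋-total x λ (a , p) → ∈-irrefl (proj₂ a) (proj₁ (≺-∋ x x p p) r)

  ≺-trichotomy : ∀ x y → ¬ ¬ (x ≺ y ⊎ ¬ ¬ (x ≃ y ⊎ y ≺ x))
  ≺-trichotomy x y = do
    a , p ← ∋-total x
    b , q ← ∋-total y
    trichotomy (proj₂ a) (proj₂ b) >>= λ
      { (inj₁ h) → return (inj₁ (proj₂ (≺-∋ x y p q) h))
      ; (inj₂ h) → return (inj₂ (¬¬-map [ inj₁ ∘ ≃-intro-≈ x y p q , inj₂ ∘ proj₂ (≺-∋ y x q p) ] h)) }

  ⊀𝟎 : ∀ x → ¬ x ≺ 𝟎
  ⊀𝟎 x r = (do
    a , p ← ∋-total x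
    e , h ← empty-exists
    contradiction (h _ (proj₁ (≺-∋ x 𝟎 {a} {e , N-zero h} p (proj₂ (𝟎-∋ (e , N-zero h)) h)) r)) λ ()) id

  ≺-suc : ∀ x → x ≺ x ⊕ 𝟏
  ≺-suc x = ≺-stable do
    a , p ← ∋-total x
    s , sc ← Succ-exists𝒩 a
    q ← ⊕𝟏-∋ x {a} {s} p sc
    return (proj₂ (≺-∋ x (x ⊕ 𝟏) {a} {s} p q) (proj₁ sc))

  ≺⇒suc≼ : ∀ x y → x ≺ y → ¬ ¬ (x ⊕ 𝟏 ≺ y ⊎ x ⊕ 𝟏 ≃ y)
  ≺⇒suc≼ x y r = do
    a , p ← ∋-total x
    b , q ← ∋-total y
    s , sc ← Succ-exists𝒩 a
    t ← ⊕𝟏-∋ x {a} {s} p sc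
    N-next (proj₂ b) (proj₁ a) (proj₁ (≺-∋ x y p q) r) >>= λ
      { (inj₁ sb) → return (inj₂ (≃-intro-≈ (x ⊕ 𝟏) y {s} {b} t q (Succ-unique sc sb)))
      ; (inj₂ h) → do
          s′ , s′∈b , sc′ ← h
          return (inj₁ (proj₂ (≺-∋ (x ⊕ 𝟏) y {s} {b} t q) (∈-cong (Succ-unique sc′ sc) ≈-refl s′∈b))) }

  -- Representatives of the parameters are fixed, which leaves an induction on numbers; each number
  -- y reached by it re-enters as `point y` to use the hypothesis on points.
  point-induction : ∀ {k} {φ : Formula ℒA (suc k)} → Δ₀ less φ → ∀ xs →
                    SatPoints φ (𝟎 ∷ xs) → (∀ x → SatPoints φ (x ∷ xs) → SatPoints φ (x ⊕ 𝟏 ∷ xs)) →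
                    ∀ x → SatPoints φ (x ∷ xs)
  point-induction {φ = φ} d xs base step x (a ∷ ρ) (p , ps) =
    𝒩-induction (Σ₁⊆Σₙ n (Π⇒Σ (Δ₀⇒Π d))) ρ
      (λ z e → base (z ∷ ρ) (proj₂ (𝟎-∋ z) e , ps))
      (λ y s sc h → S𝒩.Sat-stable φ do
        q ← ⊕𝟏-∋ (point y) {y} {s} (≈𝒩-refl {y}) sc
        return (step (point y) (SatPoints-intro φ {ρ = y ∷ ρ} (≈𝒩-refl {y} , ps) h) (s ∷ ρ) (q , ps)))
      a

  𝒩⊨PA⁻ : 𝒩 ⊨ PA⁻
  𝒩⊨PA⁻ = PeanoAxioms.⊨PA⁻ 𝒩 𝒩-isStructure record
    { ⊕-identityʳ     = ⊕-identityʳ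
    ; ⊕-suc           = ⊕-suc
    ; ⊗-zeroʳ         = ⊗-zeroʳ
    ; ⊗-suc           = ⊗-suc
    ; ≺-trans         = ≺-trans
    ; ≺-irrefl        = ≺-irrefl
    ; ≺-trichotomy    = ≺-trichotomy
    ; ⊀𝟎              = ⊀𝟎
    ; ≺-suc           = ≺-suc
    ; ≺⇒suc≼          = ≺⇒suc≼
    ; point-induction = point-induction }

  -- The axiom speaks of the terms 0 and x + 1, `𝒩-induction` of empty sets and successors. The
  -- latter are values of the former, so the substitution lemma connects the two.
  𝒩⊨Ind : 𝒩 ⊨ Ind (Σₙ less (suc n))
  𝒩⊨Ind _ (ind {φ = φ} σ) = proj₂ (S𝒩.Sat-close
    (φ [ 0′ ▹ var ] ∧′ ∀′ (φ ⇒ φ [ (v 0 +′ 1′) ▹ (λ i → var (suc i)) ]) ⇒ ∀′ φ))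
    λ ρ (base , step) → 𝒩-induction σ ρ
      (λ z e → proj₁ (Sat-subst′ (0′ ▹ var) (λ
        { zero    → ∋⇒Value {xs = points ρ} (points-∋ ρ) 0′ (proj₂ (𝟎-∋ z) e)
        ; (suc i) → val-var (≈𝒩-refl {lookup ρ i}) })) base)
      (λ x s sc h → S𝒩.Sat-stable φ do
        q ← ⊕𝟏-∋ (point x) {x} {s} (≈𝒩-refl {x}) sc
        return (proj₁ (Sat-subst′ ((v 0 +′ 1′) ▹ (λ i → var (suc i))) (λ
          { zero    → ∋⇒Value {xs = points (x ∷ ρ)} (points-∋ (x ∷ ρ)) (v 0 +′ 1′) q
          ; (suc i) → val-var (≈𝒩-refl {lookup ρ i}) })) (step x h)))
    where
    Sat-subst′ : ∀ {m} {ρ : Vec Num m} σ {ρ′} → S𝒩.Values-of ρ σ ρ′ → Sat 𝒩 (φ [ σ ]) ρ ⟺ Sat 𝒩 φ ρ′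
    Sat-subst′ σ = S𝒩.Sat-subst φ {σ = σ}

theorem4p3 : (n : ℕ) → 1 ≤ n → (ReS₀ ∪ Sep (Σₙ mem n)) Interprets (IΣ n)
theorem4p3 (suc n) (s≤s _) = record
  { interpretation = arithmetic
  ; isStructure    = λ M isS M⊨ → Model.𝒩-isStructure M isS n M⊨
  ; isModel        = λ M isS M⊨ φ → let open Axioms M isS n M⊨ in [ 𝒩⊨PA⁻ φ , 𝒩⊨Ind φ ]
  }
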